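{- Let $k\in\{4,5,6\}$ and $n\geq 2k$. Then \[ m(n,k,3)=|\mathcal{G}(n,k)|=\binom{n-1}{k-1}-\binom{n-k}{k-1}-\binom{n-k-1}{k-1}+\binom{n-2k}{k-1}+\binom{n-k-2}{k-3}+3 . \]
   Context: $[n]=\{1,\dots,n\}$, $[a,b]=\{i: a\le i\le b\}$, and $\binom{X}{k}$ is the family of $k$-element subsets of $X$. A family $\mathcal{F}\subset\binom{[n]}{k}$ is intersecting if $F\cap F'\neq\emptyset$ for all $F,F'\in\mathcal{F}$. A set $T\subset[n]$ is a cover of $\mathcal{F}$ if $T\cap F\ne\emptyset$ for all $F\in\mathcal{F}$; the covering number $\tau(\mathcal{F})$ is the minimum size of a cover. For $1\le r\le k$, $m(n,k,r)$ is the maximum of $|\mathcal{F}|$ over intersecting $\mathcal{F}\subset\binom{[n]}{k}$ with $\tau(\mathcal{F})\ge r$. The family $\mathcal{G}(n,k)=\mathcal{A}\cup\mathcal{B}$ where $\mathcal{B}=\{[2,k+1],\ \{2\}\cup[k+2,2k],\ \{3\}\cup[k+2,2k]\}$ and $\mathcal{A}=\{A\in\binom{[n]}{k}: 1\in A,\ A\cap B\ne\emptyset \text{ for each } B\in\mathcal{B}\}$; for $n\ge 2k$ it is an intersecting family with covering number $3$. -}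

module Defs where

open import Data.Bool using (Bool; true; false; _∧_; _∨_)
open import Data.Nat using (ℕ; zero; suc; _≤ᵇ_; _≡ᵇ_; _<_; _≤_; _∸_; _+_; _*_)
import Data.Nat as ℕ
open import Data.Nat.Combinatorics using (_C_)
open import Data.Integer using (ℤ; +_; _-_) renaming (_+_ to _+ℤ_)
open import Data.Fin using (Fin; toℕ)
open import Data.Fin.Subset using (Subset; _∈_; _∩_; ∣_∣; Nonempty)
open import Data.Fin.Subset.Properties using (_∈?_; nonempty?)
open import Data.Vec using (Vec; []; _∷_; tabulate)
open import Data.List using (List; []; _∷_; _++_; map; filter; length)
open import Data.List.Membership.Propositional using () renaming (_∈_ to _∈ₗ_)
open import Data.List.Relation.Unary.All using (All)
open import Data.List.Relation.Unary.Unique.Propositional using (Unique)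
open import Data.Product using (_×_; ∃; Σ)
open import Relation.Nullary using (¬_; Dec)
open import Relation.Nullary.Decidable using (_×-dec_)
open import Relation.Binary.PropositionalEquality using (_≡_)

-- Convention: the ground set [n] = {1,…,n} is represented by Fin n,
-- the element i ∈ [n] being the Fin n value with toℕ = i - 1.
-- Subsets of [n] are Data.Fin.Subset.Subset n; a family of subsets is a
-- duplicate-free list of subsets (its size is the length of the list).

allSubsets : (n : ℕ) → List (Subset n)
allSubsets zero = [] ∷ []
allSubsets (suc n) = map (true ∷_) (allSubsets n) ++ map (false ∷_) (allSubsets n)

fromPred : (n : ℕ) → (ℕ → Bool) → Subset n
fromPred n p = tabulate (λ x → p (suc (toℕ x)))

inRange : ℕ → ℕ → ℕ → Bool
inRange a b i = (a ≤ᵇ i) ∧ (i ≤ᵇ b)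

B₁ B₂ B₃ : (n k : ℕ) → Subset n
B₁ n k = fromPred n (inRange 2 (k + 1))
B₂ n k = fromPred n (λ i → (i ≡ᵇ 2) ∨ inRange (k + 2) (2 * k) i)
B₃ n k = fromPred n (λ i → (i ≡ᵇ 3) ∨ inRange (k + 2) (2 * k) i)

one : (n : ℕ) → Subset n → Set
one zero A = ¬ (0 ≡ 0)   -- [0] has no element 1
one (suc n) A = Fin.zero ∈ A
  where import Data.Fin as Fin

one? : (n : ℕ) (A : Subset n) → Dec (one n A)
one? zero A = Relation.Nullary.no (λ f → f _≡_.refl)
  where import Relation.Nullary
one? (suc n) A = Data.Fin.zero ∈? A

InA : (n k : ℕ) → Subset n → Set
InA n k A = one n A × ∣ A ∣ ≡ k × Nonempty (A ∩ B₁ n k)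
            × Nonempty (A ∩ B₂ n k) × Nonempty (A ∩ B₃ n k)

InA? : (n k : ℕ) (A : Subset n) → Dec (InA n k A)
InA? n k A = one? n A ×-dec (∣ A ∣ ℕ.≟ k) ×-dec nonempty? (A ∩ B₁ n k)
             ×-dec nonempty? (A ∩ B₂ n k) ×-dec nonempty? (A ∩ B₃ n k)

-- 𝒢(n,k) = 𝒜 ∪ ℬ (disjoint, since 1 ∉ B for B ∈ ℬ)
𝒢 : (n k : ℕ) → List (Subset n)
𝒢 n k = filter (InA? n k) (allSubsets n) ++ (B₁ n k ∷ B₂ n k ∷ B₃ n k ∷ [])

Intersecting : {n : ℕ} → List (Subset n) → Set
Intersecting ℱ = ∀ {F G} → F ∈ₗ ℱ → G ∈ₗ ℱ → Nonempty (F ∩ G)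

IsCover : {n : ℕ} → Subset n → List (Subset n) → Set
IsCover T ℱ = ∀ {F} → F ∈ₗ ℱ → Nonempty (T ∩ F)

CoverNumberAtLeast : {n : ℕ} → ℕ → List (Subset n) → Set
CoverNumberAtLeast {n} r ℱ = (T : Subset n) → ∣ T ∣ < r → ¬ IsCover T ℱ

Admissible : (n k r : ℕ) → List (Subset n) → Set
Admissible n k r ℱ = Unique ℱ × All (λ F → ∣ F ∣ ≡ k) ℱ
                     × Intersecting ℱ × CoverNumberAtLeast r ℱ

IsM : (n k r v : ℕ) → Set
IsM n k r v = (∃ λ ℱ → Admissible n k r ℱ × length ℱ ≡ v)
              × (∀ ℱ → Admissible n k r ℱ → length ℱ ≤ v)

formula : (n k : ℕ) → ℤ
formula n k = + ((n ∸ 1) C (k ∸ 1)) - + ((n ∸ k) C (k ∸ 1)) - + ((n ∸ k ∸ 1) C (k ∸ 1))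
              +ℤ + ((n ∸ 2 * k) C (k ∸ 1)) +ℤ + ((n ∸ k ∸ 2) C (k ∸ 3)) +ℤ + 3

{-# OPTIONS --safe #-}
module Submission where

-- Shifting i ← j with i in a 2k-set Y and j outside it either preserves τ ≥ 3 or exposes a cover {i, j, z}
-- of size three. In the latter case all k-sets containing the cover may be added to the family, and two or
-- three such covers, which pairwise intersect, are enough to protect a witness of τ ≥ 3 inside a suitable Y
-- from all further shifts. So one may assume that any two members meet inside a fixed 2k-set Y. The family
-- is then counted by the sizes i of the traces on Y: the k-sets by complementation in Y, and the i-sets with
-- i < k according to whether the traces have a common point (count the i-sets through x missing a member
-- that avoids x), are covered by two points (a bound for non-empty cross-intersecting families, proved by
-- the same shifting and counting), or have covering number at least three (induction on i). Level by level
-- the bound is the number of traces of 𝒢(n, k).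

open import Defs
open import Data.Bool using (Bool; true; false; _∧_; _∨_; if_then_else_)
import Data.Bool.Properties as Boolₚ
open import Data.Nat using (ℕ; zero; suc; _+_; _*_; _∸_; _≤_; _<_; z≤n; s≤s; s≤s⁻¹; _≤?_; _<?_)
import Data.Nat as ℕ
open import Data.Nat.Properties hiding (_≟_)
open import Data.Nat.Induction using (<-wellFounded)
open import Data.Nat.Solver using (module +-*-Solver)
open import Data.Nat.Combinatorics using (_C_; nCk+nC[k+1]≡[n+1]C[k+1]; k>n⇒nCk≡0; nCk≡nC[n∸k]; nCn≡1)
open import Data.Fin using (Fin; zero; suc; toℕ; fromℕ<; _≟_)
open import Data.Fin.Properties using (any?; all?; ¬∀⟶∃¬; toℕ-fromℕ<)
open import Data.Fin.Subset
open import Data.Fin.Subset.Properties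
open import Data.Vec using ([]; _∷_; lookup; tabulate; here; there)
open import Data.Vec.Properties using (≡-dec; lookup∘tabulate; []=⇒lookup; lookup⇒[]=)
open import Data.List using (List; []; _∷_; length; _++_; map; filter)
open import Data.List.Properties using (length-++; filter-++)
open import Data.List.Membership.Propositional using () renaming (_∈_ to _∈ₗ_)
open import Data.List.Membership.Propositional.Properties using (∈-++⁺ˡ; ∈-++⁺ʳ; ∈-++⁻; ∈-filter⁺; ∈-filter⁻; ∈-map⁺; ∈-map⁻)
import Data.List.Membership.DecPropositional as DecMembership
open import Data.List.Relation.Unary.Any using (here; there)
open import Data.List.Relation.Unary.All using (All; []; _∷_)
import Data.List.Relation.Unary.All as All
open import Data.List.Relation.Unary.AllPairs using ([]; _∷_)
open import Data.List.Relation.Unary.Unique.Propositional using (Unique)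
import Data.List.Relation.Unary.Unique.Propositional.Properties as Uniqueₚ
open import Data.Product using (_×_; _,_; proj₁; proj₂; Σ; ∃)
open import Data.Sum using (_⊎_; inj₁; inj₂; [_,_]′)
open import Data.Empty using (⊥-elim) renaming (⊥ to ∅)
open import Data.Unit using (tt)
open import Function using (_∘_; case_of_)
open import Induction.WellFounded using (Acc; acc)
open import Relation.Nullary using (¬_; Dec; yes; no; does)
open import Relation.Nullary.Decidable using (_×-dec_; _⊎-dec_; ¬?; map′; dec-true; dec-false; True; toWitness)
open import Relation.Unary using (Decidable)
open import Relation.Binary.Definitions using (tri<; tri≈; tri>)
open import Relation.Binary.PropositionalEquality

-- Comparing with 𝒢(n, k) separately for each trace size works because the comparison takes place
-- inside a fixed 2k-set: `n` drops out, and for each `k` finitely many inequalities between numbers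
-- remain. The star count is exact for 𝒢, whose three sets in ℬ attain it. The other two cases are
-- bounded by cruder means and only have to stay below that count; this is checked numerically, and
-- it is here that `k ≤ 6` enters, while `4 ≤ k` gives the room for the exchanges during the
-- shifting. The tightest point is `k = 4` with traces of size 3: the allowance is 13, but the
-- argument through cross-intersecting families would give 14 for traces covered by two points.
-- Triples are therefore counted by codegrees, which yields 13 there. In the reduction, the
-- difficulty is that a single 2k-set must contain the covers found so far together with enough
-- members to refute every pair `i`, `z` that a later shift might turn into a cover; the cases with
-- one, two and three covers differ in how these members are found.

private variable
  n m : ℕ

resolveˡ : {A B : Set} → ¬ A → A ⊎ B → B
resolveˡ ¬a = [ ⊥-elim ∘ ¬a , (λ b → b) ]′

resolveʳ : {A B : Set} → ¬ B → A ⊎ B → A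
resolveʳ ¬b = [ (λ a → a) , ⊥-elim ∘ ¬b ]′

-- Cardinalities of subsets

∈─⁻ : ∀ {x : Fin n} (p q : Subset n) → x ∈ p ─ q → x ∈ p × x ∉ q
∈─⁻ (true ∷ p) (false ∷ q) here = here , λ ()
∈─⁻ (y ∷ p) (false ∷ q) (there h) = there (proj₁ (∈─⁻ p q h)) , λ { (there u) → proj₂ (∈─⁻ p q h) u }
∈─⁻ (y ∷ p) (true ∷ q) (there h) = there (proj₁ (∈─⁻ p q h)) , λ { (there u) → proj₂ (∈─⁻ p q h) u }

∣∩∣+∣─∣ : ∀ (p q : Subset n) → ∣ p ∩ q ∣ + ∣ p ─ q ∣ ≡ ∣ p ∣
∣∩∣+∣─∣ [] [] = refl
∣∩∣+∣─∣ (true ∷ p) (true ∷ q) = cong suc (∣∩∣+∣─∣ p q)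
∣∩∣+∣─∣ (true ∷ p) (false ∷ q) = trans (+-suc ∣ p ∩ q ∣ ∣ p ─ q ∣) (cong suc (∣∩∣+∣─∣ p q))
∣∩∣+∣─∣ (false ∷ p) (true ∷ q) = ∣∩∣+∣─∣ p q
∣∩∣+∣─∣ (false ∷ p) (false ∷ q) = ∣∩∣+∣─∣ p q

∣∪∣+∣∩∣ : ∀ (p q : Subset n) → ∣ p ∪ q ∣ + ∣ p ∩ q ∣ ≡ ∣ p ∣ + ∣ q ∣
∣∪∣+∣∩∣ [] [] = refl
∣∪∣+∣∩∣ (true ∷ p) (true ∷ q) = cong suc (trans (+-suc ∣ p ∪ q ∣ ∣ p ∩ q ∣)
  (trans (cong suc (∣∪∣+∣∩∣ p q)) (sym (+-suc ∣ p ∣ ∣ q ∣))))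
∣∪∣+∣∩∣ (true ∷ p) (false ∷ q) = cong suc (∣∪∣+∣∩∣ p q)
∣∪∣+∣∩∣ (false ∷ p) (true ∷ q) = trans (cong suc (∣∪∣+∣∩∣ p q)) (sym (+-suc ∣ p ∣ ∣ q ∣))
∣∪∣+∣∩∣ (false ∷ p) (false ∷ q) = ∣∪∣+∣∩∣ p q

∣∪∣≤ : ∀ (p q : Subset n) → ∣ p ∪ q ∣ ≤ ∣ p ∣ + ∣ q ∣
∣∪∣≤ p q = ≤-trans (m≤m+n ∣ p ∪ q ∣ ∣ p ∩ q ∣) (≤-reflexive (∣∪∣+∣∩∣ p q))

∣∪∣-disjoint : ∀ (p q : Subset n) → (∀ {x} → x ∈ p → x ∉ q) → ∣ p ∪ q ∣ ≡ ∣ p ∣ + ∣ q ∣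
∣∪∣-disjoint {n} p q d = trans (sym (+-identityʳ ∣ p ∪ q ∣)) (trans (cong (∣ p ∪ q ∣ +_) (sym (trans (cong ∣_∣ empty) (∣⊥∣≡0 n)))) (∣∪∣+∣∩∣ p q))
  where
  empty : p ∩ q ≡ ⊥
  empty = ⊆-antisym (λ h → let a , b = x∈p∩q⁻ p q h in ⊥-elim (d a b)) ⊥⊆

∣─∣-⊆ : ∀ (p q : Subset n) → q ⊆ p → ∣ p ─ q ∣ + ∣ q ∣ ≡ ∣ p ∣
∣─∣-⊆ p q s = trans (+-comm ∣ p ─ q ∣ ∣ q ∣)
  (trans (cong (λ z → ∣ z ∣ + ∣ p ─ q ∣) (⊆-antisym (λ h → x∈p∩q⁺ (s h , h)) (p∩q⊆q p q))) (∣∩∣+∣─∣ p q))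

∣-∣-∈ : ∀ (p : Subset n) {x} → x ∈ p → suc ∣ p - x ∣ ≡ ∣ p ∣
∣-∣-∈ p {x} h = trans (+-comm 1 _) (trans (cong (∣ p - x ∣ +_) (sym (∣⁅x⁆∣≡1 x)))
  (∣─∣-⊆ p ⁅ x ⁆ (λ y∈ → subst (_∈ p) (sym (x∈⁅y⁆⇒x≡y x y∈)) h)))

∈-⁻ : ∀ (p : Subset n) {x y} → y ∈ p - x → y ∈ p × y ≢ x
∈-⁻ p {x} h = proj₁ (∈─⁻ p ⁅ x ⁆ h) , λ { refl → proj₂ (∈─⁻ p ⁅ x ⁆ h) (x∈⁅x⁆ x) }

∈-⁺ : ∀ (p : Subset n) {x y} → y ∈ p → y ≢ x → y ∈ p - x
∈-⁺ p {x} h ne = x∈p∧x∉q⇒x∈p─q h (λ u → ne (x∈⁅y⁆⇒x≡y x u))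

∃-∈ : ∀ (p : Subset n) → 0 < ∣ p ∣ → ∃ λ x → x ∈ p
∃-∈ (true ∷ p) h = zero , here
∃-∈ (false ∷ p) h = let x , x∈ = ∃-∈ p h in suc x , there x∈

∣p∣<∣q∣⇒∃ : ∀ (p q : Subset n) → ∣ p ∣ < ∣ q ∣ → ∃ λ x → x ∈ q × x ∉ p
∣p∣<∣q∣⇒∃ p q h =
  let x , x∈ = ∃-∈ (q ─ p) (+-cancelˡ-< ∣ q ∩ p ∣ _ _ (subst₂ _<_ (sym (+-identityʳ _)) (sym (∣∩∣+∣─∣ q p))
                 (≤-<-trans (∣p∩q∣≤∣q∣ q p) h)))
  in x , ∈─⁻ q p x∈

∃-superset : ∀ (p q : Subset n) k → p ⊆ q → ∣ p ∣ ≤ k → k ≤ ∣ q ∣ → ∃ λ r → p ⊆ r × r ⊆ q × ∣ r ∣ ≡ k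
∃-superset [] [] k s a z≤n = [] , s , s , refl
∃-superset (true ∷ p) (false ∷ q) k s a b = case s here of λ ()
∃-superset (true ∷ p) (true ∷ q) (suc k) s (s≤s a) (s≤s b) =
  let r , s₁ , s₂ , e = ∃-superset p q k (drop-∷-⊆ s) a b in true ∷ r , s⊆s s₁ , s⊆s s₂ , cong suc e
∃-superset (false ∷ p) (false ∷ q) k s a b =
  let r , s₁ , s₂ , e = ∃-superset p q k (drop-∷-⊆ s) a b in false ∷ r , s⊆s s₁ , s⊆s s₂ , e
∃-superset (false ∷ p) (true ∷ q) k s a b with k ≤? ∣ q ∣
... | yes b′ = let r , s₁ , s₂ , e = ∃-superset p q k (drop-∷-⊆ s) a b′ in false ∷ r , s⊆s s₁ , out⊆ s₂ , e
... | no ¬b = true ∷ q , out⊆ (drop-∷-⊆ s) , ⊆-refl , ≤-antisym (≰⇒> ¬b) b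

∃-subset : ∀ (q : Subset n) k → k ≤ ∣ q ∣ → ∃ λ r → r ⊆ q × ∣ r ∣ ≡ k
∃-subset {n} q k b =
  let r , _ , s , e = ∃-superset ⊥ q k ⊥⊆ (≤-trans (≤-reflexive (∣⊥∣≡0 n)) z≤n) b in r , s , e

x∈p⇒1≤∣p∣ : ∀ {x} {p : Subset n} → x ∈ p → 1 ≤ ∣ p ∣
x∈p⇒1≤∣p∣ {p = p} h = subst (1 ≤_) (∣-∣-∈ p h) (s≤s z≤n)

⊆∧∣∣⇒≡ : ∀ (p q : Subset n) → p ⊆ q → ∣ q ∣ ≤ ∣ p ∣ → p ≡ q
⊆∧∣∣⇒≡ p q s h = ⊆-antisym s λ {x} x∈q → case x ∈? p of λ
  { (yes x∈p) → x∈p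
  ; (no x∉p) → ⊥-elim (<⇒≱ (p⊂q⇒∣p∣<∣q∣ (s , x , x∈q , x∉p)) h) }

Meets : Subset n → Subset n → Set
Meets p q = ∃ λ x → x ∈ p × x ∈ q

meets? : (p q : Subset n) → Dec (Meets p q)
meets? p q = any? (λ x → (x ∈? p) ×-dec (x ∈? q))

-- Sums and counts over all subsets

infix 4 _≟ₛ_
_≟ₛ_ : (X Y : Subset n) → Dec (X ≡ Y)
_≟ₛ_ = ≡-dec Boolₚ._≟_

ind : {P : Set} → Dec P → ℕ
ind d = if does d then 1 else 0

ind-yes : {P : Set} (d : Dec P) → P → ind d ≡ 1
ind-yes d h rewrite dec-true d h = refl

ind-no : {P : Set} (d : Dec P) → ¬ P → ind d ≡ 0
ind-no d h rewrite dec-false d h = refl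

ind-mono : {P Q : Set} (d : Dec P) (e : Dec Q) → (P → Q) → ind d ≤ ind e
ind-mono (yes p) e f = ≤-reflexive (sym (ind-yes e (f p)))
ind-mono (no _) e f = z≤n

sumS : (Subset n → ℕ) → ℕ
sumS {zero} f = f []
sumS {suc n} f = sumS (f ∘ (true ∷_)) + sumS (f ∘ (false ∷_))

sumS-mono : {f g : Subset n → ℕ} → (∀ X → f X ≤ g X) → sumS f ≤ sumS g
sumS-mono {zero} h = h []
sumS-mono {suc n} h = +-mono-≤ (sumS-mono (h ∘ (true ∷_))) (sumS-mono (h ∘ (false ∷_)))

sumS-mono-< : {f g : Subset n → ℕ} → (∀ X → f X ≤ g X) → ∀ X → f X < g X → sumS f < sumS g
sumS-mono-< {zero} h [] l = l
sumS-mono-< {suc n} h (true ∷ X) l = +-mono-<-≤ (sumS-mono-< (h ∘ (true ∷_)) X l) (sumS-mono (h ∘ (false ∷_)))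
sumS-mono-< {suc n} h (false ∷ X) l = +-mono-≤-< (sumS-mono (h ∘ (true ∷_))) (sumS-mono-< (h ∘ (false ∷_)) X l)

sumS-cong : {f g : Subset n → ℕ} → (∀ X → f X ≡ g X) → sumS f ≡ sumS g
sumS-cong h = ≤-antisym (sumS-mono (≤-reflexive ∘ h)) (sumS-mono (≤-reflexive ∘ sym ∘ h))

+-interchange : ∀ a b c d → (a + b) + (c + d) ≡ (a + c) + (b + d)
+-interchange = solve 4 (λ a b c d → (a :+ b) :+ (c :+ d) := (a :+ c) :+ (b :+ d)) refl
  where open +-*-Solver using (solve; _:=_; _:+_; con)

sumS-+ : (f g : Subset n → ℕ) → sumS (λ X → f X + g X) ≡ sumS f + sumS g
sumS-+ {zero} f g = refl
sumS-+ {suc n} f g = trans (cong₂ _+_ (sumS-+ (f ∘ (true ∷_)) (g ∘ (true ∷_))) (sumS-+ (f ∘ (false ∷_)) (g ∘ (false ∷_))))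
  (+-interchange (sumS (f ∘ (true ∷_))) _ _ _)

sumS-0 : sumS {n} (λ _ → 0) ≡ 0
sumS-0 {zero} = refl
sumS-0 {suc n} = cong₂ _+_ (sumS-0 {n}) (sumS-0 {n})

sumS-swap : (f : Subset n → Subset m → ℕ) → sumS (λ X → sumS (f X)) ≡ sumS (λ Z → sumS (λ X → f X Z))
sumS-swap {zero} f = refl
sumS-swap {suc n} f = trans (cong₂ _+_ (sumS-swap (f ∘ (true ∷_))) (sumS-swap (f ∘ (false ∷_))))
  (sym (sumS-+ (λ Z → sumS (λ X → f (true ∷ X) Z)) (λ Z → sumS (λ X → f (false ∷ X) Z))))

at : {P : Set} → Dec P → ℕ → ℕ
at d c = if does d then c else 0

at-cong : {P Q : Set} (d : Dec P) (e : Dec Q) {a b : ℕ} → (P → Q) → (Q → P) → a ≡ b → at d a ≡ at e b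
at-cong (yes p) e f g eq rewrite dec-true e (f p) = eq
at-cong (no ¬p) e f g eq rewrite dec-false e (¬p ∘ g) = refl

sumS-at : (W : Subset n) (f : Subset n → ℕ) → sumS (λ Z → at (Z ≟ₛ W) (f Z)) ≡ f W
sumS-at [] f = refl
sumS-at {suc n} (true ∷ W) f = trans (cong (sumS (λ Z → at (Z ≟ₛ W) (f (true ∷ Z))) +_) (sumS-0 {n}))
  (trans (+-identityʳ _) (sumS-at W (f ∘ (true ∷_))))
sumS-at {suc n} (false ∷ W) f = trans (cong (_+ sumS (λ Z → at (Z ≟ₛ W) (f (false ∷ Z)))) (sumS-0 {n}))
  (sumS-at W (f ∘ (false ∷_)))

-- Writing `f (σ X)` as a sum over `Z` concentrated at `Z ≡ σ X` and exchanging the sums turns the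
-- condition into `X ≡ σ Z`, so no enumeration of the subsets has to be permuted.
sumS-involution : (σ : Subset n → Subset n) → (∀ X → σ (σ X) ≡ X) → (f : Subset n → ℕ) → sumS (f ∘ σ) ≡ sumS f
sumS-involution σ inv f = trans (sumS-cong λ X → sym (sumS-at (σ X) f))
  (trans (sumS-swap (λ X Z → at (Z ≟ₛ σ X) (f Z)))
    (sumS-cong λ Z → trans
      (sumS-cong λ X → at-cong (Z ≟ₛ σ X) (X ≟ₛ σ Z) (λ e → trans (sym (inv X)) (cong σ (sym e)))
                                                     (λ e → trans (sym (inv Z)) (cong σ (sym e))) refl)
      (sumS-at (σ Z) (λ _ → f Z))))

infixl 5 _&∈_ _&∉_

_&∈_ : {P : Subset n → Set} → Decidable P → (u : Fin n) → Decidable (λ S → P S × u ∈ S)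
(P? &∈ u) S = P? S ×-dec (u ∈? S)

_&∉_ : {P : Subset n → Set} → Decidable P → (u : Fin n) → Decidable (λ S → P S × u ∉ S)
(P? &∉ u) S = P? S ×-dec ¬? (u ∈? S)

abstract

  # : {P : Subset n → Set} → Decidable P → ℕ
  # P? = sumS (λ X → ind (P? X))

  #-sumS : {P : Subset n → Set} (P? : Decidable P) → # P? ≡ sumS (λ X → ind (P? X))
  #-sumS P? = refl

module _ {P Q : Subset n → Set} (P? : Decidable P) (Q? : Decidable Q) where

  abstract

    #-mono : (∀ X → P X → Q X) → # P? ≤ # Q?
    #-mono h = sumS-mono λ X → ind-mono (P? X) (Q? X) (h X)

    #-cong : (∀ X → P X → Q X) → (∀ X → Q X → P X) → # P? ≡ # Q?
    #-cong h g = ≤-antisym (#-mono h) (sumS-mono λ X → ind-mono (Q? X) (P? X) (g X))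

    #-∪ : {R : Subset n → Set} (R? : Decidable R) → (∀ X → R X → P X ⊎ Q X) → # R? ≤ # P? + # Q?
    #-∪ R? h = subst (# R? ≤_) (sumS-+ (ind ∘ P?) (ind ∘ Q?)) (sumS-mono λ X → lem X (R? X) (h X))
      where
      lem : ∀ X {R : Set} (d : Dec R) → (R → P X ⊎ Q X) → ind d ≤ ind (P? X) + ind (Q? X)
      lem X (no _) _ = z≤n
      lem X (yes r) h with h r
      ... | inj₁ p rewrite dec-true (P? X) p = s≤s z≤n
      ... | inj₂ q rewrite dec-true (Q? X) q = m≤n+m 1 (ind (P? X))

    #-⊎ : {R : Subset n → Set} (R? : Decidable R) → (∀ X → P X → R X) → (∀ X → Q X → R X) →
          (∀ X → P X → ¬ Q X) → # P? + # Q? ≤ # R?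
    #-⊎ R? h g d = subst (_≤ # R?) (sumS-+ (ind ∘ P?) (ind ∘ Q?)) (sumS-mono lem)
      where
      lem : ∀ X → ind (P? X) + ind (Q? X) ≤ ind (R? X)
      lem X with P? X
      ... | yes p rewrite dec-false (Q? X) (d X p) | dec-true (R? X) (h X p) = ≤-refl
      ... | no _ = ind-mono (Q? X) (R? X) (g X)

abstract

  #-∅ : {P : Subset n → Set} (P? : Decidable P) → (∀ X → ¬ P X) → # P? ≡ 0
  #-∅ {n} P? h = trans (sumS-cong λ X → ind-no (P? X) (h X)) (sumS-0 {n})

  #-≡ : (W : Subset n) → # (_≟ₛ W) ≡ 1
  #-≡ W = sumS-at W (λ _ → 1)

#-≤1 : {P : Subset n → Set} (P? : Decidable P) → (∀ X Y → P X → P Y → X ≡ Y) → # P? ≤ 1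
#-≤1 P? u with anySubset? P?
... | no h = ≤-trans (≤-reflexive (#-∅ P? (λ X p → h (X , p)))) z≤n
... | yes (W , w) = ≤-trans (#-mono P? (_≟ₛ W) (λ X p → u X W p w)) (≤-reflexive (#-≡ W))

#-≥1 : {P : Subset n → Set} (P? : Decidable P) → ∀ W → P W → 1 ≤ # P?
#-≥1 P? W w = ≤-trans (≤-reflexive (sym (#-≡ W))) (#-mono (_≟ₛ W) P? (λ { X refl → w }))

#-∃ : {P : Subset n → Set} (P? : Decidable P) → 0 < # P? → ∃ P
#-∃ P? h with anySubset? P?
... | yes w = w
... | no ¬w = ⊥-elim (<-irrefl (sym (#-∅ P? (λ X p → ¬w (X , p)))) h)

abstract

  -- Double counting of the pairs with `Z ≡ f X`: a fibre contains at most one `X` in `P`, and none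
  -- when `Z` fails `Q`.
  #-injection : {P : Subset n → Set} {Q : Subset m → Set} (P? : Decidable P) (Q? : Decidable Q) (f : Subset n → Subset m) →
    (∀ X → P X → Q (f X)) → (∀ X Y → P X → P Y → f X ≡ f Y → X ≡ Y) → # P? ≤ # Q?
  #-injection P? Q? f maps inj = begin
    # P?  ≡⟨ sumS-cong (λ X → sym (sumS-at (f X) (λ _ → ind (P? X)))) ⟩
    sumS (λ X → sumS (λ Z → at (Z ≟ₛ f X) (ind (P? X))))  ≡⟨ sumS-swap (λ X Z → at (Z ≟ₛ f X) (ind (P? X))) ⟩
    sumS (λ Z → sumS (λ X → at (Z ≟ₛ f X) (ind (P? X))))  ≡⟨ sumS-cong (λ Z → sumS-cong (λ X → at-ind (Z ≟ₛ f X) (P? X))) ⟩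
    sumS (λ Z → # (λ X → (Z ≟ₛ f X) ×-dec P? X))  ≤⟨ sumS-mono fibre ⟩
    # Q?  ∎
    where
    open ≤-Reasoning
    at-ind : {A B : Set} (d : Dec A) (e : Dec B) → at d (ind e) ≡ ind (d ×-dec e)
    at-ind (yes _) (yes _) = refl
    at-ind (yes _) (no _) = refl
    at-ind (no _) _ = refl
    fibre : ∀ Z → # (λ X → (Z ≟ₛ f X) ×-dec P? X) ≤ ind (Q? Z)
    fibre Z with Q? Z
    ... | yes _ = #-≤1 (λ X → (Z ≟ₛ f X) ×-dec P? X) (λ { X Y (e , p) (e′ , p′) → inj X Y p p′ (trans (sym e) e′) })
    ... | no ¬q = ≤-reflexive (#-∅ (λ X → (Z ≟ₛ f X) ×-dec P? X) (λ { X (refl , p) → ¬q (maps X p) }))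

-- Binomial coefficients and counts of k-subsets

binom : ℕ → ℕ → ℕ
binom n zero = 1
binom zero (suc k) = 0
binom (suc n) (suc k) = binom n (suc k) + binom n k

binom-mono : ∀ {a b} k → a ≤ b → binom a k ≤ binom b k
binom-mono zero h = ≤-refl
binom-mono (suc k) z≤n = z≤n
binom-mono (suc k) (s≤s h) = +-mono-≤ (binom-mono (suc k) h) (binom-mono k h)

KSub : Subset n → ℕ → Subset n → Set
KSub W k X = X ⊆ W × ∣ X ∣ ≡ k

ksub? : (W : Subset n) (k : ℕ) → Decidable (KSub W k)
ksub? W k X = (X ⊆? W) ×-dec (∣ X ∣ ℕ.≟ k)

-- conv f v k = Σᵢ f i * binom v (k - i), defined by Pascal's recursion.
conv : (ℕ → ℕ) → ℕ → ℕ → ℕ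
conv f zero k = f k
conv f (suc v) zero = f zero
conv f (suc v) (suc k) = conv f v (suc k) + conv f v k

shift : (ℕ → ℕ) → ℕ → ℕ
shift f zero = 0
shift f (suc i) = f i

conv-zero : ∀ f v → conv f v 0 ≡ f 0
conv-zero f zero = refl
conv-zero f (suc v) = refl

conv-mono : ∀ {f g} v k → (∀ i → i ≤ k → f i ≤ g i) → conv f v k ≤ conv g v k
conv-mono zero k h = h k ≤-refl
conv-mono (suc v) zero h = h 0 z≤n
conv-mono (suc v) (suc k) h = +-mono-≤ (conv-mono v (suc k) h) (conv-mono v k (λ i l → h i (m≤n⇒m≤1+n l)))

conv-cong : ∀ {f g} v k → (∀ i → i ≤ k → f i ≡ g i) → conv f v k ≡ conv g v k
conv-cong v k h = ≤-antisym (conv-mono v k (λ i l → ≤-reflexive (h i l))) (conv-mono v k (λ i l → ≤-reflexive (sym (h i l))))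

conv-+ : ∀ f g v k → conv (λ i → f i + g i) v k ≡ conv f v k + conv g v k
conv-+ f g zero k = refl
conv-+ f g (suc v) zero = refl
conv-+ f g (suc v) (suc k) = trans (cong₂ _+_ (conv-+ f g v (suc k)) (conv-+ f g v k)) (+-interchange (conv f v (suc k)) _ _ _)

conv-shift : ∀ f v k → conv (shift f) v (suc k) ≡ conv f v k
conv-shift f zero k = refl
conv-shift f (suc v) zero = trans (cong₂ _+_ (conv-shift f v 0) (conv-zero (shift f) v)) (trans (+-identityʳ _) (conv-zero f v))
conv-shift f (suc v) (suc k) = cong₂ _+_ (conv-shift f v (suc k)) (conv-shift f v k)

conv-δ : ∀ v k → conv (λ i → ind (i ℕ.≟ 0)) v k ≡ binom v k
conv-δ zero zero = refl
conv-δ zero (suc k) = refl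
conv-δ (suc v) zero = refl
conv-δ (suc v) (suc k) = cong₂ _+_ (conv-δ v (suc k)) (conv-δ v k)

conv-cons : ∀ f g h v k → f 0 ≡ h 0 → (∀ i → f (suc i) ≡ g i + h (suc i)) → conv f v (suc k) ≡ conv g v k + conv h v (suc k)
conv-cons f g h v k e₀ e = begin
  conv f v (suc k)  ≡⟨ conv-cong v (suc k) (λ { zero _ → e₀ ; (suc i) _ → e i }) ⟩
  conv (λ i → shift g i + h i) v (suc k)  ≡⟨ conv-+ (shift g) h v (suc k) ⟩
  conv (shift g) v (suc k) + conv h v (suc k) ≡⟨ cong (_+ conv h v (suc k)) (conv-shift g v k) ⟩
  conv g v k + conv h v (suc k)  ∎
  where open ≡-Reasoning

module _ {R : Subset n → Set} (R? : Decidable R) (W : Subset n) where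

  ksub-out : ∀ w k → # (λ X → ksub? (w ∷ W) k (false ∷ X) ×-dec R? X) ≡ # (λ X → ksub? W k X ×-dec R? X)
  ksub-out w k = #-cong (λ X → ksub? (w ∷ W) k (false ∷ X) ×-dec R? X) (λ X → ksub? W k X ×-dec R? X)
    (λ { X ((h , e) , q) → (drop-∷-⊆ h , e) , q }) (λ { X ((h , e) , q) → (out⊆ h , e) , q })

  ksub-in : ∀ k → # (λ X → ksub? (true ∷ W) (suc k) (true ∷ X) ×-dec R? X) ≡ # (λ X → ksub? W k X ×-dec R? X)
  ksub-in k = #-cong (λ X → ksub? (true ∷ W) (suc k) (true ∷ X) ×-dec R? X) (λ X → ksub? W k X ×-dec R? X)
    (λ { X ((h , e) , q) → (drop-∷-⊆ h , suc-injective e) , q }) (λ { X ((h , e) , q) → (s⊆s h , cong suc e) , q })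

  ksub-in-zero : # (λ X → ksub? (true ∷ W) 0 (true ∷ X) ×-dec R? X) ≡ 0
  ksub-in-zero = #-∅ (λ X → ksub? (true ∷ W) 0 (true ∷ X) ×-dec R? X) λ { X ((_ , ()) , _) }

  ksub-in-false : ∀ k → # (λ X → ksub? (false ∷ W) k (true ∷ X) ×-dec R? X) ≡ 0
  ksub-in-false k = #-∅ (λ X → ksub? (false ∷ W) k (true ∷ X) ×-dec R? X) λ { X ((h , _) , _) → case h here of λ () }

abstract

  -- An `i`-set in `Y` is the trace of `binom ∣ V ─ Y ∣ (k - i)` sets. The induction runs along the
  -- ground set: a point of `V` outside `Y` is one Pascal step of `conv`, and a point of `Y` splits
  -- the traces by membership through `conv-cons`.
  #-trace : {Q : Subset n → Set} (Q? : Decidable Q) (V Y : Subset n) → Y ⊆ V → ∀ k →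
    # (λ X → ksub? V k X ×-dec Q? (X ∩ Y)) ≡ conv (λ i → # (λ S → ksub? Y i S ×-dec Q? S)) (∣ V ─ Y ∣) k
  #-trace Q? [] [] s zero = refl
  #-trace Q? [] [] s (suc k) = refl
  #-trace Q? (false ∷ V) (true ∷ Y) s k = case s here of λ ()
  #-trace Q? (false ∷ V) (false ∷ Y) s k = trans
    (cong₂ _+_ (ksub-in-false (λ X → Q? (false ∷ X ∩ Y)) V k)
      (trans (ksub-out (λ X → Q? (false ∷ X ∩ Y)) V false k) (#-trace (Q? ∘ (false ∷_)) V Y (drop-∷-⊆ s) k)))
    (conv-cong (∣ V ─ Y ∣) k λ i _ → sym (cong₂ _+_ (ksub-in-false (Q? ∘ (true ∷_)) Y i) (ksub-out (Q? ∘ (false ∷_)) Y false i)))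
  #-trace Q? (true ∷ V) (false ∷ Y) s k = trans
    (cong₂ _+_ (inn k) (trans (ksub-out (λ X → Q? (false ∷ X ∩ Y)) V true k) (IH k)))
    (trans (step k) (conv-cong (suc v) k λ i _ →
      sym (cong₂ _+_ (ksub-in-false (Q? ∘ (true ∷_)) Y i) (ksub-out (Q? ∘ (false ∷_)) Y false i))))
    where
    v : ℕ
    v = ∣ V ─ Y ∣
    F G : ℕ → ℕ
    F i = # (λ S → ksub? Y i S ×-dec Q? (false ∷ S))
    G zero = 0
    G (suc k) = conv F v k
    IH : ∀ k → # (λ X → ksub? V k X ×-dec Q? (false ∷ X ∩ Y)) ≡ conv F v k
    IH = #-trace (Q? ∘ (false ∷_)) V Y (drop-∷-⊆ s)
    inn : ∀ k → # (λ X → ksub? (true ∷ V) k (true ∷ X) ×-dec Q? (false ∷ X ∩ Y)) ≡ G k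
    inn zero = ksub-in-zero (λ X → Q? (false ∷ X ∩ Y)) V
    inn (suc k) = trans (ksub-in (λ X → Q? (false ∷ X ∩ Y)) V k) (IH k)
    step : ∀ k → G k + conv F v k ≡ conv F (suc v) k
    step zero = conv-zero F v
    step (suc k) = +-comm (conv F v k) _
  #-trace Q? (true ∷ V) (true ∷ Y) s k = trans
    (cong₂ _+_ (inn k) (trans (ksub-out (λ X → Q? (false ∷ X ∩ Y)) V true k) (#-trace (Q? ∘ (false ∷_)) V Y (drop-∷-⊆ s) k)))
    (step k)
    where
    v : ℕ
    v = ∣ V ─ Y ∣
    F H T G : ℕ → ℕ
    F i = # (λ S → ksub? Y i S ×-dec Q? (false ∷ S))
    H i = # (λ S → ksub? Y i S ×-dec Q? (true ∷ S))
    T i = # (λ S → ksub? (true ∷ Y) i S ×-dec Q? S)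
    G zero = 0
    G (suc k) = conv H v k
    inn : ∀ k → # (λ X → ksub? (true ∷ V) k (true ∷ X) ×-dec Q? (true ∷ X ∩ Y)) ≡ G k
    inn zero = ksub-in-zero (λ X → Q? (true ∷ X ∩ Y)) V
    inn (suc k) = trans (ksub-in (λ X → Q? (true ∷ X ∩ Y)) V k) (#-trace (Q? ∘ (true ∷_)) V Y (drop-∷-⊆ s) k)
    T₀ : T 0 ≡ F 0
    T₀ = cong₂ _+_ (ksub-in-zero (Q? ∘ (true ∷_)) Y) (ksub-out (Q? ∘ (false ∷_)) Y true 0)
    Tₛ : ∀ i → T (suc i) ≡ H i + F (suc i)
    Tₛ i = cong₂ _+_ (ksub-in (Q? ∘ (true ∷_)) Y i) (ksub-out (Q? ∘ (false ∷_)) Y true (suc i))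
    step : ∀ k → G k + conv F v k ≡ conv T v k
    step zero = trans (conv-zero F v) (trans (sym T₀) (sym (conv-zero T v)))
    step (suc k) = sym (conv-cons T H F v k T₀ Tₛ)

  #-ksub : (W : Subset n) (k : ℕ) → # (ksub? W k) ≡ binom ∣ W ∣ k
  #-ksub [] zero = refl
  #-ksub [] (suc k) = refl
  #-ksub (false ∷ W) k = trans (cong₂ _+_
      (#-∅ (λ X → ksub? (false ∷ W) k (true ∷ X)) λ { X (h , _) → case h here of λ () })
      (#-cong (λ X → ksub? (false ∷ W) k (false ∷ X)) (ksub? W k) (λ { X (h , e) → drop-∷-⊆ h , e }) (λ { X (h , e) → out⊆ h , e })))
    (#-ksub W k)
  #-ksub (true ∷ W) zero = cong₂ _+_
      (#-∅ (λ X → ksub? (true ∷ W) 0 (true ∷ X)) λ { X (_ , ()) })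
      (trans (#-cong (λ X → ksub? (true ∷ W) 0 (false ∷ X)) (ksub? W 0) (λ { X (h , e) → drop-∷-⊆ h , e }) (λ { X (h , e) → out⊆ h , e }))
        (#-ksub W 0))
  #-ksub (true ∷ W) (suc k) = trans (cong₂ _+_
      (trans (#-cong (λ X → ksub? (true ∷ W) (suc k) (true ∷ X)) (ksub? W k)
        (λ { X (h , e) → drop-∷-⊆ h , suc-injective e }) (λ { X (h , e) → s⊆s h , cong suc e })) (#-ksub W k))
      (trans (#-cong (λ X → ksub? (true ∷ W) (suc k) (false ∷ X)) (ksub? W (suc k)) (λ { X (h , e) → drop-∷-⊆ h , e }) (λ { X (h , e) → out⊆ h , e }))
        (#-ksub W (suc k))))
    (+-comm (binom ∣ W ∣ k) _)

-- Shifting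

tr : Fin n → Fin n → Fin n → Fin n
tr i j z = if does (z ≟ i) then j else if does (z ≟ j) then i else z

module _ (i j : Fin n) where

  tr-i : tr i j i ≡ j
  tr-i rewrite dec-true (i ≟ i) refl = refl

  tr-j : tr i j j ≡ i
  tr-j with j ≟ i
  ... | yes e = e
  ... | no _ rewrite dec-true (j ≟ j) refl = refl

  tr-other : ∀ {z} → z ≢ i → z ≢ j → tr i j z ≡ z
  tr-other {z} a b rewrite dec-false (z ≟ i) a | dec-false (z ≟ j) b = refl

  tr-tr : ∀ z → tr i j (tr i j z) ≡ z
  tr-tr z with z ≟ i
  ... | yes refl = tr-j
  ... | no a with z ≟ j
  ...   | yes refl = tr-i
  ...   | no b = tr-other a b

  abstract
    -- A full transposition rather than a replacement of `j` by `i`: it is an involution on all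
    -- subsets, and it fixes the sets containing both points or neither.
    swap : Subset n → Subset n
    swap X = tabulate (λ z → lookup X (tr i j z))

    ∈-swap⁺ : ∀ {X z} → tr i j z ∈ X → z ∈ swap X
    ∈-swap⁺ {X} {z} h = lookup⇒[]= z (swap X) (trans (lookup∘tabulate _ z) ([]=⇒lookup h))

    ∈-swap⁻ : ∀ {X z} → z ∈ swap X → tr i j z ∈ X
    ∈-swap⁻ {X} {z} h = lookup⇒[]= _ X (trans (sym (lookup∘tabulate _ z)) ([]=⇒lookup h))

  module _ {X : Subset n} where

    swap-i⁺ : j ∈ X → i ∈ swap X
    swap-i⁺ h = ∈-swap⁺ (subst (_∈ X) (sym tr-i) h)

    swap-j⁺ : i ∈ X → j ∈ swap X
    swap-j⁺ h = ∈-swap⁺ (subst (_∈ X) (sym tr-j) h)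

    swap-i⁻ : i ∈ swap X → j ∈ X
    swap-i⁻ h = subst (_∈ X) tr-i (∈-swap⁻ h)

    swap-j⁻ : j ∈ swap X → i ∈ X
    swap-j⁻ h = subst (_∈ X) tr-j (∈-swap⁻ h)

    swap-other⁺ : ∀ {z} → z ≢ i → z ≢ j → z ∈ X → z ∈ swap X
    swap-other⁺ a b h = ∈-swap⁺ (subst (_∈ X) (sym (tr-other a b)) h)

    swap-other⁻ : ∀ {z} → z ≢ i → z ≢ j → z ∈ swap X → z ∈ X
    swap-other⁻ a b h = subst (_∈ X) (tr-other a b) (∈-swap⁻ h)

  swap-swap : ∀ X → swap (swap X) ≡ X
  swap-swap X = ⊆-antisym (λ {z} h → subst (_∈ X) (tr-tr z) (∈-swap⁻ (∈-swap⁻ h)))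
                          (λ {z} h → ∈-swap⁺ (∈-swap⁺ (subst (_∈ X) (sym (tr-tr z)) h)))

  swap-fixed : ∀ {X} → (i ∈ X → j ∈ X) → (j ∈ X → i ∈ X) → swap X ≡ X
  swap-fixed {X} f g = ⊆-antisym to from
    where
    to : swap X ⊆ X
    to {z} h with z ≟ i
    ... | yes refl = g (swap-i⁻ h)
    ... | no a with z ≟ j
    ...   | yes refl = f (swap-j⁻ h)
    ...   | no b = swap-other⁻ a b h
    from : X ⊆ swap X
    from {z} h with z ≟ i
    ... | yes refl = swap-i⁺ (f h)
    ... | no a with z ≟ j
    ...   | yes refl = swap-j⁺ (g h)
    ...   | no b = swap-other⁺ a b h

  swap-⊆ : ∀ {X V} → i ∈ V → j ∈ V → X ⊆ V → swap X ⊆ V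
  swap-⊆ hi hj s {z} h with z ≟ i
  ... | yes refl = hi
  ... | no a with z ≟ j
  ...   | yes refl = hj
  ...   | no b = s (swap-other⁻ a b h)

  swap-─ : ∀ {X Y} → i ∈ Y → j ∉ Y → j ∈ X → i ∉ X → suc ∣ swap X ─ Y ∣ ≡ ∣ X ─ Y ∣
  swap-─ {X} {Y} iY jY jX iX = trans (cong (suc ∘ ∣_∣) (⊆-antisym to from)) (∣-∣-∈ (X ─ Y) (x∈p∧x∉q⇒x∈p─q jX jY))
    where
    to : swap X ─ Y ⊆ (X ─ Y) - j
    to {z} h with ∈─⁻ (swap X) Y h
    ... | zX , zY = ∈-⁺ (X ─ Y) (x∈p∧x∉q⇒x∈p─q (swap-other⁻ (λ { refl → zY iY }) z≢j zX) zY) z≢j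
      where
      z≢j : z ≢ j
      z≢j refl = iX (swap-j⁻ zX)
    from : (X ─ Y) - j ⊆ swap X ─ Y
    from h with ∈-⁻ (X ─ Y) h
    ... | h′ , z≢j with ∈─⁻ X Y h′
    ...   | zX , zY = x∈p∧x∉q⇒x∈p─q (swap-other⁺ (λ { refl → zY iY }) z≢j zX) zY

  ∣swap∣-moved : ∀ {X} → j ∈ X → i ∉ X → ∣ swap X ∣ ≡ ∣ X ∣
  ∣swap∣-moved {X} jX iX = trans (sym (∣-∣-∈ (swap X) (swap-i⁺ jX)))
    (trans (cong (suc ∘ ∣_∣) (⊆-antisym to from)) (∣-∣-∈ X jX))
    where
    to : swap X - i ⊆ X - j
    to {z} h with ∈-⁻ (swap X) h
    ... | zX , z≢i = ∈-⁺ X (swap-other⁻ z≢i z≢j zX) z≢j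
      where
      z≢j : z ≢ j
      z≢j refl = iX (swap-j⁻ zX)
    from : X - j ⊆ swap X - i
    from {z} h with ∈-⁻ X h
    ... | zX , z≢j = ∈-⁺ (swap X) (swap-other⁺ z≢i z≢j zX) z≢i
      where
      z≢i : z ≢ i
      z≢i refl = iX zX

  ∣swap∣ : ∀ X → ∣ swap X ∣ ≡ ∣ X ∣
  ∣swap∣ X with i ∈? X | j ∈? X
  ... | yes a | yes b = cong ∣_∣ (swap-fixed (λ _ → b) (λ _ → a))
  ... | no a | no b = cong ∣_∣ (swap-fixed (⊥-elim ∘ a) (⊥-elim ∘ b))
  ... | no a | yes b = ∣swap∣-moved b a
  ... | yes a | no b = trans (sym (∣swap∣-moved (swap-j⁺ a) (b ∘ swap-i⁻))) (cong ∣_∣ (swap-swap X))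

-- Families as Boolean predicates and the shift operator

Fam : ℕ → Set
Fam n = Subset n → Bool

infix 4 _∋_
record _∋_ (p : Fam n) (X : Subset n) : Set where
  constructor mem
  field holds : p X ≡ true

open _∋_

_∋?_ : (p : Fam n) → Decidable (p ∋_)
p ∋? X = map′ mem holds (p X Boolₚ.≟ true)

∥_∥ : Fam n → ℕ
∥ p ∥ = # (p ∋?_)

∨-true⁻ : ∀ {a b} → a ∨ b ≡ true → a ≡ true ⊎ b ≡ true
∨-true⁻ {true} h = inj₁ refl
∨-true⁻ {false} h = inj₂ h

∨-trueˡ : ∀ {a b} → a ≡ true → a ∨ b ≡ true
∨-trueˡ refl = refl

∨-trueʳ : ∀ {a b} → b ≡ true → a ∨ b ≡ true
∨-trueʳ {a} refl = Boolₚ.∨-zeroʳ a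

∧-true⁻ : ∀ {a b} → a ∧ b ≡ true → a ≡ true × b ≡ true
∧-true⁻ {true} h = refl , h

weight : (Subset n → ℕ) → Fam n → ℕ
weight w p = sumS (λ X → at (p ∋? X) (w X))

a+a≡b+b⇒a≡b : ∀ {a b} → a + a ≡ b + b → a ≡ b
a+a≡b+b⇒a≡b {a} {b} h with <-cmp a b
... | tri< l _ _ = ⊥-elim (<-irrefl h (+-mono-< l l))
... | tri≈ _ e _ = e
... | tri> _ _ l = ⊥-elim (<-irrefl (sym h) (+-mono-< l l))

a+a<b+b⇒a<b : ∀ {a b} → a + a < b + b → a < b
a+a<b+b⇒a<b {a} {b} h with a <? b
... | yes l = l
... | no ¬l = ⊥-elim (<⇒≱ h (+-mono-≤ (≮⇒≥ ¬l) (≮⇒≥ ¬l)))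

module _ (i j : Fin n) where

  abstract

    -- On an orbit of `swap i j` the disjunction goes to the set with `i` and the conjunction to the
    -- set without it, which is the usual shift. On sets fixed by the swap both formulas reduce to
    -- `p X`, so `j` needs no case of its own.
    S : Fam n → Fam n
    S p X = if does (i ∈? X) then p X ∨ p (swap i j X) else p X ∧ p (swap i j X)

    S-in : ∀ p {X} → i ∈ X → S p X ≡ p X ∨ p (swap i j X)
    S-in p {X} h rewrite dec-true (i ∈? X) h = refl

    S-out : ∀ p {X} → i ∉ X → S p X ≡ p X ∧ p (swap i j X)
    S-out p {X} h rewrite dec-false (i ∈? X) h = refl

  S-out⁻ : ∀ {p X} → i ∉ X → S p ∋ X → p ∋ X × p ∋ swap i j X
  S-out⁻ {p} {X} h e = let a , b = ∧-true⁻ (trans (sym (S-out p h)) (holds e)) in mem a , mem b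

  S-in⁻ : ∀ {p X} → i ∈ X → S p ∋ X → p ∋ X ⊎ p ∋ swap i j X
  S-in⁻ {p} {X} h e = [ inj₁ ∘ mem , inj₂ ∘ mem ]′ (∨-true⁻ (trans (sym (S-in p h)) (holds e)))

  S-⁻ : ∀ {p X} → S p ∋ X → p ∋ X ⊎ p ∋ swap i j X
  S-⁻ {p} {X} e with i ∈? X
  ... | yes h = S-in⁻ h e
  ... | no h = inj₁ (proj₁ (S-out⁻ h e))

  S-in⁺ : ∀ {p X} → i ∈ X → p ∋ X → S p ∋ X
  S-in⁺ {p} h e = mem (trans (S-in p h) (∨-trueˡ (holds e)))

  S-both⁺ : ∀ {p X} → p ∋ X → p ∋ swap i j X → S p ∋ X
  S-both⁺ {p} {X} e e′ with i ∈? X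
  ... | yes h = S-in⁺ h e
  ... | no h = mem (trans (S-out p h) (cong₂ _∧_ (holds e) (holds e′)))

  S-avoid⁺ : ∀ {p X} → j ∉ X → p ∋ X → S p ∋ X
  S-avoid⁺ {p} {X} h e with i ∈? X
  ... | yes a = S-in⁺ a e
  ... | no a = S-both⁺ e (subst (p ∋_) (sym (swap-fixed i j (⊥-elim ∘ a) (⊥-elim ∘ h))) e)

  S-moved⁺ : ∀ {p X} → j ∈ X → p ∋ X → S p ∋ swap i j X
  S-moved⁺ {p} {X} h e = mem (trans (S-in p (swap-i⁺ i j h)) (∨-trueʳ (trans (cong p (swap-swap i j X)) (holds e))))

  private
    -- Counting every orbit twice lets the weights of `S p` and `p` be compared orbit by orbit
    -- without choosing representatives.
    double : ∀ w p → sumS (λ X → at (p ∋? X) (w X) + at (p ∋? swap i j X) (w (swap i j X))) ≡ weight w p + weight w p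
    double w p = trans (sumS-+ (λ X → at (p ∋? X) (w X)) (λ X → at (p ∋? swap i j X) (w (swap i j X)))) (cong (weight w p +_)
      (sumS-involution (swap i j) (swap-swap i j) (λ X → at (p ∋? X) (w X))))

    bool-≤ : ∀ {a b c d} u v → u ≤ v → c ≡ a ∨ b → d ≡ b ∧ a →
      at (c Boolₚ.≟ true) u + at (d Boolₚ.≟ true) v ≤ at (a Boolₚ.≟ true) u + at (b Boolₚ.≟ true) v
    bool-≤ {true} {true} u v h refl refl = ≤-refl
    bool-≤ {true} {false} u v h refl refl = ≤-refl
    bool-≤ {false} {true} u v h refl refl = ≤-trans (≤-reflexive (+-identityʳ u)) h
    bool-≤ {false} {false} u v h refl refl = ≤-refl

    Pt : (Subset n → ℕ) → Fam n → Subset n → ℕ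
    Pt w p X = at (p ∋? X) (w X) + at (p ∋? swap i j X) (w (swap i j X))

    Pt-sym : ∀ w p X → Pt w p (swap i j X) ≡ Pt w p X
    Pt-sym w p X rewrite swap-swap i j X = +-comm (at (p ∋? swap i j X) (w (swap i j X))) _

    fixed : ∀ w p X → swap i j X ≡ X → Pt w (S p) X ≡ Pt w p X
    fixed w p X e = cong₂ _+_ (lem X e) (lem (swap i j X) (trans (swap-swap i j X) (sym e)))
      where
      lem : ∀ X → swap i j X ≡ X → at (S p ∋? X) (w X) ≡ at (p ∋? X) (w X)
      lem X e = cong (λ b → at (b Boolₚ.≟ true) (w X)) (eq X e)
        where
        eq : ∀ X → swap i j X ≡ X → S p X ≡ p X
        eq X e with i ∈? X
        ... | yes a = trans (S-in p a) (trans (cong (λ Z → p X ∨ p Z) e) (Boolₚ.∨-idem (p X)))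
        ... | no a = trans (S-out p a) (trans (cong (λ Z → p X ∧ p Z) e) (Boolₚ.∧-idem (p X)))

    moved : ∀ w p {X} → i ∈ X → j ∉ X → w X ≤ w (swap i j X) → Pt w (S p) X ≤ Pt w p X
    moved w p {X} a b h = bool-≤ {p X} {p (swap i j X)} (w X) (w (swap i j X)) h (S-in p a)
      (trans (S-out p (b ∘ swap-i⁻ i j)) (cong (λ Z → p (swap i j X) ∧ p Z) (swap-swap i j X)))

  module _ (w : Subset n → ℕ) (h : ∀ X → i ∈ X → j ∉ X → w X ≤ w (swap i j X)) (p : Fam n) where

    private
      pointwise : ∀ X → Pt w (S p) X ≤ Pt w p X
      pointwise X = case i ∈? X of λ
        { (yes a) → case j ∈? X of λ
          { (yes b) → ≤-reflexive (fixed w p X (swap-fixed i j (λ _ → b) (λ _ → a)))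
          ; (no b) → moved w p a b (h X a b) }
        ; (no a) → case j ∈? X of λ
          { (yes b) → subst₂ _≤_ (Pt-sym w (S p) X) (Pt-sym w p X)
              (moved w p (swap-i⁺ i j b) (a ∘ swap-j⁻ i j) (h _ (swap-i⁺ i j b) (a ∘ swap-j⁻ i j)))
          ; (no b) → ≤-reflexive (fixed w p X (swap-fixed i j (⊥-elim ∘ a) (⊥-elim ∘ b))) } }

    weight-S-≤ : weight w (S p) ≤ weight w p
    weight-S-≤ = ≮⇒≥ λ l → <⇒≱ (subst₂ _<_ (sym (double w p)) (sym (double w (S p))) (+-mono-< l l)) (sumS-mono pointwise)

    weight-S-< : ∀ {X} → p ∋ X → j ∈ X → i ∉ X → p (swap i j X) ≡ false → w (swap i j X) < w X → weight w (S p) < weight w p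
    weight-S-< {X} pX b a pX′ l = a+a<b+b⇒a<b (subst₂ _<_ (double w (S p)) (double w p) (sumS-mono-< pointwise X strict))
      where
      bit : ∀ {b c} u → b ≡ c → at (b Boolₚ.≟ true) u ≡ at (c Boolₚ.≟ true) u
      bit u = cong (λ b → at (b Boolₚ.≟ true) u)
      strict : Pt w (S p) X < Pt w p X
      strict = subst₂ _<_
        (sym (cong₂ _+_ (bit (w X) (trans (S-out p a) (trans (cong (p X ∧_) pX′) (Boolₚ.∧-zeroʳ (p X)))))
                        (bit (w (swap i j X)) (holds (S-moved⁺ b pX)))))
        (sym (trans (cong₂ _+_ (bit (w X) (holds pX)) (bit (w (swap i j X)) pX′)) (+-identityʳ (w X)))) l

  ∥S∥ : ∀ p → ∥ S p ∥ ≡ ∥ p ∥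
  ∥S∥ p = trans (#-sumS (S p ∋?_)) (trans (a+a≡b+b⇒a≡b (trans (sym (double (λ _ → 1) (S p))) (trans (sumS-cong pointwise) (double (λ _ → 1) p)))) (sym (#-sumS (p ∋?_))))
    where
    bool-≡ : ∀ {a b c d} → c ≡ a ∨ b → d ≡ b ∧ a →
      at (c Boolₚ.≟ true) 1 + at (d Boolₚ.≟ true) 1 ≡ at (a Boolₚ.≟ true) 1 + at (b Boolₚ.≟ true) 1
    bool-≡ {true} {true} refl refl = refl
    bool-≡ {true} {false} refl refl = refl
    bool-≡ {false} {true} refl refl = refl
    bool-≡ {false} {false} refl refl = refl
    mv : ∀ {X} → i ∈ X → j ∉ X → Pt (λ _ → 1) (S p) X ≡ Pt (λ _ → 1) p X
    mv {X} a b = bool-≡ {p X} {p (swap i j X)} (S-in p a)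
      (trans (S-out p (b ∘ swap-i⁻ i j)) (cong (λ Z → p (swap i j X) ∧ p Z) (swap-swap i j X)))
    pointwise : ∀ X → Pt (λ _ → 1) (S p) X ≡ Pt (λ _ → 1) p X
    pointwise X = case i ∈? X of λ
        { (yes a) → case j ∈? X of λ
          { (yes b) → fixed (λ _ → 1) p X (swap-fixed i j (λ _ → b) (λ _ → a))
          ; (no b) → mv a b }
        ; (no a) → case j ∈? X of λ
          { (yes b) → trans (sym (Pt-sym (λ _ → 1) (S p) X)) (trans (mv (swap-i⁺ i j b) (a ∘ swap-j⁻ i j)) (Pt-sym (λ _ → 1) p X))
          ; (no b) → fixed (λ _ → 1) p X (swap-fixed i j (⊥-elim ∘ a) (⊥-elim ∘ b)) } }

Cross : Fam n → Fam n → Set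
Cross p q = ∀ {X Z} → p ∋ X → q ∋ Z → Meets X Z

Unif : Subset n → ℕ → Fam n → Set
Unif V k p = ∀ {X} → p ∋ X → KSub V k X

module _ {i j : Fin n} where

  swap-meets⁻ : ∀ {X Z} → Meets (swap i j X) (swap i j Z) → Meets X Z
  swap-meets⁻ (x , a , b) = tr i j x , ∈-swap⁻ i j a , ∈-swap⁻ i j b

  -- Disjoint X, Z cannot both contain i, so one of them lies in its unshifted family together with its swap.
  S-cross : ∀ {p q} → Cross p q → Cross (S i j p) (S i j q)
  S-cross {p} {q} c {X} {Z} hX hZ = case i ∈? X of λ
    { (yes a) → case i ∈? Z of λ
      { (yes b) → i , a , b
      ; (no b) → let e , e′ = S-out⁻ i j b hZ in [ (λ u → c u e) , (λ u → swap-meets⁻ (c u e′)) ]′ (S-⁻ i j hX) }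
    ; (no a) → let e , e′ = S-out⁻ i j a hX in [ (λ u → c e u) , (λ u → swap-meets⁻ (c e′ u)) ]′ (S-⁻ i j hZ) }

  S-unif : ∀ {V k p} → i ∈ V → j ∈ V → Unif V k p → Unif V k (S i j p)
  S-unif {V} {k} iV jV u {X} h with S-⁻ i j h
  ... | inj₁ e = u e
  ... | inj₂ e = let s , c = u e in
    (λ {x} x∈ → subst (_⊆ V) (swap-swap i j X) (swap-⊆ i j iV jV s) x∈) , trans (sym (∣swap∣ i j X)) c

Stable : Fin n → Fin n → Fam n → Set
Stable i j p = ∀ {X} → p ∋ X → j ∈ X → i ∉ X → p ∋ swap i j X

-- Drops under every non-trivial shift into Y, hence the termination measure of iterated shifting.
outer : Subset n → Fam n → ℕ
outer Y = weight (λ X → ∣ X ─ Y ∣)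

module _ {i j : Fin n} {Y : Subset n} (iY : i ∈ Y) (jY : j ∉ Y) where

  private
    swap-lighter : ∀ X → i ∈ X → j ∉ X → ∣ X ─ Y ∣ ≤ ∣ swap i j X ─ Y ∣
    swap-lighter X a b = ≤-trans (n≤1+n _) (≤-reflexive (trans (cong (λ Z → suc ∣ Z ─ Y ∣) (sym (swap-swap i j X)))
      (swap-─ i j {swap i j X} iY jY (swap-j⁺ i j a) (b ∘ swap-i⁻ i j))))

  outer-S-≤ : ∀ p → outer Y (S i j p) ≤ outer Y p
  outer-S-≤ p = weight-S-≤ i j (λ X → ∣ X ─ Y ∣) swap-lighter p

  outer-stable : ∀ {p} → ¬ (outer Y (S i j p) < outer Y p) → Stable i j p
  outer-stable {p} ¬l {X} pX jX iX with p (swap i j X) in e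
  ... | true = mem e
  ... | false = ⊥-elim (¬l (weight-S-< i j (λ X → ∣ X ─ Y ∣) swap-lighter
                              p pX jX iX e (≤-reflexive (swap-─ i j iY jY jX iX))))

-- Finite point sets

pattern at₀ = here refl
pattern at₁ = there at₀
pattern at₂ = there at₁
pattern at₃ = there at₂
pattern at₄ = there at₃
pattern at₅ = there at₄

∈∉⇒≢ : ∀ {x y : Fin n} {A : Subset n} → x ∈ A → y ∉ A → x ≢ y
∈∉⇒≢ a b refl = b a

abstract

  pts : List (Fin n) → Subset n
  pts [] = ⊥
  pts (x ∷ xs) = ⁅ x ⁆ ∪ pts xs

  ∈-pts⁺ : ∀ {x : Fin n} {xs} → x ∈ₗ xs → x ∈ pts xs
  ∈-pts⁺ at₀ = x∈p∪q⁺ (inj₁ (x∈⁅x⁆ _))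
  ∈-pts⁺ (there h) = x∈p∪q⁺ (inj₂ (∈-pts⁺ h))

  ∈-pts⁻ : ∀ {x : Fin n} xs → x ∈ pts xs → x ∈ₗ xs
  ∈-pts⁻ [] h = ⊥-elim (∉⊥ h)
  ∈-pts⁻ (y ∷ xs) h with x∈p∪q⁻ ⁅ y ⁆ (pts xs) h
  ... | inj₁ u = here (x∈⁅y⁆⇒x≡y y u)
  ... | inj₂ u = there (∈-pts⁻ xs u)

  ∣pts∣≤ : ∀ (xs : List (Fin n)) → ∣ pts xs ∣ ≤ length xs
  ∣pts∣≤ {n} [] = ≤-reflexive (∣⊥∣≡0 n)
  ∣pts∣≤ (x ∷ xs) = ≤-trans (∣∪∣≤ ⁅ x ⁆ (pts xs)) (+-mono-≤ (≤-reflexive (∣⁅x⁆∣≡1 x)) (∣pts∣≤ xs))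

pts-⊆ : ∀ {V : Subset n} {xs} → All (_∈ V) xs → pts xs ⊆ V
pts-⊆ {xs = xs} a h = All.lookup a (∈-pts⁻ xs h)

∣─pts∣ : ∀ (Y : Subset n) xs → ∣ Y ∣ ≤ length xs + ∣ Y ─ pts xs ∣
∣─pts∣ Y xs = ≤-trans (≤-reflexive (sym (∣∩∣+∣─∣ Y (pts xs))))
  (+-monoˡ-≤ _ (≤-trans (∣p∩q∣≤∣q∣ Y (pts xs)) (∣pts∣≤ xs)))

outside-≤ : ∀ {X I : Subset n} xs → Unique xs → All (λ x → x ∈ X × x ∉ I) xs → length xs + ∣ X ∩ I ∣ ≤ ∣ X ∣
outside-≤ {X = X} {I} [] _ _ = ∣p∩q∣≤∣p∣ X I
outside-≤ {X = X} {I} (x ∷ xs) (ne ∷ u) ((xX , xI) ∷ a) = begin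
  suc (length xs + ∣ X ∩ I ∣)  ≤⟨ s≤s (+-monoʳ-≤ (length xs) (p⊆q⇒∣p∣≤∣q∣ inc)) ⟩
  suc (length xs + ∣ (X - x) ∩ I ∣) ≤⟨ s≤s (outside-≤ xs u (go ne a)) ⟩
  suc ∣ X - x ∣  ≡⟨ ∣-∣-∈ X xX ⟩
  ∣ X ∣  ∎
  where
  open ≤-Reasoning
  inc : X ∩ I ⊆ (X - x) ∩ I
  inc h = let a , b = x∈p∩q⁻ X I h in x∈p∩q⁺ (∈-⁺ X a (λ { refl → xI b }) , b)
  go : ∀ {ys} → All (x ≢_) ys → All (λ y → y ∈ X × y ∉ I) ys → All (λ y → y ∈ X - x × y ∉ I) ys
  go [] [] = []
  go (ne ∷ n) ((yX , yI) ∷ a) = (∈-⁺ X yX (λ e → ne (sym e)) , yI) ∷ go n a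

∃-outside : ∀ {X Z I : Subset n} → ∣ X ∩ I ∣ + ∣ Z ∩ I ∣ < ∣ I ∣ → ∃ λ i → i ∈ I × i ∉ X × i ∉ Z
∃-outside {X = X} {Z} {I} h =
  let i , a , b = ∣p∣<∣q∣⇒∃ (X ∩ I ∪ Z ∩ I) I (≤-<-trans (∣∪∣≤ (X ∩ I) (Z ∩ I)) h)
  in i , a , (λ u → b (x∈p∪q⁺ (inj₁ (x∈p∩q⁺ (u , a))))) , (λ u → b (x∈p∪q⁺ (inj₂ (x∈p∩q⁺ (u , a)))))

-- Iterated shifting into a set Y

-- Kept abstract in the state, since it is run both on one family and on a pair of families moved
-- together. `B` is the obstruction that ends the iteration early; for pairs it is empty.
closure : {A : Set} (m : A → ℕ) (act : Fin n → Fin n → A → A) (I J : Subset n) (G : A → Set) (B : A → Fin n → Fin n → Set) →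
  (∀ a i j → G a → i ∈ I → j ∈ J → G (act i j a) ⊎ B a i j) → ∀ a → G a →
  (Σ A λ a′ → G a′ × (∀ {i j} → i ∈ I → j ∈ J → ¬ (m (act i j a′) < m a′))) ⊎
  (Σ A λ a′ → G a′ × ∃ λ i → ∃ λ j → i ∈ I × j ∈ J × B a′ i j)
closure m act I J G B step a₀ g₀ = go a₀ g₀ (<-wellFounded (m a₀))
  where
  go : ∀ a → G a → Acc _<_ (m a) → _
  go a g (acc rs) with any? (λ i → any? (λ j → (i ∈? I) ×-dec (j ∈? J) ×-dec (m (act i j a) <? m a)))
  ... | no h = inj₁ (a , g , λ {i} {j} iI jJ l → h (i , j , iI , jJ , l))
  ... | yes (i , j , iI , jJ , l) with step a i j g iI jJ
  ...   | inj₁ g′ = go (act i j a) g′ (rs l)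
  ...   | inj₂ b = inj₂ (a , g , i , j , iI , jJ , b)

Core : Subset n → Fam n → Fam n → Set
Core Y p q = ∀ {X Z} → p ∋ X → q ∋ Z → ∃ λ x → x ∈ X × x ∈ Z × x ∈ Y

module _ {p q : Fam n} {Y : Subset n} (cr : Cross p q)
  (move : ∀ {X Z j} → p ∋ X → q ∋ Z → j ∈ X → j ∈ Z → j ∉ Y → (∀ {x} → x ∈ X → x ∈ Z → x ∉ Y) →
          ∃ λ i → i ∈ Y × i ∉ X × i ∉ Z × p ∋ swap i j X) where

  -- If `X` and `Z` meet only outside `Y`, at `j`, then exchanging `j` for a point `i` of `Y`
  -- outside both adds no point of `Z` and brings `X` closer to `Y`. A point of `Y` common to the
  -- moved set and `Z` therefore already lies in `X`.
  core : Core Y p q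
  core {X} {Z} pX qZ = go X pX (<-wellFounded _)
    where
    go : ∀ X → p ∋ X → Acc _<_ ∣ X ─ Y ∣ → ∃ λ x → x ∈ X × x ∈ Z × x ∈ Y
    go X pX (acc rs) with any? (λ x → (x ∈? X) ×-dec (x ∈? Z) ×-dec (x ∈? Y))
    ... | yes h = h
    ... | no h = let
      j , jX , jZ = cr pX qZ
      jY = λ u → h (j , jX , jZ , u)
      i , iY , iX , iZ , pX′ = move pX qZ jX jZ jY (λ {x} a b c → h (x , a , b , c))
      x , xX′ , xZ , xY = go (swap i j X) pX′ (rs (≤-reflexive (swap-─ i j iY jY jX iX)))
      in x , swap-other⁻ i j (∈∉⇒≢ xZ iZ) (∈∉⇒≢ xY jY) xX′ , xZ , xY

-- Covers by two points and shifts that create them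

NoCov : Fam n → Set
NoCov p = ∀ x y → ∃ λ X → p ∋ X × x ∉ X × y ∉ X

noCov? : (p : Fam n) → Dec (NoCov p)
noCov? p = all? λ x → all? λ y → anySubset? λ X → (p ∋? X) ×-dec ¬? (x ∈? X) ×-dec ¬? (y ∈? X)

Cov₂ : Fam n → Fin n → Fin n → Set
Cov₂ p x y = ∀ {X} → p ∋ X → x ∈ X ⊎ y ∈ X

¬noCov : (p : Fam n) → ¬ NoCov p → ∃ λ x → ∃ λ y → Cov₂ p x y
¬noCov {n} p h =
  let x , h₁ = ¬∀⟶∃¬ n _ (λ x → all? λ y → anySubset? λ X → (p ∋? X) ×-dec ¬? (x ∈? X) ×-dec ¬? (y ∈? X)) h
      y , h₂ = ¬∀⟶∃¬ n _ (λ y → anySubset? λ X → (p ∋? X) ×-dec ¬? (x ∈? X) ×-dec ¬? (y ∈? X)) h₁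
  in x , y , λ {X} pX → case x ∈? X of λ
    { (yes a) → inj₁ a
    ; (no a) → case y ∈? X of λ { (yes b) → inj₂ b ; (no b) → ⊥-elim (h₂ (X , pX , a , b)) } }

record Break (i j : Fin n) (p : Fam n) : Set where
  field
    z : Fin n
    cov₃ : ∀ {X} → p ∋ X → i ∈ X ⊎ j ∈ X ⊎ z ∈ X
    cov₂ : Cov₂ (S i j p) i z

-- A member `W` that avoids the pair covering the shifted family must have been moved, so it
-- contained `j`, and its image gains only `i`: hence `i` belongs to the pair. Members without `j`
-- survive the shift and are covered by the pair, so adding `j` gives a cover of the original
-- family.
break : ∀ {i j : Fin n} {p} → NoCov p → ¬ NoCov (S i j p) → Break i j p
break {i = i} {j} {p} nc ¬nc with ¬noCov (S i j p) ¬nc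
... | x , y , c with nc x y
...   | W , pW , xW , yW = result (mustMove (j ∈? W))
  where
  mustMove : Dec (j ∈ W) → x ≡ i ⊎ y ≡ i
  mustMove (no jW) = ⊥-elim ([ xW , yW ]′ (c (S-avoid⁺ i j jW pW)))
  mustMove (yes jW) with c (S-moved⁺ i j jW pW) | x ≟ i | y ≟ i
  ... | _ | yes e | _ = inj₁ e
  ... | _ | no _ | yes e = inj₂ e
  ... | inj₁ u | no a | no b = ⊥-elim (case x ≟ j of λ
      { (yes refl) → xW jW ; (no d) → xW (swap-other⁻ i j a d u) })
  ... | inj₂ u | no a | no b = ⊥-elim (case y ≟ j of λ
      { (yes refl) → yW jW ; (no d) → yW (swap-other⁻ i j b d u) })
  mk : ∀ z → Cov₂ (S i j p) i z → Break i j p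
  mk z c′ = record
    { z = z
    ; cov₂ = c′
    ; cov₃ = λ {X} pX → case j ∈? X of λ
      { (yes a) → inj₂ (inj₁ a)
      ; (no a) → [ inj₁ , inj₂ ∘ inj₂ ]′ (c′ (S-avoid⁺ i j a pX)) } }
  result : x ≡ i ⊎ y ≡ i → Break i j p
  result (inj₁ refl) = mk y c
  result (inj₂ refl) = mk x (λ h → [ inj₂ , inj₁ ]′ (c h))

record Good (V : Subset n) (k : ℕ) (p : Fam n) : Set where
  field
    unif : Unif V k p
    int : Cross p p
    nocov : NoCov p

Fil : Subset n → ℕ → Fin n → Fin n → Fin n → Fam n → Set
Fil V k a b c p = ∀ {X} → KSub V k X → a ∈ X → b ∈ X → c ∈ X → p ∋ X

-- A set through `a`, `b`, `c` that lacks `i` keeps these three points under the swap, because `j`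
-- is none of them; set and image then both belong to the filter.
S-fil : ∀ {i j : Fin n} {V k a b c p} → i ∈ V → j ∈ V → j ≢ a → j ≢ b → j ≢ c → Fil V k a b c p → Fil V k a b c (S i j p)
S-fil {i = i} {j} {p = p} iV jV ja jb jc f {X} kX@(s , e) a b c = case i ∈? X of λ
  { (yes iX) → S-in⁺ i j iX (f kX a b c)
  ; (no iX) → S-both⁺ i j (f kX a b c) (f ((λ {x} → swap-⊆ i j iV jV s {x}) , trans (∣swap∣ i j X) e)
      (keep iX ja a) (keep iX jb b) (keep iX jc c)) }
  where
  keep : ∀ {x} → i ∉ X → j ≢ x → x ∈ X → x ∈ swap i j X
  keep iX jx h = swap-other⁺ i j (λ { refl → iX h }) (λ e → jx (sym e)) h

-- Shifting into a set while preserving what lies inside it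

module Shifting (V : Subset n) (k : ℕ) where

  -- These are invariants of shifts that remove points outside `Y` only. They make members and
  -- covers placed in `Y` beforehand available at the moment when a later shift breaks.
  record Keeps (Y : Subset n) (p p′ : Fam n) : Set where
    field
      size : ∥ p ∥ ≤ ∥ p′ ∥
      sets : ∀ {X} → X ⊆ Y → p ∋ X → p′ ∋ X
      fils : ∀ {a b c} → a ∈ Y → b ∈ Y → c ∈ Y → Fil V k a b c p → Fil V k a b c p′

  open Keeps

  keeps-refl : ∀ {Y p} → Keeps Y p p
  keeps-refl = record { size = ≤-refl ; sets = λ _ h → h ; fils = λ _ _ _ f → f }

  keeps-S : ∀ {Y p p′ i j} → i ∈ V → j ∈ V → j ∉ Y → Keeps Y p p′ → Keeps Y p (S i j p′)
  keeps-S {i = i} {j} iV jV jY K = record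
    { size = ≤-trans (size K) (≤-reflexive (sym (∥S∥ i j _)))
    ; sets = λ s h → S-avoid⁺ i j (λ u → jY (s u)) (sets K s h)
    ; fils = λ a b c f → S-fil iV jV (λ { refl → jY a }) (λ { refl → jY b }) (λ { refl → jY c }) (fils K a b c f) }

  record Shifted (Y I : Subset n) (p : Fam n) : Set where
    field
      fam : Fam n
      keeps : Keeps Y p fam
      good : Good V k fam
      stable : ∀ {i j} → i ∈ I → j ∈ V → j ∉ Y → Stable i j fam

  record Broken (Y I : Subset n) (p : Fam n) : Set where
    field
      fam : Fam n
      keeps : Keeps Y p fam
      good : Good V k fam
      {i j} : Fin n
      i∈I : i ∈ I
      j∈V : j ∈ V
      j∉Y : j ∉ Y
      brk : Break i j fam

  shiftInto : ∀ {Y I p} → Y ⊆ V → I ⊆ Y → Good V k p → Shifted Y I p ⊎ Broken Y I p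
  shiftInto {Y} {I} {p} YV IY g
    with closure (outer Y) (λ i j p → S i j p) I (V ─ Y) (λ p′ → Keeps Y p p′ × Good V k p′) (λ p′ i j → Break i j p′)
      step p (keeps-refl , g)
    where
    step : ∀ p′ i j → Keeps Y p p′ × Good V k p′ → i ∈ I → j ∈ V ─ Y → (Keeps Y p (S i j p′) × Good V k (S i j p′)) ⊎ Break i j p′
    step p′ i j (K , g) iI jJ with noCov? (S i j p′) | ∈─⁻ V Y jJ
    ... | no h | _ = inj₂ (break (Good.nocov g) h)
    ... | yes h | jV , jY = inj₁ (keeps-S (YV (IY iI)) jV jY K , record
      { unif = S-unif (YV (IY iI)) jV (Good.unif g)
      ; int = S-cross (Good.int g)
      ; nocov = h })
  ... | inj₁ (p′ , (K , g′) , st) = inj₁ (record { fam = p′ ; keeps = K ; good = g′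
      ; stable = λ iI jV jY → outer-stable (IY iI) jY (st iI (x∈p∧x∉q⇒x∈p─q jV jY)) })
  ... | inj₂ (p′ , (K , g′) , i , j , iI , jJ , b) = inj₂ (record { fam = p′ ; keeps = K ; good = g′
      ; i∈I = iI ; j∈V = proj₁ (∈─⁻ V Y jJ) ; j∉Y = proj₂ (∈─⁻ V Y jJ) ; brk = b })

does⁻ : {P : Set} (d : Dec P) → does d ≡ true → P
does⁻ (yes h) _ = h

∈-pts₂ : ∀ {x a b : Fin n} → x ∈ pts (a ∷ b ∷ []) → x ≡ a ⊎ x ≡ b
∈-pts₂ {a = a} {b} h with ∈-pts⁻ (a ∷ b ∷ []) h
... | here e = inj₁ e
... | there (here e) = inj₂ e

∈-pts₃ : ∀ {x a b c : Fin n} → x ∈ pts (a ∷ b ∷ c ∷ []) → x ≡ a ⊎ x ≡ b ⊎ x ≡ c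
∈-pts₃ {a = a} {b} {c} h with ∈-pts⁻ (a ∷ b ∷ c ∷ []) h
... | here e = inj₁ e
... | there (here e) = inj₂ (inj₁ e)
... | there (there (here e)) = inj₂ (inj₂ e)

meets-pts₂⁺ : ∀ {X : Subset n} {a b} → a ∈ X ⊎ b ∈ X → Meets X (pts (a ∷ b ∷ []))
meets-pts₂⁺ (inj₁ h) = _ , h , ∈-pts⁺ at₀
meets-pts₂⁺ (inj₂ h) = _ , h , ∈-pts⁺ at₁

meets-pts₃⁺ : ∀ {X : Subset n} {a b c} → a ∈ X ⊎ b ∈ X ⊎ c ∈ X → Meets X (pts (a ∷ b ∷ c ∷ []))
meets-pts₃⁺ (inj₁ h) = _ , h , ∈-pts⁺ at₀
meets-pts₃⁺ (inj₂ (inj₁ h)) = _ , h , ∈-pts⁺ at₁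
meets-pts₃⁺ (inj₂ (inj₂ h)) = _ , h , ∈-pts⁺ at₂

pts₂-meets⁻ : ∀ {X : Subset n} {a b} → Meets (pts (a ∷ b ∷ [])) X → a ∈ X ⊎ b ∈ X
pts₂-meets⁻ (x , h , xX) with ∈-pts₂ h
... | inj₁ refl = inj₁ xX
... | inj₂ refl = inj₂ xX

pts₃-meets⁻ : ∀ {X : Subset n} {a b c} → Meets (pts (a ∷ b ∷ c ∷ [])) X → a ∈ X ⊎ b ∈ X ⊎ c ∈ X
pts₃-meets⁻ (x , h , xX) with ∈-pts₃ h
... | inj₁ refl = inj₁ xX
... | inj₂ (inj₁ refl) = inj₂ (inj₁ xX)
... | inj₂ (inj₂ refl) = inj₂ (inj₂ xX)

-- Reduction to a core of 2k points

module Stages {n : ℕ} (V : Subset n) (k : ℕ) (4≤k : 4 ≤ k) (2k≤∣V∣ : k + k ≤ ∣ V ∣) where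

  open Shifting V k
  open Keeps

  record CoreRes (p : Fam n) : Set where
    field
      fam : Fam n
      size-≤ : ∥ p ∥ ≤ ∥ fam ∥
      good : Good V k fam
      Y : Subset n
      Y⊆V : Y ⊆ V
      ∣Y∣ : ∣ Y ∣ ≡ k + k
      isCore : Core Y fam fam

  resize : ∀ {p p′} → ∥ p ∥ ≤ ∥ p′ ∥ → CoreRes p′ → CoreRes p
  resize h r = record { CoreRes r ; size-≤ = ≤-trans h (CoreRes.size-≤ r) }

  -- A cover `R` of at most `k` points leaves at least `k` points of `V`; if it missed the triple, a
  -- member through the triple would fit beside it. It is applied with a member, with the triple
  -- `i`, `j`, `z` and with the pair `i`, `z` as `R`.
  fil-meets : ∀ {p a b c R} → a ∈ V → b ∈ V → c ∈ V → ∣ R ∣ ≤ k → (∀ {X} → p ∋ X → Meets X R) →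
    Fil V k a b c p → Meets R (pts (a ∷ b ∷ c ∷ []))
  fil-meets {p} {a} {b} {c} {R} aV bV cV R≤k cov f with meets? R (pts (a ∷ b ∷ c ∷ []))
  ... | yes h = h
  ... | no h = ⊥-elim (
    let W , A⊆W , W⊆ , ∣W∣ = ∃-superset (pts (a ∷ b ∷ c ∷ [])) (V ─ R) k
          (λ x∈ → x∈p∧x∉q⇒x∈p─q (pts-⊆ (aV ∷ bV ∷ cV ∷ []) x∈) (λ xR → h (_ , xR , x∈)))
          (≤-trans (∣pts∣≤ (a ∷ b ∷ c ∷ [])) (≤-trans (n≤1+n 3) 4≤k))
          (+-cancelˡ-≤ k _ _ (≤-trans 2k≤∣V∣ (≤-trans (≤-reflexive (sym (∣∩∣+∣─∣ V R)))
            (+-monoˡ-≤ ∣ V ─ R ∣ (≤-trans (∣p∩q∣≤∣q∣ V R) R≤k)))))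
        pW = f ((λ x∈ → proj₁ (∈─⁻ V R (W⊆ x∈))) , ∣W∣) (A⊆W (∈-pts⁺ at₀))
               (A⊆W (∈-pts⁺ at₁)) (A⊆W (∈-pts⁺ at₂))
        x , xW , xR = cov pW
    in proj₂ (∈─⁻ V R (W⊆ xW)) xR)

  pts-small : ∀ {xs : List (Fin n)} → length xs ≤ 4 → ∣ pts xs ∣ ≤ k
  pts-small {xs} h = ≤-trans (∣pts∣≤ xs) (≤-trans h 4≤k)

  fil-hit : ∀ {p a b c X} → Good V k p → a ∈ V → b ∈ V → c ∈ V → Fil V k a b c p → p ∋ X → a ∈ X ⊎ b ∈ X ⊎ c ∈ X
  fil-hit {X = X} g aV bV cV f pX =
    let x , a , b = fil-meets aV bV cV (≤-reflexive (proj₂ (Good.unif g pX))) (λ pZ → Good.int g pZ pX) f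
    in pts₃-meets⁻ (x , b , a)

  record Added (p : Fam n) (a b c : Fin n) : Set where
    field
      fam : Fam n
      size-≤ : ∥ p ∥ ≤ ∥ fam ∥
      good : Good V k fam
      fil : Fil V k a b c fam
      old : ∀ {X} → p ∋ X → fam ∋ X

  -- A `k`-set containing the whole cover meets every old member, and two new sets share `a`.
  addFil : ∀ {p a b c} → Good V k p → (∀ {X} → p ∋ X → a ∈ X ⊎ b ∈ X ⊎ c ∈ X) → Added p a b c
  addFil {p} {a} {b} {c} g cov = record
    { fam = q
    ; size-≤ = #-mono (p ∋?_) (q ∋?_) (λ X → old)
    ; good = record
      { unif = λ h → [ Good.unif g , proj₁ ]′ (q⁻ h)
      ; int = λ hX hZ → meet (q⁻ hX) (q⁻ hZ)
      ; nocov = λ x y → let X , pX , r = Good.nocov g x y in X , old pX , r }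
    ; fil = λ kX u v w → mem (∨-trueʳ (dec-true (new? _) (kX , u , v , w)))
    ; old = old }
    where
    new? : (X : Subset n) → Dec (KSub V k X × a ∈ X × b ∈ X × c ∈ X)
    new? X = ksub? V k X ×-dec (a ∈? X) ×-dec (b ∈? X) ×-dec (c ∈? X)
    q : Fam n
    q X = p X ∨ does (new? X)
    old : ∀ {X} → p ∋ X → q ∋ X
    old h = mem (∨-trueˡ (holds h))
    q⁻ : ∀ {X} → q ∋ X → p ∋ X ⊎ (KSub V k X × a ∈ X × b ∈ X × c ∈ X)
    q⁻ {X} h = [ inj₁ ∘ mem , inj₂ ∘ does⁻ (new? X) ]′ (∨-true⁻ {p X} (holds h))
    hit : ∀ {X Z : Subset n} → a ∈ X ⊎ b ∈ X ⊎ c ∈ X → KSub V k Z × a ∈ Z × b ∈ Z × c ∈ Z → Meets X Z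
    hit (inj₁ h) (_ , u , v , w) = a , h , u
    hit (inj₂ (inj₁ h)) (_ , u , v , w) = b , h , v
    hit (inj₂ (inj₂ h)) (_ , u , v , w) = c , h , w
    meet : ∀ {X Z} → p ∋ X ⊎ (KSub V k X × a ∈ X × b ∈ X × c ∈ X) → p ∋ Z ⊎ (KSub V k Z × a ∈ Z × b ∈ Z × c ∈ Z) → Meets X Z
    meet (inj₁ u) (inj₁ v) = Good.int g u v
    meet (inj₁ u) (inj₂ v) = hit (cov u) v
    meet (inj₂ u) (inj₁ v) = let x , a , b = hit (cov v) u in x , b , a
    meet (inj₂ u) (inj₂ v) = hit (inj₁ (proj₁ (proj₂ u))) v

  module _ {p : Fam n} {i j : Fin n} (g : Good V k p) (b : Break i j p) where
    open Break b

    break-z≢i : z ≢ i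
    break-z≢i refl = let X , pX , u , v = Good.nocov g i j in [ u , [ v , u ]′ ]′ (cov₃ pX)

    break-z≢j : z ≢ j
    break-z≢j refl = let X , pX , u , v = Good.nocov g i j in [ u , [ v , v ]′ ]′ (cov₃ pX)

    break-z∈V : z ∈ V
    break-z∈V = let X , pX , u , v = Good.nocov g i j in
      [ ⊥-elim ∘ u , [ ⊥-elim ∘ v , proj₁ (Good.unif g pX) ]′ ]′ (cov₃ pX)

    break-fil₃ : ∀ {a b c} → a ∈ V → b ∈ V → c ∈ V → Fil V k a b c p →
      i ∈ pts (a ∷ b ∷ c ∷ []) ⊎ j ∈ pts (a ∷ b ∷ c ∷ []) ⊎ z ∈ pts (a ∷ b ∷ c ∷ [])
    break-fil₃ aV bV cV f = pts₃-meets⁻ (fil-meets aV bV cV (pts-small (s≤s (s≤s (s≤s z≤n)))) (meets-pts₃⁺ ∘ cov₃) f)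

    break-fil₂ : ∀ {a b c} → a ∈ V → b ∈ V → c ∈ V → Fil V k a b c (S i j p) →
      i ∈ pts (a ∷ b ∷ c ∷ []) ⊎ z ∈ pts (a ∷ b ∷ c ∷ [])
    break-fil₂ aV bV cV f = pts₂-meets⁻ (fil-meets aV bV cV (pts-small (s≤s (s≤s z≤n))) (meets-pts₂⁺ ∘ cov₂) f)

  -- Two members with a common point outside `Y` have at most `k - 1` points in `Y` each, so a point
  -- of the 2k-set `Y` lies outside both.
  finish : ∀ {Y p} → Y ⊆ V → ∣ Y ∣ ≡ k + k → Shifted Y Y p → CoreRes p
  finish {Y} YV eY sh = record
    { fam = fam ; size-≤ = size keeps ; good = good ; Y = Y ; Y⊆V = YV ; ∣Y∣ = eY
    ; isCore = core (Good.int good) (λ {X} {Z} {j} pX pZ jX jZ jY _ →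
        let i , iY , iX , iZ = ∃-outside {X = X} {Z} {Y} (≤-trans (+-mono-< (small pX jX jY) (small pZ jZ jY)) (≤-reflexive (sym eY)))
        in i , iY , iX , iZ , stable iY (proj₁ (Good.unif good pX) jX) jY pX jX iX) }
    where
    open Shifted sh
    small : ∀ {X j} → fam ∋ X → j ∈ X → j ∉ Y → ∣ X ∩ Y ∣ < k
    small {X} {j} pX jX jY = ≤-trans (outside-≤ (j ∷ []) ([] ∷ []) ((jX , jY) ∷ [])) (≤-reflexive (proj₂ (Good.unif good pX)))

  Avoids : Subset n → Subset n → Set
  Avoids W A = ∀ {x} → x ∈ A → x ∉ W

  module _ {p Y I A} (u : Unif V k p) (I⊆Y : I ⊆ Y) (A∉I : ∀ {x} → x ∈ A → x ∉ I)
    (st : ∀ {i j} → i ∈ I → j ∈ V → j ∉ Y → Stable i j p)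
    (room : ∀ {W r} → p ∋ W → Avoids W A → r ∈ W → r ∉ Y → ∣ W ∩ I ∣ < ∣ I ∣) where

    -- This is how a witness gets inside `Y`: points brought in from `I` do not spoil the avoidance
    -- because `A` is disjoint from `I`, and `room` provides a free point of `I` as long as the set
    -- sticks out of `Y`.
    moveIn : ∀ {W} → p ∋ W → Avoids W A → ∃ λ W′ → p ∋ W′ × Avoids W′ A × W′ ⊆ Y
    moveIn {W} pW av = go W pW av (<-wellFounded _)
      where
      go : ∀ W → p ∋ W → Avoids W A → Acc _<_ ∣ W ─ Y ∣ → ∃ λ W′ → p ∋ W′ × Avoids W′ A × W′ ⊆ Y
      go W pW av (acc rs) with any? (λ r → (r ∈? W) ×-dec ¬? (r ∈? Y))
      ... | no h = W , pW , av , λ {x} xW → case x ∈? Y of λ { (yes y) → y ; (no y) → ⊥-elim (h (x , xW , y)) }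
      ... | yes (r , rW , rY) with ∣p∣<∣q∣⇒∃ (W ∩ I) I (room pW av rW rY)
      ...   | i , iI , i∉ = go (swap i r W) (st iI (proj₁ (u pW) rW) rY pW rW iW) av′ (rs (≤-reflexive (swap-─ i r (I⊆Y iI) rY rW iW)))
        where
        iW : i ∉ W
        iW h = i∉ (x∈p∩q⁺ (h , iI))
        av′ : Avoids (swap i r W) A
        av′ {x} xA x∈ with x ≟ r
        ... | yes refl = iW (swap-j⁻ i r x∈)
        ... | no x≢r = av xA (swap-other⁻ i r (λ { refl → A∉I xA iI }) x≢r x∈)

  ksuperset : ∀ A → A ⊆ V → ∣ A ∣ ≤ k + k → ∃ λ Y → A ⊆ Y × Y ⊆ V × ∣ Y ∣ ≡ k + k
  ksuperset A s h = ∃-superset A V (k + k) s h 2k≤∣V∣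

  -- Two or three pairwise intersecting covers

  record Conf (p : Fam n) (v b c d e : Fin n) : Set where
    field
      good : Good V k p
      vV : v ∈ V
      bV : b ∈ V
      cV : c ∈ V
      dV : d ∈ V
      eV : e ∈ V
      vb : v ≢ b
      vc : v ≢ c
      vd : v ≢ d
      ve : v ≢ e
      bc : b ≢ c
      bd : b ≢ d
      be : b ≢ e
      cd : c ≢ d
      ce : c ≢ e
      de : d ≢ e
      fil₁ : Fil V k v b c p
      fil₂ : Fil V k v d e p

  module _ {p : Fam n} {v b c d e : Fin n} (cf : Conf p v b c d e) where
    open Conf cf

    flipL : Conf p v c b d e
    flipL = record { good = good ; vV = vV ; bV = cV ; cV = bV ; dV = dV ; eV = eV ; vb = vc ; vc = vb ; vd = vd ; ve = ve
                   ; bc = bc ∘ sym ; bd = cd ; be = ce ; cd = bd ; ce = be ; de = de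
                   ; fil₁ = λ kX x y z → fil₁ kX x z y ; fil₂ = fil₂ }

    flipX : Conf p v d e b c
    flipX = record { good = good ; vV = vV ; bV = dV ; cV = eV ; dV = bV ; eV = cV ; vb = vd ; vc = ve ; vd = vb ; ve = vc
                   ; bc = de ; bd = bd ∘ sym ; be = cd ∘ sym ; cd = be ∘ sym ; ce = ce ∘ sym ; de = bc
                   ; fil₁ = fil₂ ; fil₂ = fil₁ }

    five : List (Fin n)
    five = v ∷ b ∷ c ∷ d ∷ e ∷ []

    conf-keeps : ∀ {Y p′} → All (_∈ Y) five → Keeps Y p p′ → Good V k p′ → Conf p′ v b c d e
    conf-keeps (v′ ∷ b′ ∷ c′ ∷ d′ ∷ e′ ∷ []) K g = record
      { Conf cf ; good = g ; fil₁ = fils K v′ b′ c′ fil₁ ; fil₂ = fils K v′ d′ e′ fil₂ }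

    common : ∀ {z} → z ∈ pts (v ∷ b ∷ c ∷ []) → z ∈ pts (v ∷ d ∷ e ∷ []) → z ≡ v
    common h h′ with ∈-pts₃ h | ∈-pts₃ h′
    ... | inj₁ eq | _ = eq
    ... | inj₂ _ | inj₁ eq = eq
    ... | inj₂ (inj₁ refl) | inj₂ (inj₁ eq) = ⊥-elim (bd eq)
    ... | inj₂ (inj₁ refl) | inj₂ (inj₂ eq) = ⊥-elim (be eq)
    ... | inj₂ (inj₂ refl) | inj₂ (inj₁ eq) = ⊥-elim (cd eq)
    ... | inj₂ (inj₂ refl) | inj₂ (inj₂ eq) = ⊥-elim (ce eq)

    hitL : ∀ {X} → p ∋ X → v ∉ X → b ∈ X ⊎ c ∈ X
    hitL pX vX = resolveˡ vX (fil-hit good vV bV cV fil₁ pX)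

    hitR : ∀ {X} → p ∋ X → v ∉ X → d ∈ X ⊎ e ∈ X
    hitR pX vX = resolveˡ vX (fil-hit good vV dV eV fil₂ pX)

  module Stage₄ {p : Fam n} {v b c d e f : Fin n} (cf : Conf p v b c d e) (fV : f ∈ V) (vf : v ≢ f) (fil₃ : Fil V k b d f p) where
    open Conf cf

    six : List (Fin n)
    six = v ∷ b ∷ c ∷ d ∷ e ∷ f ∷ []

    sup : ∃ λ Y → pts six ⊆ Y × Y ⊆ V × ∣ Y ∣ ≡ k + k
    sup = ksuperset (pts six) (pts-⊆ (vV ∷ bV ∷ cV ∷ dV ∷ eV ∷ fV ∷ []))
      (≤-trans (∣pts∣≤ six) (≤-trans (s≤s (s≤s (s≤s (s≤s (s≤s (s≤s z≤n)))))) (+-mono-≤ 4≤k 4≤k)))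

    Y I : Subset n
    Y = proj₁ sup
    I = Y ─ pts six
    six⊆Y : pts six ⊆ Y
    six⊆Y = proj₁ (proj₂ sup)
    Y⊆V : Y ⊆ V
    Y⊆V = proj₁ (proj₂ (proj₂ sup))
    ∣Y∣ : ∣ Y ∣ ≡ k + k
    ∣Y∣ = proj₂ (proj₂ (proj₂ sup))

    T₁ T₂ T₃ : List (Fin n)
    T₁ = v ∷ b ∷ c ∷ []
    T₂ = v ∷ d ∷ e ∷ []
    T₃ = b ∷ d ∷ f ∷ []

    vY : v ∈ Y
    vY = six⊆Y (∈-pts⁺ at₀)
    bY : b ∈ Y
    bY = six⊆Y (∈-pts⁺ at₁)
    cY : c ∈ Y
    cY = six⊆Y (∈-pts⁺ at₂)
    dY : d ∈ Y
    dY = six⊆Y (∈-pts⁺ at₃)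
    eY : e ∈ Y
    eY = six⊆Y (∈-pts⁺ at₄)
    fY : f ∈ Y
    fY = six⊆Y (∈-pts⁺ at₅)

    T₁⊆ : pts T₁ ⊆ pts six
    T₁⊆ = pts-⊆ (∈-pts⁺ at₀ ∷ ∈-pts⁺ at₁ ∷ ∈-pts⁺ at₂ ∷ [])
    T₂⊆ : pts T₂ ⊆ pts six
    T₂⊆ = pts-⊆ (∈-pts⁺ at₀ ∷ ∈-pts⁺ at₃ ∷ ∈-pts⁺ at₄ ∷ [])
    T₃⊆ : pts T₃ ⊆ pts six
    T₃⊆ = pts-⊆ (∈-pts⁺ at₁ ∷ ∈-pts⁺ at₃ ∷ ∈-pts⁺ at₅ ∷ [])

    noCommon : ∀ {z} → z ∈ pts T₁ → z ∈ pts T₂ → ¬ (z ∈ pts T₃)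
    noCommon h₁ h₂ h₃ with common cf h₁ h₂
    ... | refl = [ vb , [ vd , vf ]′ ]′ (∈-pts₃ h₃)

    third : ∀ {i j z} {T : List (Fin n)} → pts T ⊆ pts six → i ∉ pts six → j ∉ pts six → i ∈ pts T ⊎ j ∈ pts T ⊎ z ∈ pts T → z ∈ pts T
    third s i∉ j∉ = [ (λ h → ⊥-elim (i∉ (s h))) , [ (λ h → ⊥-elim (j∉ (s h))) , (λ h → h) ]′ ]′

    -- The broken cover meets all three triples, but `i` and `j` avoid the six points, so `z` alone
    -- would have to be common to the triples.
    noBreak₁ : ¬ Broken Y I p
    noBreak₁ br = noCommon
        (third T₁⊆ i∉ j∉ (break-fil₃ good′ brk vV bV cV (fils keeps vY bY cY fil₁)))
        (third T₂⊆ i∉ j∉ (break-fil₃ good′ brk vV dV eV (fils keeps vY dY eY fil₂)))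
        (third T₃⊆ i∉ j∉ (break-fil₃ good′ brk bV dV fV (fils keeps bY dY fY fil₃)))
      where
      open Broken br renaming (good to good′)
      i∉ : i ∉ pts six
      i∉ = proj₂ (∈─⁻ Y (pts six) i∈I)
      j∉ : j ∉ pts six
      j∉ h = j∉Y (six⊆Y h)

    module _ (sh : Shifted Y I p) where
      open Shifted sh renaming (good to good′)

      twoPoints : ∀ {W} → fam ∋ W → ∃ λ s → ∃ λ t → s ≢ t × s ∈ W × t ∈ W × s ∈ pts six × t ∈ pts six
      twoPoints {W} pW with fil-hit good′ vV bV cV (fils keeps vY bY cY fil₁) pW
                          | fil-hit good′ vV dV eV (fils keeps vY dY eY fil₂) pW
                          | fil-hit good′ bV dV fV (fils keeps bY dY fY fil₃) pW
      ... | inj₁ x | _ | inj₁ y = v , b , vb , x , y , T₁⊆ (∈-pts⁺ at₀) , T₃⊆ (∈-pts⁺ at₀)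
      ... | inj₁ x | _ | inj₂ (inj₁ y) = v , d , vd , x , y , T₁⊆ (∈-pts⁺ at₀) , T₃⊆ (∈-pts⁺ at₁)
      ... | inj₁ x | _ | inj₂ (inj₂ y) = v , f , vf , x , y , T₁⊆ (∈-pts⁺ at₀) , T₃⊆ (∈-pts⁺ at₂)
      ... | inj₂ (inj₁ x) | inj₁ y | _ = b , v , vb ∘ sym , x , y , T₁⊆ (∈-pts⁺ at₁) , T₂⊆ (∈-pts⁺ at₀)
      ... | inj₂ (inj₁ x) | inj₂ (inj₁ y) | _ = b , d , bd , x , y , T₁⊆ (∈-pts⁺ at₁) , T₂⊆ (∈-pts⁺ at₁)
      ... | inj₂ (inj₁ x) | inj₂ (inj₂ y) | _ = b , e , be , x , y , T₁⊆ (∈-pts⁺ at₁) , T₂⊆ (∈-pts⁺ at₂)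
      ... | inj₂ (inj₂ x) | inj₁ y | _ = c , v , vc ∘ sym , x , y , T₁⊆ (∈-pts⁺ at₂) , T₂⊆ (∈-pts⁺ at₀)
      ... | inj₂ (inj₂ x) | inj₂ (inj₁ y) | _ = c , d , cd , x , y , T₁⊆ (∈-pts⁺ at₂) , T₂⊆ (∈-pts⁺ at₁)
      ... | inj₂ (inj₂ x) | inj₂ (inj₂ y) | _ = c , e , ce , x , y , T₁⊆ (∈-pts⁺ at₂) , T₂⊆ (∈-pts⁺ at₂)

      -- A member with a point `r` outside `Y` also has two of the six points, so at most `k - 3` of
      -- its points are in `I`. As `∣ I ∣` is at least `2k - 6`, `4 ≤ k` leaves a free point.
      room : ∀ {W r} → fam ∋ W → r ∈ W → r ∉ Y → ∣ W ∩ I ∣ < ∣ I ∣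
      room {W} {r} pW rW rY =
        let s , t , s≢t , sW , tW , s∈ , t∈ = twoPoints pW
            w≤ : 3 + ∣ W ∩ I ∣ ≤ k
            w≤ = ≤-trans (outside-≤ (r ∷ s ∷ t ∷ [])
                   ((∈∉⇒≢ (six⊆Y s∈) rY ∘ sym ∷ ∈∉⇒≢ (six⊆Y t∈) rY ∘ sym ∷ []) ∷ (s≢t ∷ []) ∷ [] ∷ [])
                   ((rW , λ h → rY (proj₁ (∈─⁻ Y (pts six) h))) ∷ (sW , λ h → proj₂ (∈─⁻ Y (pts six) h) s∈) ∷ (tW , λ h → proj₂ (∈─⁻ Y (pts six) h) t∈) ∷ []))
                   (≤-reflexive (proj₂ (Good.unif good′ pW)))
        in +-cancelˡ-≤ 6 _ _ (begin
             6 + suc ∣ W ∩ I ∣  ≡⟨ solve 1 (λ w → con 6 :+ (con 1 :+ w) := con 4 :+ (con 3 :+ w)) refl ∣ W ∩ I ∣ ⟩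
             4 + (3 + ∣ W ∩ I ∣)  ≤⟨ +-mono-≤ 4≤k w≤ ⟩
             k + k  ≡⟨ sym ∣Y∣ ⟩
             ∣ Y ∣  ≤⟨ ∣─pts∣ Y six ⟩
             6 + ∣ I ∣  ∎)
        where
        open ≤-Reasoning
        open +-*-Solver using (solve; _:=_; _:+_; con)

      avoid : ∀ {x y} → x ∈ pts six → y ∈ pts six → ∃ λ W → fam ∋ W × x ∉ W × y ∉ W × W ⊆ Y
      avoid {x} {y} x∈ y∈ =
        let W , pW , xW , yW = Good.nocov good′ x y
            W′ , pW′ , av , s = moveIn {fam} {Y} {I} {pts (x ∷ y ∷ [])} (Good.unif good′) (p─q⊆p Y (pts six))
              (λ h hI → proj₂ (∈─⁻ Y (pts six) hI) (pts-⊆ (x∈ ∷ y∈ ∷ []) h)) stable (λ pW _ → room pW) pW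
              (λ h → All.lookup (xW ∷ yW ∷ []) (∈-pts⁻ _ h))
        in W′ , pW′ , av (∈-pts⁺ at₀) , av (∈-pts⁺ at₁) , s

      -- The pair `i`, `z` must meet all three triples, which one point cannot do, so both are among
      -- the six points. Then `avoid` supplies a member inside `Y` that misses both and survives
      -- every shift.
      noBreak₂ : ¬ Broken Y Y fam
      noBreak₂ br = case i ∈? pts six of λ
          { (no i∉) → noCommon (z₁ i∉) (z₂ i∉) (z₃ i∉)
          ; (yes i∈) → case z ∈? pts six of λ
            { (no z∉) → noCommon (i₁ z∉) (i₂ z∉) (i₃ z∉)
            ; (yes z∈) → let W , pW , iW , zW , s = avoid i∈ z∈ in
                [ iW , zW ]′ (cov₂ (S-avoid⁺ i j (λ h → j∉Y (s h)) (sets K s pW))) } }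
        where
        open Broken br renaming (good to good″; keeps to K; fam to fam′)
        open Break brk
        S-keeps : Keeps Y fam (S i j fam′)
        S-keeps = keeps-S (Y⊆V i∈I) j∈V j∉Y K
        m₁ = break-fil₂ good″ brk vV bV cV (fils S-keeps vY bY cY (fils keeps vY bY cY fil₁))
        m₂ = break-fil₂ good″ brk vV dV eV (fils S-keeps vY dY eY (fils keeps vY dY eY fil₂))
        m₃ = break-fil₂ good″ brk bV dV fV (fils S-keeps bY dY fY (fils keeps bY dY fY fil₃))
        z₁ : i ∉ pts six → z ∈ pts T₁
        z₁ h = [ ⊥-elim ∘ h ∘ T₁⊆ , (λ u → u) ]′ m₁
        z₂ : i ∉ pts six → z ∈ pts T₂
        z₂ h = [ ⊥-elim ∘ h ∘ T₂⊆ , (λ u → u) ]′ m₂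
        z₃ : i ∉ pts six → z ∈ pts T₃
        z₃ h = [ ⊥-elim ∘ h ∘ T₃⊆ , (λ u → u) ]′ m₃
        i₁ : z ∉ pts six → i ∈ pts T₁
        i₁ h = [ (λ u → u) , ⊥-elim ∘ h ∘ T₁⊆ ]′ m₁
        i₂ : z ∉ pts six → i ∈ pts T₂
        i₂ h = [ (λ u → u) , ⊥-elim ∘ h ∘ T₂⊆ ]′ m₂
        i₃ : z ∉ pts six → i ∈ pts T₃
        i₃ h = [ (λ u → u) , ⊥-elim ∘ h ∘ T₃⊆ ]′ m₃

      result : CoreRes p
      result with shiftInto {Y} {Y} Y⊆V ⊆-refl good′
      ... | inj₁ sh′ = resize (size keeps) (finish Y⊆V ∣Y∣ sh′)
      ... | inj₂ br = ⊥-elim (noBreak₂ br)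

    stage₄ : CoreRes p
    stage₄ with shiftInto {Y} {I} Y⊆V (p─q⊆p Y (pts six)) good
    ... | inj₁ sh = result sh
    ... | inj₂ br = ⊥-elim (noBreak₁ br)

  module _ {p : Fam n} {v b c d e : Fin n} (cf : Conf p v b c d e) where
    open Conf cf

    conf-⊇ : ∀ {q} → (∀ {X} → p ∋ X → q ∋ X) → Good V k q → Conf q v b c d e
    conf-⊇ sub g = record
      { Conf cf ; good = g ; fil₁ = λ kX x y z → sub (fil₁ kX x y z) ; fil₂ = λ kX x y z → sub (fil₂ kX x y z) }

    flipR : Conf p v b c e d
    flipR = flipX (flipL (flipX cf))

  toStage₄ : ∀ {p v b c d e s t f} → Conf p v b c d e → s ≡ b ⊎ s ≡ c → t ≡ d ⊎ t ≡ e → f ∈ V → v ≢ f → Fil V k s t f p → CoreRes p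
  toStage₄ cf (inj₁ refl) (inj₁ refl) fV vf f = Stage₄.stage₄ cf fV vf f
  toStage₄ cf (inj₂ refl) (inj₁ refl) fV vf f = Stage₄.stage₄ (flipL cf) fV vf f
  toStage₄ cf (inj₁ refl) (inj₂ refl) fV vf f = Stage₄.stage₄ (flipR cf) fV vf f
  toStage₄ cf (inj₂ refl) (inj₂ refl) fV vf f = Stage₄.stage₄ (flipL (flipR cf)) fV vf f

  -- Two members that avoid `v` and jointly contain `b`, `c`, `d`, `e`. Since they intersect, their
  -- union together with `v` has at most `2k` points, so one set `Y` can hold both members and all
  -- five points.
  record PQ (p : Fam n) (v b c d e : Fin n) : Set where
    field
      P Q : Subset n
      pP : p ∋ P
      pQ : p ∋ Q
      vP : v ∉ P
      vQ : v ∉ Q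
      cb : b ∈ P ⊎ b ∈ Q
      cc : c ∈ P ⊎ c ∈ Q
      cd : d ∈ P ⊎ d ∈ Q
      ce : e ∈ P ⊎ e ∈ Q

  findPQ : ∀ {p v b c d e} → Conf p v b c d e → PQ p v b c d e
  findPQ {p} {v} {b} {c} {d} {e} cf =
    let P , pP , vP , bP = Good.nocov good v b
        cP = resolveˡ bP (hitL cf pP vP)
        Q , pQ , vQ , cQ = Good.nocov good v c
        bQ = resolveʳ cQ (hitL cf pQ vQ)
        mk : ∀ {P Q} → p ∋ P → p ∋ Q → v ∉ P → v ∉ Q → b ∈ P ⊎ b ∈ Q → c ∈ P ⊎ c ∈ Q → d ∈ P ⊎ d ∈ Q → e ∈ P ⊎ e ∈ Q → PQ p v b c d e
        mk = λ {P} {Q} u v w x y z s t → record { P = P ; Q = Q ; pP = u ; pQ = v ; vP = w ; vQ = x ; cb = y ; cc = z ; cd = s ; ce = t }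
        -- P ∋ c, s and Q ∋ b, s, both avoiding the mate of s, so a set avoiding s completes one of them.
        go : ∀ {s t} → (s ∈ P) → (s ∈ Q) → (∀ {X} → p ∋ X → v ∉ X → s ∈ X ⊎ t ∈ X) →
             (∀ {X Z} → s ∈ X → t ∈ Z → (d ∈ X ⊎ d ∈ Z) × (e ∈ X ⊎ e ∈ Z)) → PQ p v b c d e
        go = λ {s} {t} sP sQ hit perm →
          let R , pR , vR , sR = Good.nocov good v s
              tR = resolveˡ sR (hit pR vR)
          in [ (λ bR → let x , y = perm sP tR in mk pP pR vP vR (inj₂ bR) (inj₁ cP) x y)
             , (λ cR → let x , y = perm sQ tR in mk pQ pR vQ vR (inj₁ bQ) (inj₂ cR) x y) ]′ (hitL cf pR vR)
    in case d ∈? P of λ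
      { (yes dP) → case e ∈? P of λ
        { (yes eP) → mk pP pQ vP vQ (inj₂ bQ) (inj₁ cP) (inj₁ dP) (inj₁ eP)
        ; (no _) → case e ∈? Q of λ
          { (yes eQ) → mk pP pQ vP vQ (inj₂ bQ) (inj₁ cP) (inj₁ dP) (inj₂ eQ)
          ; (no eQ) → go {d} {e} dP (resolveʳ eQ (hitR cf pQ vQ)) (hitR cf) (λ u w → inj₁ u , inj₂ w) } }
      ; (no dP) → let eP = resolveˡ dP (hitR cf pP vP) in case d ∈? Q of λ
        { (yes dQ) → mk pP pQ vP vQ (inj₂ bQ) (inj₁ cP) (inj₂ dQ) (inj₁ eP)
        ; (no dQ) → go {e} {d} eP (resolveˡ dQ (hitR cf pQ vQ))
            (λ u w → [ inj₂ , inj₁ ]′ (hitR cf u w)) (λ u w → inj₂ w , inj₁ u) } }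
    where open Conf cf

  small-by : ∀ {p X Z} → Good V k p → p ∋ X → Z ⊆ X → ∀ {r s t} → r ≢ s → r ≢ t → s ≢ t →
    r ∈ X → s ∈ X → t ∈ X → r ∉ Z → s ∉ Z → t ∉ Z → 3 + ∣ Z ∣ ≤ k
  small-by {X = X} {Z} g pX Z⊆X {r} {s} {t} rs rt st rX sX tX rZ sZ tZ = ≤-trans
    (+-monoʳ-≤ 3 (p⊆q⇒∣p∣≤∣q∣ {p = Z} {q = X ∩ Z} (λ h → x∈p∩q⁺ (Z⊆X h , h))))
    (≤-trans (outside-≤ (r ∷ s ∷ t ∷ []) ((rs ∷ rt ∷ []) ∷ (st ∷ []) ∷ [] ∷ []) ((rX , rZ) ∷ (sX , sZ) ∷ (tX , tZ) ∷ []))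
      (≤-reflexive (proj₂ (Good.unif g pX))))

  module Stage₃ {p : Fam n} {v b c d e : Fin n} (cf : Conf p v b c d e) (pq : PQ p v b c d e)
    (small : 3 + ∣ (PQ.P pq ∩ PQ.Q pq) ─ pts (five cf) ∣ ≤ k) where
    open Conf cf
    open PQ pq using (P; Q; pP; pQ; vP; vQ; cb; cc) renaming (cd to cd′; ce to ce′)

    pts5 A : Subset n
    pts5 = pts (five cf)
    A = ⁅ v ⁆ ∪ (P ∪ Q)

    sup : ∃ λ Y → A ⊆ Y × Y ⊆ V × ∣ Y ∣ ≡ k + k
    sup = ksuperset A
      (λ h → [ (λ u → subst (_∈ V) (sym (x∈⁅y⁆⇒x≡y v u)) vV) ,
               (λ u → [ proj₁ (Good.unif good pP) , proj₁ (Good.unif good pQ) ]′ (x∈p∪q⁻ P Q u)) ]′ (x∈p∪q⁻ ⁅ v ⁆ (P ∪ Q) h))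
      (begin
        ∣ A ∣  ≤⟨ ∣∪∣≤ ⁅ v ⁆ (P ∪ Q) ⟩
        ∣ ⁅ v ⁆ ∣ + ∣ P ∪ Q ∣  ≡⟨ cong (_+ ∣ P ∪ Q ∣) (∣⁅x⁆∣≡1 v) ⟩
        1 + ∣ P ∪ Q ∣  ≤⟨ +-monoˡ-≤ ∣ P ∪ Q ∣ common≥1 ⟩
        ∣ P ∩ Q ∣ + ∣ P ∪ Q ∣  ≡⟨ +-comm ∣ P ∩ Q ∣ _ ⟩
        ∣ P ∪ Q ∣ + ∣ P ∩ Q ∣  ≡⟨ ∣∪∣+∣∩∣ P Q ⟩
        ∣ P ∣ + ∣ Q ∣  ≡⟨ cong₂ _+_ (proj₂ (Good.unif good pP)) (proj₂ (Good.unif good pQ)) ⟩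
        k + k  ∎)
      where
      open ≤-Reasoning
      common≥1 : 1 ≤ ∣ P ∩ Q ∣
      common≥1 = let x , xP , xQ = Good.int good pP pQ in
        x∈p⇒1≤∣p∣ (x∈p∩q⁺ (xP , xQ))

    Y I : Subset n
    Y = proj₁ sup
    -- Without the points of `P ∩ Q`, every `i` in `I` is missed by `P` or by `Q`, and that member
    -- also misses `v`: it refutes the pair `i`, `v`.
    I = (Y ─ pts5) ─ (P ∩ Q)
    Y⊆V : Y ⊆ V
    Y⊆V = proj₁ (proj₂ (proj₂ sup))
    ∣Y∣ : ∣ Y ∣ ≡ k + k
    ∣Y∣ = proj₂ (proj₂ (proj₂ sup))
    P⊆Y : P ⊆ Y
    P⊆Y h = proj₁ (proj₂ sup) (x∈p∪q⁺ (inj₂ (x∈p∪q⁺ (inj₁ h))))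
    Q⊆Y : Q ⊆ Y
    Q⊆Y h = proj₁ (proj₂ sup) (x∈p∪q⁺ (inj₂ (x∈p∪q⁺ (inj₂ h))))
    PQ⊆Y : ∀ {x} → x ∈ P ⊎ x ∈ Q → x ∈ Y
    PQ⊆Y = [ P⊆Y , Q⊆Y ]′
    vY : v ∈ Y
    vY = proj₁ (proj₂ sup) (x∈p∪q⁺ (inj₁ (x∈⁅x⁆ v)))
    five-Y : All (_∈ Y) (five cf)
    five-Y = vY ∷ PQ⊆Y cb ∷ PQ⊆Y cc ∷ PQ⊆Y cd′ ∷ PQ⊆Y ce′ ∷ []
    I⊆Y : I ⊆ Y
    I⊆Y h = p─q⊆p Y pts5 (p─q⊆p (Y ─ pts5) (P ∩ Q) h)
    five∉I : ∀ {x} → x ∈ pts5 → x ∉ I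
    five∉I h hI = proj₂ (∈─⁻ Y pts5 (p─q⊆p (Y ─ pts5) (P ∩ Q) hI)) h

    v∈₅ : v ∈ pts5
    v∈₅ = ∈-pts⁺ at₀
    b∈₅ : b ∈ pts5
    b∈₅ = ∈-pts⁺ at₁
    c∈₅ : c ∈ pts5
    c∈₅ = ∈-pts⁺ at₂
    d∈₅ : d ∈ pts5
    d∈₅ = ∈-pts⁺ at₃
    e∈₅ : e ∈ pts5
    e∈₅ = ∈-pts⁺ at₄

    noBreak : ¬ Broken Y I p
    noBreak br = contra (common cf′ (third (v∈₅ ∷ b∈₅ ∷ c∈₅ ∷ []) (break-fil₃ (Broken.good br) brk vV bV cV (Conf.fil₁ cf′)))
                                    (third (v∈₅ ∷ d∈₅ ∷ e∈₅ ∷ []) (break-fil₃ (Broken.good br) brk vV dV eV (Conf.fil₂ cf′))))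
      where
      open Broken br using (fam; keeps; i; j; i∈I; j∉Y; brk)
      open Break brk
      cf′ : Conf fam v b c d e
      cf′ = conf-keeps cf five-Y keeps (Broken.good br)
      third : ∀ {T} → All (_∈ pts5) T → i ∈ pts T ⊎ j ∈ pts T ⊎ z ∈ pts T → z ∈ pts T
      third a = [ (λ h → ⊥-elim (five∉I (pts-⊆ a h) i∈I)) , [ (λ h → ⊥-elim (j∉Y (pts-⊆ five-Y (pts-⊆ a h)))) , (λ h → h) ]′ ]′
      use : ∀ {X} → p ∋ X → X ⊆ Y → v ∉ X → i ∉ X → z ≢ v
      use pX s vX iX refl = [ iX , vX ]′ (cov₂ (S-avoid⁺ i j (λ h → j∉Y (s h)) (sets keeps s pX)))
      contra : z ≢ v
      contra = case i ∈? P of λ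
        { (no iP) → use pP P⊆Y vP iP
        ; (yes iP) → case i ∈? Q of λ
          { (no iQ) → use pQ Q⊆Y vQ iQ
          ; (yes iQ) → ⊥-elim (proj₂ (∈─⁻ (Y ─ pts5) (P ∩ Q) i∈I) (x∈p∩q⁺ (iP , iQ))) } }

    module _ (sh : Shifted Y I p) where
      open Shifted sh renaming (good to good′)

      cf₁ : Conf fam v b c d e
      cf₁ = conf-keeps cf five-Y keeps good′

      -- `W` has `r`, one of `b`, `c` and one of `d`, `e` outside `I`, hence at most `k - 3` points
      -- in `I`. By `small` the removed part of `Y` has at most `5 + (k - 3)` points, which leaves
      -- at least `k - 2` in `I`.
      room : ∀ {W r} → fam ∋ W → v ∉ W → r ∈ W → r ∉ Y → ∣ W ∩ I ∣ < ∣ I ∣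
      room {W} {r} pW vW rW rY = +-cancelˡ-≤ (5 + ∣ (Y ─ pts5) ∩ (P ∩ Q) ∣) _ _ (begin
          (5 + x) + suc ∣ W ∩ I ∣  ≡⟨ solve 2 (λ x w → (con 5 :+ x) :+ (con 1 :+ w) := (con 3 :+ x) :+ (con 3 :+ w)) refl x ∣ W ∩ I ∣ ⟩
          (3 + x) + (3 + ∣ W ∩ I ∣)  ≤⟨ +-mono-≤ (≤-trans (+-monoʳ-≤ 3 (p⊆q⇒∣p∣≤∣q∣ inc)) small) w≤ ⟩
          k + k  ≡⟨ sym ∣Y∣ ⟩
          ∣ Y ∣  ≤⟨ ∣─pts∣ Y (five cf) ⟩
          5 + ∣ Y ─ pts5 ∣  ≡⟨ cong (5 +_) (sym (∣∩∣+∣─∣ (Y ─ pts5) (P ∩ Q))) ⟩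
          5 + (x + ∣ I ∣)  ≡⟨ sym (+-assoc 5 x ∣ I ∣) ⟩
          (5 + x) + ∣ I ∣  ∎)
        where
        open ≤-Reasoning
        open +-*-Solver using (solve; _:=_; _:+_; con)
        x : ℕ
        x = ∣ (Y ─ pts5) ∩ (P ∩ Q) ∣
        inc : (Y ─ pts5) ∩ (P ∩ Q) ⊆ (P ∩ Q) ─ pts5
        inc h = let h₁ , h₂ = x∈p∩q⁻ (Y ─ pts5) (P ∩ Q) h in x∈p∧x∉q⇒x∈p─q h₂ (proj₂ (∈─⁻ Y pts5 h₁))
        three : ∀ {s t} → s ≢ t → s ∈ W → t ∈ W → s ∈ pts5 → t ∈ pts5 → 3 + ∣ W ∩ I ∣ ≤ k
        three s≢t sW tW s∈ t∈ = ≤-trans (outside-≤ (r ∷ _ ∷ _ ∷ [])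
          ((∈∉⇒≢ (pts-⊆ five-Y s∈) rY ∘ sym ∷ ∈∉⇒≢ (pts-⊆ five-Y t∈) rY ∘ sym ∷ []) ∷ (s≢t ∷ []) ∷ [] ∷ [])
          ((rW , λ h → rY (I⊆Y h)) ∷ (sW , five∉I s∈) ∷ (tW , five∉I t∈) ∷ [])) (≤-reflexive (proj₂ (Good.unif good′ pW)))
        w≤ : 3 + ∣ W ∩ I ∣ ≤ k
        w≤ with hitL cf₁ pW vW | hitR cf₁ pW vW
        ... | inj₁ u | inj₁ w = three bd u w b∈₅ d∈₅
        ... | inj₁ u | inj₂ w = three be u w b∈₅ e∈₅
        ... | inj₂ u | inj₁ w = three cd u w c∈₅ d∈₅
        ... | inj₂ u | inj₂ w = three ce u w c∈₅ e∈₅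

      -- One of `P`, `Q` serves unless both contain `x`. In that case `x` is outside `I`, so a
      -- member avoiding `v` and `x` can be moved into `Y` without picking up either point.
      avoid : ∀ x → ∃ λ R → fam ∋ R × v ∉ R × x ∉ R × R ⊆ Y
      avoid x with x ∈? P | x ∈? Q
      ... | no xP | _ = P , sets keeps P⊆Y pP , vP , xP , P⊆Y
      ... | yes _ | no xQ = Q , sets keeps Q⊆Y pQ , vQ , xQ , Q⊆Y
      ... | yes xP | yes xQ =
        let W , pW , vW , xW = Good.nocov good′ v x
            W′ , pW′ , av , s = moveIn {fam} {Y} {I} {pts (v ∷ x ∷ [])} (Good.unif good′) I⊆Y
              (λ h hI → [ (λ { refl → five∉I v∈₅ hI }) , (λ { refl → proj₂ (∈─⁻ (Y ─ pts5) (P ∩ Q) hI) (x∈p∩q⁺ (xP , xQ)) }) ]′ (∈-pts₂ h))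
              stable (λ pW av → room pW (av (∈-pts⁺ at₀))) pW (λ h → All.lookup (vW ∷ xW ∷ []) (∈-pts⁻ _ h))
        in W′ , pW′ , av (∈-pts⁺ at₀) , av (∈-pts⁺ at₁) , s

      -- By `avoid` neither `i` nor `z` is `v`. As the pair meets both triples, it takes one point
      -- from `b`, `c` and one from `d`, `e`; with `j` as the sixth point the new cover is the third
      -- triple of `Stage₄`.
      broken : Broken Y Y fam → CoreRes fam
      broken br = resize (≤-trans (size K) (Added.size-≤ ad)) (pick m₁ m₂)
        where
        open Broken br renaming (good to good″; keeps to K; fam to fam′)
        open Break brk
        S-keeps : Keeps Y fam (S i j fam′)
        S-keeps = keeps-S (Y⊆V i∈I) j∈V j∉Y K
        ad : Added fam′ i j z
        ad = addFil good″ cov₃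
        cf₂ : Conf (Added.fam ad) v b c d e
        cf₂ = conf-⊇ (conf-keeps cf₁ five-Y K good″) (Added.old ad) (Added.good ad)
        m₁ : i ∈ pts (v ∷ b ∷ c ∷ []) ⊎ z ∈ pts (v ∷ b ∷ c ∷ [])
        m₁ = break-fil₂ good″ brk vV bV cV (fils S-keeps vY (PQ⊆Y cb) (PQ⊆Y cc) (Conf.fil₁ cf₁))
        m₂ : i ∈ pts (v ∷ d ∷ e ∷ []) ⊎ z ∈ pts (v ∷ d ∷ e ∷ [])
        m₂ = break-fil₂ good″ brk vV dV eV (fils S-keeps vY (PQ⊆Y cd′) (PQ⊆Y ce′) (Conf.fil₂ cf₁))
        i≢v : i ≢ v
        i≢v refl = let R , pR , vR , zR , s = avoid z in [ vR , zR ]′ (cov₂ (S-avoid⁺ i j (λ h → j∉Y (s h)) (sets K s pR)))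
        z≢v : z ≢ v
        z≢v refl = let R , pR , vR , iR , s = avoid i in [ iR , vR ]′ (cov₂ (S-avoid⁺ i j (λ h → j∉Y (s h)) (sets K s pR)))
        drop : ∀ {x s t} → x ≢ v → x ∈ pts (v ∷ s ∷ t ∷ []) → x ≡ s ⊎ x ≡ t
        drop ne h = resolveˡ ne (∈-pts₃ h)
        pick : i ∈ pts (v ∷ b ∷ c ∷ []) ⊎ z ∈ pts (v ∷ b ∷ c ∷ []) → i ∈ pts (v ∷ d ∷ e ∷ []) ⊎ z ∈ pts (v ∷ d ∷ e ∷ []) → CoreRes (Added.fam ad)
        pick (inj₁ h) (inj₁ h′) = ⊥-elim (i≢v (common cf h h′))
        pick (inj₂ h) (inj₂ h′) = ⊥-elim (z≢v (common cf h h′))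
        pick (inj₁ h) (inj₂ h′) = toStage₄ cf₂ (drop i≢v h) (drop z≢v h′) j∈V (∈∉⇒≢ vY j∉Y) (λ kX x y w → Added.fil ad kX x w y)
        pick (inj₂ h) (inj₁ h′) = toStage₄ cf₂ (drop z≢v h) (drop i≢v h′) j∈V (∈∉⇒≢ vY j∉Y) (λ kX x y w → Added.fil ad kX y w x)

      result : CoreRes p
      result with shiftInto {Y} {Y} Y⊆V ⊆-refl good′
      ... | inj₁ sh′ = resize (size keeps) (finish Y⊆V ∣Y∣ sh′)
      ... | inj₂ br = resize (size keeps) (broken br)

    stage₃ : CoreRes p
    stage₃ with shiftInto {Y} {I} Y⊆V I⊆Y good
    ... | inj₁ sh = result sh
    ... | inj₂ br = ⊥-elim (noBreak br)

-- Finding a suitable pair of members, and the passage from one cover to two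

module Reduction {n : ℕ} (V : Subset n) (k : ℕ) (4≤k : 4 ≤ k) (2k≤∣V∣ : k + k ≤ ∣ V ∣) where

  open Shifting V k
  open Keeps
  open Stages V k 4≤k 2k≤∣V∣

  module _ {p : Fam n} {v b c d e : Fin n} (pq : PQ p v b c d e) where
    open PQ pq

    pq-swap : PQ p v b c d e
    pq-swap = record { P = Q ; Q = P ; pP = pQ ; pQ = pP ; vP = vQ ; vQ = vP
                     ; cb = flip cb ; cc = flip cc ; cd = flip cd ; ce = flip ce }
      where
      flip : ∀ {A B : Set} → A ⊎ B → B ⊎ A
      flip = [ inj₂ , inj₁ ]′

    pq-flipL : PQ p v c b d e
    pq-flipL = record { P = P ; Q = Q ; pP = pP ; pQ = pQ ; vP = vP ; vQ = vQ ; cb = cc ; cc = cb ; cd = cd ; ce = ce }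

    pq-flipX : PQ p v d e b c
    pq-flipX = record { P = P ; Q = Q ; pP = pP ; pQ = pQ ; vP = vP ; vQ = vQ ; cb = cd ; cc = ce ; cd = cb ; ce = cc }

  ∉-five : ∀ {x : Fin n} {X : Subset n} {xs} → x ∈ₗ xs → x ∉ X ─ pts xs
  ∉-five {X = X} {xs} h h′ = proj₂ (∈─⁻ X (pts xs) h′) (∈-pts⁺ h)

  -- Shifting δ to b moves δ out of P ∩ Q and b into it.
  module _ {p : Fam n} {v b c d e : Fin n} (cf : Conf p v b c d e) (pq : PQ p v b c d e) {δ : Fin n} {R : Subset n}
    (δv : δ ≢ v) (δb : δ ≢ b) (δc : δ ≢ c) (δd : δ ≢ d) (δe : δ ≢ e)
    (pR : p ∋ R) (vR : v ∉ R) (δR : δ ∉ R) (bR : b ∉ R) where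
    open Conf cf

    separate : δ ∈ PQ.P pq → δ ∈ PQ.Q pq → b ∈ PQ.P pq → b ∉ PQ.Q pq → CoreRes p
    separate δP δQ bP bQ with noCov? (S b δ p)
    ... | yes nc = resize (≤-reflexive (sym (∥S∥ b δ p))) (Stage₃.stage₃ cf₁ pq₁ small)
      where
      open PQ pq using (P; Q; pP; pQ; vP; vQ; cb; cc) renaming (cd to cd′; ce to ce′)
      δV : δ ∈ V
      δV = proj₁ (Good.unif good pP) δP
      good₁ : Good V k (S b δ p)
      good₁ = record { unif = S-unif bV δV (Good.unif good) ; int = S-cross (Good.int good) ; nocov = nc }
      cf₁ : Conf (S b δ p) v b c d e
      cf₁ = record { Conf cf ; good = good₁ ; fil₁ = S-fil bV δV δv δb δc fil₁ ; fil₂ = S-fil bV δV δv δd δe fil₂ }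
      Q₁ : Subset n
      Q₁ = swap b δ Q
      stay : ∀ {x} → x ≢ b → δ ≢ x → x ∈ P ⊎ x ∈ Q → x ∈ P ⊎ x ∈ Q₁
      stay xb δx = [ inj₁ , (λ h → inj₂ (swap-other⁺ b δ xb (λ e → δx (sym e)) h)) ]′
      pq₁ : PQ (S b δ p) v b c d e
      pq₁ = record { P = P ; Q = Q₁ ; pP = S-in⁺ b δ bP pP ; pQ = S-moved⁺ b δ δQ pQ ; vP = vP
        ; vQ = λ h → vQ (swap-other⁻ b δ vb (δv ∘ sym) h)
        ; cb = inj₁ bP ; cc = stay (bc ∘ sym) δc cc ; cd = stay (bd ∘ sym) δd cd′ ; ce = stay (be ∘ sym) δe ce′ }
      Z : Subset n
      Z = (P ∩ Q₁) ─ pts (five cf)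
      Z⊆P : Z ⊆ P
      Z⊆P h = p∩q⊆p P Q₁ (p─q⊆p (P ∩ Q₁) (pts (five cf)) h)
      δZ : δ ∉ Z
      δZ h = bQ (swap-j⁻ b δ (p∩q⊆q P Q₁ (p─q⊆p (P ∩ Q₁) (pts (five cf)) h)))
      small : 3 + ∣ Z ∣ ≤ k
      small with hitR cf pP vP
      ... | inj₁ dP = small-by good pP Z⊆P (δb ∘ sym) bd δd bP δP dP
                        (∉-five {X = P ∩ Q₁} at₁) δZ (∉-five {X = P ∩ Q₁} at₃)
      ... | inj₂ eP = small-by good pP Z⊆P (δb ∘ sym) be δe bP δP eP
                        (∉-five {X = P ∩ Q₁} at₁) δZ (∉-five {X = P ∩ Q₁} at₄)
    -- `R` avoids `b` and `v` and survives the shift, so `z` is not `v`. The cover `b`, `δ`, `z`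
    -- must meet the triple `v`, `d`, `e`, which leaves `d` or `e` for `z` and yields a third triple
    -- with `δ` as the sixth point.
    ... | no ¬nc = resize (Added.size-≤ ad) (toStage₄ (conf-⊇ cf (Added.old ad) (Added.good ad)) (inj₁ refl)
                     (zde (break-fil₃ good brk vV dV eV fil₂)) (proj₁ (Good.unif good (PQ.pP pq)) δP) (δv ∘ sym) (λ kX x y w → Added.fil ad kX x w y))
      where
      brk : Break b δ p
      brk = break (Good.nocov good) ¬nc
      open Break brk
      ad : Added p b δ z
      ad = addFil good cov₃
      zv : z ≢ v
      zv eq = [ bR , (λ h → vR (subst (_∈ R) eq h)) ]′ (cov₂ (S-avoid⁺ b δ δR pR))
      zde : b ∈ pts (v ∷ d ∷ e ∷ []) ⊎ δ ∈ pts (v ∷ d ∷ e ∷ []) ⊎ z ∈ pts (v ∷ d ∷ e ∷ []) → z ≡ d ⊎ z ≡ e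
      zde (inj₁ h) = ⊥-elim ([ vb ∘ sym , [ bd , be ]′ ]′ (∈-pts₃ h))
      zde (inj₂ (inj₁ h)) = ⊥-elim ([ δv , [ δd , δe ]′ ]′ (∈-pts₃ h))
      zde (inj₂ (inj₂ h)) = resolveˡ zv (∈-pts₃ h)

  module _ {p : Fam n} {v b c d e : Fin n} (cf : Conf p v b c d e) (pq : PQ p v b c d e) where
    open Conf cf
    open PQ pq using (P; Q; pP; pQ; vP; vQ; cb; cc)

    threeIn : ∀ {X} → p ∋ X → v ∉ X → P ∩ Q ⊆ X → b ∈ X → c ∈ X → 3 + ∣ (P ∩ Q) ─ pts (five cf) ∣ ≤ k
    threeIn pX vX s bX cX with hitR cf pX vX
    ... | inj₁ dX = small-by good pX (λ h → s (p─q⊆p (P ∩ Q) (pts (five cf)) h)) bc bd cd bX cX dX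
          (∉-five {X = P ∩ Q} at₁) (∉-five {X = P ∩ Q} at₂) (∉-five {X = P ∩ Q} at₃)
    ... | inj₂ eX = small-by good pX (λ h → s (p─q⊆p (P ∩ Q) (pts (five cf)) h)) bc be ce bX cX eX
          (∉-five {X = P ∩ Q} at₁) (∉-five {X = P ∩ Q} at₂) (∉-five {X = P ∩ Q} at₄)

    missing-b : ∀ {δ R} → δ ∈ P → δ ∈ Q → δ ≢ v → δ ≢ b → δ ≢ c → δ ≢ d → δ ≢ e → p ∋ R → v ∉ R → δ ∉ R → b ∉ R → CoreRes p
    missing-b δP δQ δv δb δc δd δe pR vR δR bR with b ∈? P | b ∈? Q
    ... | yes bP | no bQ = separate cf pq δv δb δc δd δe pR vR δR bR δP δQ bP bQ
    ... | no bP | yes bQ = separate cf (pq-swap pq) δv δb δc δd δe pR vR δR bR δQ δP bQ bP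
    ... | no bP | no bQ = ⊥-elim ([ bP , bQ ]′ cb)
    ... | yes bP | yes bQ = Stage₃.stage₃ cf pq
      ([ (λ cP → threeIn pP vP (p∩q⊆p P Q) bP cP) , (λ cQ → threeIn pQ vQ (p∩q⊆q P Q) bQ cQ) ]′ cc)

  -- If `P ∩ Q` is too large, it has a point `δ` off the five points; let `R` avoid `v` and `δ`. If
  -- `R` misses one of `b`, `c`, `d`, `e`, then either `P` and `Q` share that point, which already
  -- bounds their common part, or shifting `δ` to it makes the common part small or produces a third
  -- cover. If `R` contains all four, it replaces `Q`.
  fromConf : ∀ {p v b c d e} → Conf p v b c d e → CoreRes p
  fromConf {p} {v} {b} {c} {d} {e} cf with 3 + ∣ (PQ.P (findPQ cf) ∩ PQ.Q (findPQ cf)) ─ pts (five cf) ∣ ≤? k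
  ... | yes small = Stage₃.stage₃ cf (findPQ cf) small
  ... | no big = main (∃-∈ D D>0)
    where
    open Conf cf
    pq = findPQ cf
    open PQ pq using (P; Q; pP; pQ; vP; vQ)
    D : Subset n
    D = (P ∩ Q) ─ pts (five cf)
    D>0 : 0 < ∣ D ∣
    D>0 with ∣ D ∣
    ... | zero = ⊥-elim (big (≤-trans (n≤1+n 3) 4≤k))
    ... | suc _ = s≤s z≤n
    main : (∃ λ δ → δ ∈ D) → CoreRes p
    main (δ , δD) = go (Good.nocov good v δ)
      where
      δP : δ ∈ P
      δP = p∩q⊆p P Q (p─q⊆p (P ∩ Q) (pts (five cf)) δD)
      δQ : δ ∈ Q
      δQ = p∩q⊆q P Q (p─q⊆p (P ∩ Q) (pts (five cf)) δD)
      δ∉ : ∀ {x} → x ∈ₗ five cf → δ ≢ x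
      δ∉ h refl = ∉-five {X = P ∩ Q} h δD
      δv = δ∉ at₀
      δb = δ∉ at₁
      δc = δ∉ at₂
      δd = δ∉ at₃
      δe = δ∉ at₄
      go : (∃ λ R → p ∋ R × v ∉ R × δ ∉ R) → CoreRes p
      go (R , pR , vR , δR) with b ∈? R | c ∈? R | d ∈? R | e ∈? R
      ... | no bR | _ | _ | _ = missing-b cf pq δP δQ δv δb δc δd δe pR vR δR bR
      ... | yes _ | no cR | _ | _ = missing-b (flipL cf) (pq-flipL pq) δP δQ δv δc δb δd δe pR vR δR cR
      ... | yes _ | yes _ | no dR | _ = missing-b (flipX cf) (pq-flipX pq) δP δQ δv δd δe δb δc pR vR δR dR
      ... | yes _ | yes _ | yes _ | no eR = missing-b (flipL (flipX cf)) (pq-flipL (pq-flipX pq)) δP δQ δv δe δd δb δc pR vR δR eR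
      ... | yes bR | yes cR | yes dR | yes eR = Stage₃.stage₃ cf pq′ (threeIn cf pq′ pR vR (p∩q⊆q P R) bR cR)
        where
        pq′ : PQ p v b c d e
        pq′ = record { P = P ; Q = R ; pP = pP ; pQ = pR ; vP = vP ; vQ = vR ; cb = inj₂ bR ; cc = inj₂ cR ; cd = inj₂ dR ; ce = inj₂ eR }

  module Stage₂ {p : Fam n} {a b c : Fin n} (g : Good V k p) (aV : a ∈ V) (bV : b ∈ V) (cV : c ∈ V)
    (ab : a ≢ b) (ac : a ≢ c) (bc : b ≢ c) (fil : Fil V k a b c p) where

    T : Subset n
    T = pts (a ∷ b ∷ c ∷ [])

    sup : ∃ λ Y → T ⊆ Y × Y ⊆ V × ∣ Y ∣ ≡ k + k
    sup = ksuperset T (pts-⊆ (aV ∷ bV ∷ cV ∷ [])) (≤-trans (pts-small (s≤s (s≤s (s≤s z≤n)))) (m≤m+n k k))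

    Y I : Subset n
    Y = proj₁ sup
    I = Y ─ T
    T⊆Y : T ⊆ Y
    T⊆Y = proj₁ (proj₂ sup)
    Y⊆V : Y ⊆ V
    Y⊆V = proj₁ (proj₂ (proj₂ sup))
    ∣Y∣ : ∣ Y ∣ ≡ k + k
    ∣Y∣ = proj₂ (proj₂ (proj₂ sup))
    aT : a ∈ T
    aT = ∈-pts⁺ at₀
    bT : b ∈ T
    bT = ∈-pts⁺ at₁
    cT : c ∈ T
    cT = ∈-pts⁺ at₂

    module _ (sh : Shifted Y I p) where
      open Shifted sh

      two : ∀ {X j} → fam ∋ X → j ∈ X → j ∉ Y → 2 + ∣ X ∩ I ∣ ≤ k
      two {X} {j} pX jX jY =
        let t , tX , tT = meets-pts₃⁺ (fil-hit good aV bV cV (fils keeps (T⊆Y aT) (T⊆Y bT) (T⊆Y cT) fil) pX)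
        in ≤-trans (outside-≤ (j ∷ t ∷ []) ((∈∉⇒≢ (T⊆Y tT) jY ∘ sym ∷ []) ∷ [] ∷ [])
             ((jX , λ h → jY (p─q⊆p Y T h)) ∷ (tX , λ h → proj₂ (∈─⁻ Y T h) tT) ∷ [])) (≤-reflexive (proj₂ (Good.unif good pX)))

      -- Shifts to `I` suffice: two members with a common `j` outside `Y` each have a further point
      -- in `T`, so together they occupy at most `2k - 4` of the at least `2k - 3` points of `I`.
      stable₂ : CoreRes p
      stable₂ = record { fam = fam ; size-≤ = size keeps ; good = good ; Y = Y ; Y⊆V = Y⊆V ; ∣Y∣ = ∣Y∣
        ; isCore = core (Good.int good) (λ {X} {Z} {j} pX pZ jX jZ jY _ →
            let i , iI , iX , iZ = ∃-outside {X = X} {Z} {I} (room pX pZ jX jZ jY)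
            in i , p─q⊆p Y T iI , iX , iZ , stable iI (proj₁ (Good.unif good pX) jX) jY pX jX iX) }
        where
        room : ∀ {X Z j} → fam ∋ X → fam ∋ Z → j ∈ X → j ∈ Z → j ∉ Y → ∣ X ∩ I ∣ + ∣ Z ∩ I ∣ < ∣ I ∣
        room {X} {Z} pX pZ jX jZ jY = +-cancelˡ-≤ 3 _ _ (begin
          3 + suc (x + z)  ≡⟨ solve 2 (λ x z → con 3 :+ (con 1 :+ (x :+ z)) := (con 2 :+ x) :+ (con 2 :+ z)) refl x z ⟩
          (2 + x) + (2 + z)  ≤⟨ +-mono-≤ (two pX jX jY) (two pZ jZ jY) ⟩
          k + k  ≡⟨ sym ∣Y∣ ⟩
          ∣ Y ∣  ≤⟨ ∣─pts∣ Y (a ∷ b ∷ c ∷ []) ⟩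
          3 + ∣ I ∣  ∎)
          where
          open ≤-Reasoning
          open +-*-Solver using (solve; _:=_; _:+_; con)
          x z : ℕ
          x = ∣ X ∩ I ∣
          z = ∣ Z ∩ I ∣

    -- The old and the new cover must meet, and `i`, `j` lie off `T`; so `z` is their only common
    -- point, and it becomes the centre of the configuration.
    broken₂ : Broken Y I p → CoreRes p
    broken₂ br = resize (≤-trans (size keeps) (Added.size-≤ ad)) (pick (∈-pts₃ zT))
      where
      open Broken br
      open Break brk
      filₖ : Fil V k a b c fam
      filₖ = fils keeps (T⊆Y aT) (T⊆Y bT) (T⊆Y cT) fil
      i∉T : i ∉ T
      i∉T = proj₂ (∈─⁻ Y T i∈I)
      j∉T : j ∉ T
      j∉T h = j∉Y (T⊆Y h)
      iY : i ∈ Y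
      iY = p─q⊆p Y T i∈I
      zT : z ∈ T
      zT = [ ⊥-elim ∘ i∉T , resolveˡ j∉T ]′ (break-fil₃ good brk aV bV cV filₖ)
      ad : Added fam i j z
      ad = addFil good cov₃
      conf : ∀ {x y} → x ∈ T → y ∈ T → z ≢ x → z ≢ y → x ≢ y → Fil V k z x y (Added.fam ad) → Conf (Added.fam ad) z x y i j
      conf xT yT zx zy xy f = record
        { good = Added.good ad ; vV = break-z∈V good brk ; bV = Y⊆V (T⊆Y xT) ; cV = Y⊆V (T⊆Y yT) ; dV = Y⊆V iY ; eV = j∈V
        ; vb = zx ; vc = zy ; vd = break-z≢i good brk ; ve = break-z≢j good brk ; bc = xy
        ; bd = ∈∉⇒≢ xT i∉T ; be = ∈∉⇒≢ xT j∉T ; cd = ∈∉⇒≢ yT i∉T ; ce = ∈∉⇒≢ yT j∉T ; de = ∈∉⇒≢ iY j∉Y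
        ; fil₁ = f ; fil₂ = λ kX x y w → Added.fil ad kX y w x }
      pick : z ≡ a ⊎ z ≡ b ⊎ z ≡ c → CoreRes (Added.fam ad)
      pick (inj₁ e) = fromConf (conf bT cT (λ h → ab (trans (sym e) h)) (λ h → ac (trans (sym e) h)) bc
        (λ kX x y w → Added.old ad (filₖ kX (subst (_∈ _) e x) y w)))
      pick (inj₂ (inj₁ e)) = fromConf (conf aT cT (λ h → ab (sym (trans (sym e) h))) (λ h → bc (trans (sym e) h)) ac
        (λ kX x y w → Added.old ad (filₖ kX y (subst (_∈ _) e x) w)))
      pick (inj₂ (inj₂ e)) = fromConf (conf aT bT (λ h → ac (sym (trans (sym e) h))) (λ h → bc (sym (trans (sym e) h))) ab
        (λ kX x y w → Added.old ad (filₖ kX y w (subst (_∈ _) e x))))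

    stage₂ : CoreRes p
    stage₂ with shiftInto {Y} {I} Y⊆V (p─q⊆p Y T) g
    ... | inj₁ sh = stable₂ sh
    ... | inj₂ br = broken₂ br

  toCore : ∀ {p} → Good V k p → CoreRes p
  toCore {p} g with ksuperset ⊥ ⊥⊆ (≤-trans (≤-reflexive (∣⊥∣≡0 n)) z≤n)
  ... | Y , _ , Y⊆V , ∣Y∣ with shiftInto {Y} {Y} Y⊆V ⊆-refl g
  ...   | inj₁ sh = finish Y⊆V ∣Y∣ sh
  ...   | inj₂ br = resize (≤-trans (size keeps) (Added.size-≤ ad))
      (Stage₂.stage₂ (Added.good ad) (Y⊆V i∈I) j∈V (break-z∈V good brk) (∈∉⇒≢ i∈I j∉Y) (break-z≢i good brk ∘ sym) (break-z≢j good brk ∘ sym) (Added.fil ad))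
    where
    open Broken br
    ad : Added fam i j (Break.z brk)
    ad = addFil good (Break.cov₃ brk)

-- Traces on a core

module _ (p : Fam n) (Y : Subset n) where

  Trace : Subset n → Set
  Trace S = ∃ λ X → p ∋ X × X ∩ Y ≡ S

  trace? : Decidable Trace
  trace? S = anySubset? λ X → (p ∋? X) ×-dec (X ∩ Y ≟ₛ S)

  abstract

    level : ℕ → Fam n
    level i S = does (trace? S ×-dec (∣ S ∣ ℕ.≟ i))

    level⁻ : ∀ {i S} → level i ∋ S → Trace S × ∣ S ∣ ≡ i
    level⁻ {i} {S} h = does⁻ (trace? S ×-dec (∣ S ∣ ℕ.≟ i)) (holds h)

    level⁺ : ∀ {i S} → Trace S → ∣ S ∣ ≡ i → level i ∋ S
    level⁺ {i} {S} t e = mem (dec-true (trace? S ×-dec (∣ S ∣ ℕ.≟ i)) (t , e))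

  level-unif : ∀ {i} → Unif Y i (level i)
  level-unif h = let (X , _ , e) , c = level⁻ h in (λ {x} x∈ → p∩q⊆q X Y (subst (x ∈_) (sym e) x∈)) , c

  ∥∥≤levels : ∀ {V k} → Unif V k p → Y ⊆ V → ∥ p ∥ ≤ conv (λ i → ∥ level i ∥) (∣ V ─ Y ∣) k
  ∥∥≤levels {V} {k} u s = begin
    ∥ p ∥  ≤⟨ #-mono (p ∋?_) (λ X → ksub? V k X ×-dec trace? (X ∩ Y)) (λ X h → u h , X , h , refl) ⟩
    # (λ X → ksub? V k X ×-dec trace? (X ∩ Y))  ≡⟨ #-trace trace? V Y s k ⟩
    conv (λ i → # (λ S → ksub? Y i S ×-dec trace? S)) (∣ V ─ Y ∣) k  ≤⟨ conv-mono (∣ V ─ Y ∣) k (λ i _ →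
        #-mono (λ S → ksub? Y i S ×-dec trace? S) (level i ∋?_) (λ { S ((_ , e) , t) → level⁺ t e })) ⟩
    conv (λ i → ∥ level i ∥) (∣ V ─ Y ∣) k  ∎
    where open ≤-Reasoning

module _ {p q : Fam n} {Y : Subset n} (c : Core Y p q) where

  level-meets : ∀ {i S Z} → level p Y i ∋ S → q ∋ Z → Meets S Z
  level-meets hS qZ = let (X , pX , e) , _ = level⁻ p Y hS
                          x , xX , xZ , xY = c pX qZ
                      in x , subst (x ∈_) e (x∈p∩q⁺ (xX , xY)) , xZ

  level-cross : ∀ {i j} → Cross (level p Y i) (level q Y j)
  level-cross hS hS′ = let (Z , qZ , e) , _ = level⁻ q Y hS′
                           (X , pX , e′) , _ = level⁻ p Y hS
                           x , xX , xZ , xY = c pX qZ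
                       in x , subst (x ∈_) e′ (x∈p∩q⁺ (xX , xY)) , subst (x ∈_) e (x∈p∩q⁺ (xZ , xY))

-- The complement in `Y` of a member of `q` is a `t`-set disjoint from that member, hence not in
-- `p`.
complement-≤ : ∀ {Y : Subset n} {t p q} → ∣ Y ∣ ≡ t + t → Unif Y t p → Unif Y t q → Cross p q → ∥ p ∥ + ∥ q ∥ ≤ binom (t + t) t
complement-≤ {n} {Y} {t} {p} {q} e up uq c = begin
  ∥ p ∥ + ∥ q ∥  ≤⟨ +-monoʳ-≤ ∥ p ∥ (#-injection (q ∋?_) (λ X → ksub? Y t X ×-dec ¬? (p ∋? X)) (Y ─_) maps inj) ⟩
  ∥ p ∥ + # (λ X → ksub? Y t X ×-dec ¬? (p ∋? X))  ≤⟨ #-⊎ (p ∋?_) (λ X → ksub? Y t X ×-dec ¬? (p ∋? X)) (ksub? Y t) (λ _ → up) (λ _ → proj₁) (λ _ h k → proj₂ k h) ⟩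
  # (ksub? Y t)  ≡⟨ #-ksub Y t ⟩
  binom ∣ Y ∣ t  ≡⟨ cong (λ z → binom z t) e ⟩
  binom (t + t) t  ∎
  where
  open ≤-Reasoning
  maps : ∀ Z → q ∋ Z → KSub Y t (Y ─ Z) × ¬ (p ∋ Y ─ Z)
  maps Z h = let s , c′ = uq h in
    ((λ {x} → p─q⊆p Y Z {x}) , +-cancelʳ-≡ ∣ Z ∣ ∣ Y ─ Z ∣ t (trans (∣─∣-⊆ Y Z s) (trans e (cong (t +_) (sym c′))))) ,
    (λ h′ → let x , a , b = c h′ h in proj₂ (∈─⁻ Y Z a) b)
  sub : ∀ X Z → q ∋ X → Y ─ X ≡ Y ─ Z → X ⊆ Z
  sub X Z hX eq {x} xX = case x ∈? Z of λ
    { (yes xZ) → xZ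
    ; (no xZ) → ⊥-elim (proj₂ (∈─⁻ Y X (subst (x ∈_) (sym eq) (x∈p∧x∉q⇒x∈p─q (proj₁ (uq hX) xX) xZ))) xX) }
  inj : ∀ X Z → q ∋ X → q ∋ Z → Y ─ X ≡ Y ─ Z → X ≡ Z
  inj X Z hX hZ eq = ⊆-antisym (sub X Z hX eq) (sub Z X hZ (sym eq))

hitting-≤ : ∀ {Y R : Subset n} {i p} → Unif Y i p → (∀ {S} → p ∋ S → Meets S R) → ∥ p ∥ + binom (∣ Y ─ R ∣) i ≤ binom (∣ Y ∣) i
hitting-≤ {Y = Y} {R} {i} {p} u h = begin
  ∥ p ∥ + binom (∣ Y ─ R ∣) i  ≡⟨ cong (∥ p ∥ +_) (sym (#-ksub (Y ─ R) i)) ⟩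
  ∥ p ∥ + # (ksub? (Y ─ R) i)  ≤⟨ #-⊎ (p ∋?_) (ksub? (Y ─ R) i) (ksub? Y i) (λ _ → u) (λ { _ (s , e) → (λ x → p─q⊆p Y R (s x)) , e })
                                       (λ { S pS (s , _) → let x , xS , xR = h pS in proj₂ (∈─⁻ Y R (s xS)) xR }) ⟩
  # (ksub? Y i)  ≡⟨ #-ksub Y i ⟩
  binom (∣ Y ∣) i  ∎
  where open ≤-Reasoning

∣─∣≥ : ∀ (Y R : Subset n) t → ∣ R ∣ ≤ t → ∣ Y ∣ ≤ t + ∣ Y ─ R ∣
∣─∣≥ Y R t h = ≤-trans (≤-reflexive (sym (∣∩∣+∣─∣ Y R))) (+-monoˡ-≤ ∣ Y ─ R ∣ (≤-trans (∣p∩q∣≤∣q∣ Y R) h))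

-- Non-empty cross-intersecting families

-- For i < t: the number of i-subsets of a 2t-set meeting a fixed t-set.
crossLevel : ℕ → ℕ → ℕ
crossLevel t i = if does (i ℕ.≟ t) then binom (t + t) t else binom (t + t) i ∸ binom t i

-- The extremal pair consists of a single `t`-set and all `t`-sets meeting it. At the top level the
-- single set compensates for its complement, the only `t`-set of the core that is excluded; hence
-- `binom (t + t) t` in `crossLevel`.
CrossBound : ℕ → Set
CrossBound t = ∀ {n v} {V : Subset n} {p q} → ∣ V ∣ ≡ (t + t) + v → Unif V t p → Unif V t q → Cross p q →
  0 < ∥ p ∥ → 0 < ∥ q ∥ → ∥ p ∥ + ∥ q ∥ ≤ conv (crossLevel t) v t

crossLevel-< : ∀ t i → i < t → crossLevel t i ≡ binom (t + t) i ∸ binom t i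
crossLevel-< t i l rewrite dec-false (i ℕ.≟ t) (<⇒≢ l) = refl

crossLevel-≡ : ∀ t → crossLevel t t ≡ binom (t + t) t
crossLevel-≡ t rewrite dec-true (t ℕ.≟ t) refl = refl

module _ {n : ℕ} {V : Subset n} {t v : ℕ} (∣V∣ : ∣ V ∣ ≡ (t + t) + v) where

  record CrossCore (a b : ℕ) : Set where
    field
      p q : Fam n
      up : Unif V t p
      uq : Unif V t q
      sp : ∥ p ∥ ≡ a
      sq : ∥ q ∥ ≡ b
      Y : Subset n
      Y⊆V : Y ⊆ V
      ∣Y∣ : ∣ Y ∣ ≡ t + t
      isCore : Core Y p q

  crossCore : ∀ {p q} → Unif V t p → Unif V t q → Cross p q → CrossCore ∥ p ∥ ∥ q ∥
  crossCore {p₀} {q₀} up₀ uq₀ c₀ with ∃-subset V (t + t) (≤-trans (m≤m+n (t + t) v) (≤-reflexive (sym ∣V∣)))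
  ... | Y , Y⊆V , ∣Y∣ = build (closure (λ { (p , q) → outer Y p + outer Y q }) (λ { i j (p , q) → S i j p , S i j q }) Y (V ─ Y) G (λ _ _ _ → ∅)
                              (λ { (p , q) i j g iY jJ → inj₁ (step g iY (∈─⁻ V Y jJ)) }) (p₀ , q₀) (up₀ , uq₀ , c₀ , refl , refl))
    where
    G : Fam n × Fam n → Set
    G (p , q) = Unif V t p × Unif V t q × Cross p q × ∥ p ∥ ≡ ∥ p₀ ∥ × ∥ q ∥ ≡ ∥ q₀ ∥
    step : ∀ {p q i j} → G (p , q) → i ∈ Y → j ∈ V × j ∉ Y → G (S i j p , S i j q)
    step {i = i} {j} (up , uq , c , e , e′) iY (jV , _) =
      S-unif (Y⊆V iY) jV up , S-unif (Y⊆V iY) jV uq , S-cross c , trans (∥S∥ i j _) e , trans (∥S∥ i j _) e′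
    build : _ → CrossCore ∥ p₀ ∥ ∥ q₀ ∥
    build (inj₁ ((p , q) , (up , uq , c , e , e′) , st)) = record
      { p = p ; q = q ; up = up ; uq = uq ; sp = e ; sq = e′ ; Y = Y ; Y⊆V = Y⊆V ; ∣Y∣ = ∣Y∣
      ; isCore = core c (λ {X} {Z} {j} pX qZ jX jZ jY _ →
          let i , iY , iX , iZ = ∃-outside {X = X} {Z} {Y} (≤-trans (+-mono-< (small (up pX) jX jY) (small (uq qZ) jZ jY)) (≤-reflexive (sym ∣Y∣)))
              jV = proj₁ (up pX) jX
          -- A drop of the outer weight of `p` alone would be a drop of the sum, because the shift
          -- never raises that of `q`.
          in i , iY , iX , iZ , outer-stable iY jY (λ l → st iY (x∈p∧x∉q⇒x∈p─q jV jY) (+-mono-<-≤ l (outer-S-≤ iY jY q))) pX jX iX) }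
      where
      small : ∀ {X j} → KSub V t X → j ∈ X → j ∉ Y → ∣ X ∩ Y ∣ < t
      small {X} {j} (_ , eX) jX jY = ≤-trans (outside-≤ (j ∷ []) ([] ∷ []) ((jX , jY) ∷ [])) (≤-reflexive eX)

  -- If one family has no trace on a level, the traces of the other still meet a fixed member of the
  -- first. If both have traces there, the bound for smaller sets applies inside `Y`; the second
  -- half of the hypothesis compares it with `crossLevel t i`.
  crossLevels : (∀ i → 1 ≤ i → i < t → CrossBound i × conv (crossLevel i) ((t + t) ∸ (i + i)) i ≤ crossLevel t i) →
    ∀ {a b} → CrossCore a b → 0 < a → 0 < b → a + b ≤ conv (crossLevel t) v t
  crossLevels IH {a} {b} cc a>0 b>0 = begin
    a + b  ≡⟨ sym (cong₂ _+_ sp sq) ⟩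
    ∥ p ∥ + ∥ q ∥  ≤⟨ +-mono-≤ (∥∥≤levels p Y up Y⊆V) (∥∥≤levels q Y uq Y⊆V) ⟩
    conv (λ i → ∥ level p Y i ∥) (∣ V ─ Y ∣) t + conv (λ i → ∥ level q Y i ∥) (∣ V ─ Y ∣) t  ≡⟨ sym (conv-+ (λ i → ∥ level p Y i ∥) (λ i → ∥ level q Y i ∥) (∣ V ─ Y ∣) t) ⟩
    conv (λ i → ∥ level p Y i ∥ + ∥ level q Y i ∥) (∣ V ─ Y ∣) t  ≡⟨ cong (λ z → conv (λ i → ∥ level p Y i ∥ + ∥ level q Y i ∥) z t) ∣V─Y∣ ⟩
    conv (λ i → ∥ level p Y i ∥ + ∥ level q Y i ∥) v t  ≤⟨ conv-mono v t bound ⟩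
    conv (crossLevel t) v t  ∎
    where
    open ≤-Reasoning
    open CrossCore cc
    ∣V─Y∣ : ∣ V ─ Y ∣ ≡ v
    ∣V─Y∣ = +-cancelʳ-≡ (t + t) ∣ V ─ Y ∣ v (trans (cong (∣ V ─ Y ∣ +_) (sym ∣Y∣)) (trans (∣─∣-⊆ V Y Y⊆V) (trans ∣V∣ (+-comm (t + t) v))))
    coreᵒ : Core Y q p
    coreᵒ qZ pX = let x , a , b , c = isCore pX qZ in x , b , a , c
    one-sided : ∀ {p q} → Core Y p q → Unif V t q → 0 < ∥ q ∥ → ∀ i → ∥ level p Y i ∥ ≤ binom (t + t) i ∸ binom t i
    one-sided {p} {q} c uq q>0 i = let Z , qZ = #-∃ (q ∋?_) q>0 in
      m+n≤o⇒m≤o∸n ∥ level p Y i ∥ (≤-trans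
        (+-monoʳ-≤ ∥ level p Y i ∥ (binom-mono i (+-cancelˡ-≤ t _ _ (≤-trans (≤-reflexive (sym ∣Y∣)) (∣─∣≥ Y Z t (≤-reflexive (proj₂ (uq qZ))))))))
        (≤-trans (hitting-≤ (level-unif p Y) (λ h → level-meets c h qZ)) (≤-reflexive (cong (λ z → binom z i) ∣Y∣))))
    pq>0 : 0 < ∥ p ∥ × 0 < ∥ q ∥
    pq>0 = subst (0 <_) (sym sp) a>0 , subst (0 <_) (sym sq) b>0
    below : ∀ i → i < t → ∥ level p Y i ∥ + ∥ level q Y i ∥ ≤ crossLevel t i
    below i i<t with ∥ level p Y i ∥ ℕ.≟ 0 | ∥ level q Y i ∥ ℕ.≟ 0
    ... | yes e | _ = subst (λ z → z + ∥ level q Y i ∥ ≤ crossLevel t i) (sym e)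
          (≤-trans (one-sided coreᵒ up (proj₁ pq>0) i) (≤-reflexive (sym (crossLevel-< t i i<t))))
    ... | no _ | yes e = subst (λ z → ∥ level p Y i ∥ + z ≤ crossLevel t i) (sym e)
          (≤-trans (≤-reflexive (+-identityʳ _)) (≤-trans (one-sided isCore uq (proj₂ pq>0) i) (≤-reflexive (sym (crossLevel-< t i i<t)))))
    ... | no a | no b = ≤-trans (proj₁ IHi (trans ∣Y∣ (sym (m+[n∸m]≡n (+-mono-≤ (<⇒≤ i<t) (<⇒≤ i<t)))))
            (level-unif p Y) (level-unif q Y) (level-cross isCore) (n≢0⇒n>0 a) (n≢0⇒n>0 b)) (proj₂ IHi)
      where
      i≥1 : 1 ≤ i
      i≥1 = let S , pS = #-∃ (level p Y i ∋?_) (n≢0⇒n>0 a)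
                S′ , qS = #-∃ (level q Y i ∋?_) (n≢0⇒n>0 b)
                x , xS , _ = level-cross isCore pS qS
            in ≤-trans (x∈p⇒1≤∣p∣ xS) (≤-reflexive (proj₂ (level-unif p Y pS)))
      IHi = IH i i≥1 i<t
    bound : ∀ i → i ≤ t → ∥ level p Y i ∥ + ∥ level q Y i ∥ ≤ crossLevel t i
    bound i i≤t with i ℕ.≟ t
    ... | yes refl = ≤-trans (complement-≤ ∣Y∣ (level-unif p Y) (level-unif q Y) (level-cross isCore)) (≤-reflexive (sym (crossLevel-≡ t)))
    ... | no i≢t = below i (≤∧≢⇒< i≤t i≢t)

  crossStep : (∀ i → 1 ≤ i → i < t → CrossBound i × conv (crossLevel i) ((t + t) ∸ (i + i)) i ≤ crossLevel t i) →
    ∀ {p q} → Unif V t p → Unif V t q → Cross p q → 0 < ∥ p ∥ → 0 < ∥ q ∥ → ∥ p ∥ + ∥ q ∥ ≤ conv (crossLevel t) v t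
  crossStep IH up uq c = crossLevels IH (crossCore up uq c)

cross₁ : CrossBound 1
cross₁ e up uq c = crossStep {t = 1} e (λ { zero () _ ; (suc i) _ (s≤s ()) }) up uq c

cross₂ : CrossBound 2
cross₂ e up uq c = crossStep {t = 2} e (λ { zero () _ ; 1 _ _ → cross₁ , ≤-refl ; (suc (suc i)) _ (s≤s (s≤s ())) }) up uq c

cross₃ : CrossBound 3
cross₃ e up uq c = crossStep {t = 3} e (λ { zero () _ ; 1 _ _ → cross₁ , s≤s (s≤s z≤n) ; 2 _ _ → cross₂ , m≤m+n 10 2
  ; (suc (suc (suc i))) _ (s≤s (s≤s (s≤s ()))) }) up uq c

cross₄ : CrossBound 4
cross₄ e up uq c = crossStep {t = 4} e (λ { zero () _ ; 1 _ _ → cross₁ , s≤s (s≤s z≤n) ; 2 _ _ → cross₂ , m≤m+n 14 8 ; 3 _ _ → cross₃ , m≤m+n 47 5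
  ; (suc (suc (suc (suc i)))) _ (s≤s (s≤s (s≤s (s≤s ())))) }) up uq c

-- Families with a common point

∣-∣≥ : ∀ (D : Subset n) z → ∣ D ∣ ≤ suc ∣ D - z ∣
∣-∣≥ D z = ∣─∣≥ D ⁅ z ⁆ 1 (≤-reflexive (∣⁅x⁆∣≡1 z))

∣∪⁅⁆∣ : ∀ {X : Subset n} {z} → z ∉ X → ∣ X ∪ ⁅ z ⁆ ∣ ≡ suc ∣ X ∣
∣∪⁅⁆∣ {X = X} {z} h = trans (∣∪∣-disjoint X ⁅ z ⁆ (λ x∈ u → h (subst (_∈ X) (x∈⁅y⁆⇒x≡y z u) x∈)))
  (trans (cong (∣ X ∣ +_) (∣⁅x⁆∣≡1 z)) (+-comm ∣ X ∣ 1))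

∪⁅⁆-injective : ∀ {X Z : Subset n} {z} → z ∉ X → z ∉ Z → X ∪ ⁅ z ⁆ ≡ Z ∪ ⁅ z ⁆ → X ≡ Z
∪⁅⁆-injective {X = X} {Z} {z} a b e = ⊆-antisym (sub a e) (sub b (sym e))
  where
  sub : ∀ {X Z} → z ∉ X → X ∪ ⁅ z ⁆ ≡ Z ∪ ⁅ z ⁆ → X ⊆ Z
  sub {X} {Z} a e {x} h = [ (λ u → u) , (λ u → ⊥-elim (a (subst (_∈ X) (x∈⁅y⁆⇒x≡y z u) h))) ]′
    (x∈p∪q⁻ Z ⁅ z ⁆ (subst (x ∈_) e (x∈p∪q⁺ (inj₁ h))))

-- Reveal the points of Z one at a time: the j-th contributes binom (d - j) r new sets.
covered-≥ : ∀ r {B : Subset n → Set} (B? : Decidable B) q d (Z : Subset n) → ∣ Z ∣ ≡ q →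
  (∀ {z} → z ∈ Z → ∃ λ D → z ∈ D × d ≤ ∣ D ∣ × (∀ {S} → KSub D (suc r) S → B S)) →
  binom d (suc r) ≤ # (λ S → B? S ×-dec meets? S Z) + binom (d ∸ q) (suc r)
covered-≥ r B? zero d Z e h = m≤n+m _ _
covered-≥ r B? (suc q) zero Z e h = z≤n
covered-≥ {n} r {B} B? (suc q) (suc d) Z e h with ∃-∈ Z (subst (0 <_) (sym e) (s≤s z≤n))
... | z , z∈Z = begin
  binom d (suc r) + binom d r  ≤⟨ +-mono-≤ ih through ⟩
  (# M₁ + binom (d ∸ q) (suc r)) + # M₂  ≡⟨ solve 3 (λ a b c → (a :+ b) :+ c := (a :+ c) :+ b) refl (# M₁) _ (# M₂) ⟩
  (# M₁ + # M₂) + binom (d ∸ q) (suc r)  ≤⟨ +-monoˡ-≤ _ (#-⊎ M₁ M₂ (λ S → B? S ×-dec meets? S Z)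
      (λ { S ((b , _) , x , xS , xZ) → b , x , xS , proj₁ (∈-⁻ Z xZ) }) (λ { S (b , zS) → b , z , zS , z∈Z }) (λ { S ((_ , zS) , _) (_ , zS′) → zS zS′ })) ⟩
  # (λ S → B? S ×-dec meets? S Z) + binom (d ∸ q) (suc r)  ∎
  where
  open ≤-Reasoning
  open +-*-Solver using (solve; _:=_; _:+_; con)
  M₁ = λ S → (B? S ×-dec ¬? (z ∈? S)) ×-dec meets? S (Z - z)
  M₂ = λ S → B? S ×-dec (z ∈? S)
  ih : binom d (suc r) ≤ # M₁ + binom (d ∸ q) (suc r)
  ih = covered-≥ r (B? &∉ z) q d (Z - z) (suc-injective (trans (∣-∣-∈ Z z∈Z) e)) λ z′∈ →
    let z′Z , z′≢z = ∈-⁻ Z z′∈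
        D , z′D , d≤ , f = h z′Z
    in D - z , ∈-⁺ D z′D z′≢z , s≤s⁻¹ (≤-trans d≤ (∣-∣≥ D z)) ,
       λ { (s , c) → f ((λ x → proj₁ (∈-⁻ D (s x))) , c) , λ zS → proj₂ (∈-⁻ D (s zS)) refl }
  through : binom d r ≤ # M₂
  through with h z∈Z
  ... | D , zD , d≤ , f = begin
    binom d r  ≤⟨ binom-mono r (s≤s⁻¹ (≤-trans d≤ (∣-∣≥ D z))) ⟩
    binom (∣ D - z ∣) r  ≡⟨ sym (#-ksub (D - z) r) ⟩
    # (ksub? (D - z) r)  ≤⟨ #-injection (ksub? (D - z) r) M₂ (_∪ ⁅ z ⁆)
        (λ { X (s , c) → f ((λ x → [ (λ u → proj₁ (∈-⁻ D (s u))) , (λ u → subst (_∈ D) (sym (x∈⁅y⁆⇒x≡y z u)) zD) ]′ (x∈p∪q⁻ X ⁅ z ⁆ x)) ,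
                            trans (∣∪⁅⁆∣ (z∉ s)) (cong suc c)) , x∈p∪q⁺ (inj₂ (x∈⁅x⁆ z)) })
        (λ { X X′ (s , _) (s′ , _) → ∪⁅⁆-injective (z∉ s) (z∉ s′) }) ⟩
    # M₂  ∎
    where
    z∉ : ∀ {X} → X ⊆ D - z → z ∉ X
    z∉ s h = proj₂ (∈-⁻ D (s h)) refl

binom-superadditive : ∀ a b r → binom a (suc r) + binom b (suc r) ≤ binom (a + b) (suc r)
binom-superadditive zero b r = ≤-refl
binom-superadditive (suc a) b r = begin
  (binom a (suc r) + binom a r) + binom b (suc r)  ≡⟨ solve 3 (λ x y z → (x :+ y) :+ z := (x :+ z) :+ y) refl (binom a (suc r)) _ _ ⟩
  (binom a (suc r) + binom b (suc r)) + binom a r  ≤⟨ +-mono-≤ (binom-superadditive a b r) (binom-mono r (m≤m+n a b)) ⟩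
  binom (a + b) (suc r) + binom (a + b) r  ∎
  where
  open ≤-Reasoning
  open +-*-Solver using (solve; _:=_; _:+_; con)

module Levels {n : ℕ} {V Y : Subset n} {k : ℕ} {fam : Fam n} (good : Good V (suc (suc k)) fam)
  (∣Y∣ : ∣ Y ∣ ≡ (2 + k) + (2 + k)) (isCore : Core Y fam fam) where

  -- The complements in Y - x of the members avoiding x have at least k+1 points each and cover Y - x,
  -- but no two of them do.
  module _ {r : ℕ} {L : Fam n} (uL : Unif Y (2 + r) L) (hits : ∀ {S Z} → L ∋ S → fam ∋ Z → Meets S Z)
    {x : Fin n} (x∈Y : x ∈ Y) (star : ∀ {S} → L ∋ S → x ∈ S) where

    private
      W : Subset n
      W = Y - x
      ∣W∣ : ∣ W ∣ ≡ suc k + (2 + k)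
      ∣W∣ = suc-injective (trans (∣-∣-∈ Y x∈Y) ∣Y∣)

      β? : (S : Subset n) → Dec (∃ λ Z → fam ∋ Z × x ∉ Z × ¬ Meets S Z)
      β? S = anySubset? λ Z → (fam ∋? Z) ×-dec ¬? (x ∈? Z) ×-dec ¬? (meets? S Z)

      Bad? = λ S → ksub? W (suc r) S ×-dec β? S

      ∣W─∣ : ∀ {Z} → fam ∋ Z → suc k ≤ ∣ W ─ Z ∣
      ∣W─∣ {Z} h = +-cancelˡ-≤ (2 + k) _ _ (≤-trans (≤-reflexive (trans (+-comm (2 + k) (suc k)) (sym ∣W∣)))
        (∣─∣≥ W Z (2 + k) (≤-reflexive (proj₂ (Good.unif good h)))))

      bad : ∀ {Z S} → fam ∋ Z → x ∉ Z → KSub (W ─ Z) (suc r) S → KSub W (suc r) S × ∃ λ Z → fam ∋ Z × x ∉ Z × ¬ Meets S Z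
      bad {Z} {S} h xZ (s , c) = ((λ u → p─q⊆p W Z (s u)) , c) , Z , h , xZ , λ { (u , uS , uZ) → proj₂ (∈─⁻ W Z (s uS)) uZ }

      Z₁ : ∃ λ Z → fam ∋ Z × x ∉ Z × x ∉ Z
      Z₁ = Good.nocov good x x

      module Count (D₁ : Subset n) (D₁⊆ : D₁ ⊆ W ─ proj₁ Z₁) (∣D₁∣ : ∣ D₁ ∣ ≡ suc k)
        (y : Fin n) (yW : y ∈ W) (yD₁ : y ∉ D₁) (Z₂ : Subset n) (f₂ : fam ∋ Z₂) (x₂ : x ∉ Z₂) (y₂ : y ∉ Z₂) where

        D₂ E F : Subset n
        D₂ = W ─ Z₂
        E = D₂ ─ D₁
        F = (W ─ D₁) ─ D₂

        f₁ = proj₁ (proj₂ Z₁)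
        x₁ = proj₁ (proj₂ (proj₂ Z₁))

        w≥1 : 1 ≤ ∣ E ∣
        w≥1 = x∈p⇒1≤∣p∣ (x∈p∧x∉q⇒x∈p─q (x∈p∧x∉q⇒x∈p─q yW y₂) yD₁)

        q≥1 : 1 ≤ ∣ F ∣
        q≥1 = let u , u₁ , u₂ , uY = isCore f₁ f₂
                  uW = ∈-⁺ Y uY (∈∉⇒≢ u₁ x₁)
                  uF = x∈p∧x∉q⇒x∈p─q (x∈p∧x∉q⇒x∈p─q uW (λ h → proj₂ (∈─⁻ W (proj₁ Z₁) (D₁⊆ h)) u₁)) (λ h → proj₂ (∈─⁻ W Z₂ h) u₂)
              in x∈p⇒1≤∣p∣ uF

        w+q : ∣ E ∣ + ∣ F ∣ ≡ 2 + k
        w+q = +-cancelˡ-≡ (suc k) _ _ (begin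
          suc k + (∣ E ∣ + ∣ F ∣)  ≡⟨ cong₂ _+_ (sym ∣D₁∣) (cong (_+ ∣ F ∣) (cong ∣_∣ E≡)) ⟩
          ∣ D₁ ∣ + (∣ (W ─ D₁) ∩ D₂ ∣ + ∣ F ∣)  ≡⟨ cong (∣ D₁ ∣ +_) (∣∩∣+∣─∣ (W ─ D₁) D₂) ⟩
          ∣ D₁ ∣ + ∣ W ─ D₁ ∣  ≡⟨ +-comm ∣ D₁ ∣ _ ⟩
          ∣ W ─ D₁ ∣ + ∣ D₁ ∣  ≡⟨ ∣─∣-⊆ W D₁ (λ h → p─q⊆p W (proj₁ Z₁) (D₁⊆ h)) ⟩
          ∣ W ∣  ≡⟨ ∣W∣ ⟩
          suc k + (2 + k)  ∎)
          where
          open ≡-Reasoning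
          E≡ : E ≡ (W ─ D₁) ∩ D₂
          E≡ = ⊆-antisym (λ h → let a , b = ∈─⁻ D₂ D₁ h in x∈p∩q⁺ (x∈p∧x∉q⇒x∈p─q (p─q⊆p W Z₂ a) b , a))
                         (λ h → let a , b = x∈p∩q⁻ (W ─ D₁) D₂ h in x∈p∧x∉q⇒x∈p─q b (proj₂ (∈─⁻ W D₁ a)))

        -- The bad sets are sorted into those inside `D₁`, those inside `D₂` reaching beyond `D₁`,
        -- and those reaching outside both. These classes are disjoint.
        B₁? = ksub? D₁ (suc r)
        B₂? = λ S → ksub? D₂ (suc r) S ×-dec meets? S E
        B₃? = λ S → Bad? S ×-dec meets? S F
        b = binom (suc k) (suc r)

        n₁ : # B₁? ≡ b
        n₁ = trans (#-ksub D₁ (suc r)) (cong (λ z → binom z (suc r)) ∣D₁∣)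
        n₂ : b ≤ # B₂? + binom (suc k ∸ ∣ E ∣) (suc r)
        n₂ = covered-≥ r (ksub? D₂ (suc r)) (∣ E ∣) (suc k) E refl (λ h → D₂ , p─q⊆p D₂ D₁ h , ∣W─∣ f₂ , λ u → u)
        -- Each point `z` of `F` is missed by some member that also avoids `x`. Different points may
        -- need different members, which `covered-≥` permits.
        n₃ : b ≤ # B₃? + binom (suc k ∸ ∣ F ∣) (suc r)
        n₃ = covered-≥ r Bad? (∣ F ∣) (suc k) F refl (λ {z} h →
          let Z , f , xZ , zZ = Good.nocov good x z
          in W ─ Z , x∈p∧x∉q⇒x∈p─q (p─q⊆p W D₁ (p─q⊆p (W ─ D₁) D₂ h)) zZ , ∣W─∣ f , bad f xZ)

        disjoint-≤ : (# B₁? + # B₂?) + # B₃? ≤ # Bad?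
        disjoint-≤ = ≤-trans (+-monoˡ-≤ (# B₃?) (#-⊎ B₁? B₂? B₁₂? (λ S h → inj₁ h) (λ S h → inj₂ h)
            (λ { S (s , _) (_ , u , uS , uE) → proj₂ (∈─⁻ D₂ D₁ uE) (s uS) })))
          (#-⊎ B₁₂? B₃? Bad? (λ { S (inj₁ (s , c)) → bad f₁ x₁ ((λ u → D₁⊆ (s u)) , c) ; S (inj₂ (h , _)) → bad f₂ x₂ h })
            (λ S → proj₁) (λ { S (inj₁ (s , _)) (_ , u , uS , uF) → proj₂ (∈─⁻ W D₁ (p─q⊆p (W ─ D₁) D₂ uF)) (s uS)
                             ; S (inj₂ ((s , _) , _)) (_ , u , uS , uF) → proj₂ (∈─⁻ (W ─ D₁) D₂ uF) (s uS) }))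
          where
          B₁₂? = λ S → B₁? S ⊎-dec B₂? S

        -- As `∣ E ∣ + ∣ F ∣` is `2 + k`, the two remaining sizes add up to `k`, and the total loss
        -- is greatest when it sits in one block of `k` points.
        rest-≤ : binom (suc k ∸ ∣ E ∣) (suc r) + binom (suc k ∸ ∣ F ∣) (suc r) ≤ binom k (suc r)
        rest-≤ = ≤-trans (binom-superadditive (suc k ∸ ∣ E ∣) (suc k ∸ ∣ F ∣) r) (binom-mono (suc r) (≤-reflexive (lem ∣ E ∣ ∣ F ∣ w≥1 q≥1 w+q)))
          where
          lem : ∀ w q → 1 ≤ w → 1 ≤ q → w + q ≡ 2 + k → (suc k ∸ w) + (suc k ∸ q) ≡ k
          lem (suc w) (suc q) _ _ e = trans (cong₂ _+_ (cong (_∸ w) (sym e′)) (cong (_∸ q) (sym e′)))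
              (trans (cong₂ _+_ (m+n∸m≡n w q) (m+n∸n≡m w q)) (trans (+-comm q w) e′))
            where
            e′ : w + q ≡ k
            e′ = suc-injective (suc-injective (trans (cong suc (sym (+-suc w q))) e))

        total : (b + b) + b ≤ # Bad? + binom k (suc r)
        total = begin
          (b + b) + b  ≤⟨ +-mono-≤ (+-mono-≤ (≤-reflexive (sym n₁)) n₂) n₃ ⟩
          (# B₁? + (# B₂? + c₂)) + (# B₃? + c₃)  ≡⟨ solve 5 (λ a b c d e → (a :+ (b :+ c)) :+ (d :+ e) := ((a :+ b) :+ d) :+ (c :+ e)) refl (# B₁?) (# B₂?) c₂ (# B₃?) c₃ ⟩
          ((# B₁? + # B₂?) + # B₃?) + (c₂ + c₃)  ≤⟨ +-mono-≤ disjoint-≤ rest-≤ ⟩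
          # Bad? + binom k (suc r)  ∎
          where
          open ≤-Reasoning
          open +-*-Solver using (solve; _:=_; _:+_; con)
          c₂ = binom (suc k ∸ ∣ E ∣) (suc r)
          c₃ = binom (suc k ∸ ∣ F ∣) (suc r)

      total-≤ : let b = binom (suc k) (suc r) in (b + b) + b ≤ # Bad? + binom k (suc r)
      total-≤ with ∃-subset (W ─ proj₁ Z₁) (suc k) (∣W─∣ (proj₁ (proj₂ Z₁)))
      ... | D₁ , D₁⊆ , ∣D₁∣ with ∣p∣<∣q∣⇒∃ D₁ W (subst₂ _<_ (sym ∣D₁∣) (sym ∣W∣) (m<m+n (suc k) (s≤s z≤n)))
      ...   | y , yW , yD₁ with Good.nocov good x y
      ...     | Z₂ , f₂ , x₂ , y₂ = Count.total D₁ D₁⊆ ∣D₁∣ y yW yD₁ Z₂ f₂ x₂ y₂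

      -- A trace meets every member, and a member avoiding `x` is met in another point; so the trace
      -- without `x` is not bad.
      L-≤ : ∥ L ∥ ≤ # (λ S → ksub? W (suc r) S ×-dec ¬? (β? S))
      L-≤ = #-injection (L ∋?_) (λ S → ksub? W (suc r) S ×-dec ¬? (β? S)) (_- x)
        (λ S h → ((λ u → let a , b = ∈-⁻ S u in ∈-⁺ Y (proj₁ (uL h) a) b) , suc-injective (trans (∣-∣-∈ S (star h)) (proj₂ (uL h)))) ,
          λ { (Z , f , xZ , ¬m) → let u , uS , uZ = hits h f in ¬m (u , ∈-⁺ S uS (∈∉⇒≢ uZ xZ) , uZ) })
        (λ S S′ h h′ e → ⊆-antisym (sub h h′ e) (sub h′ h (sym e)))
        where
        sub : ∀ {S S′} → L ∋ S → L ∋ S′ → S - x ≡ S′ - x → S ⊆ S′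
        sub {S} {S′} h h′ e {u} uS with u ≟ x
        ... | yes refl = star h′
        ... | no ne = proj₁ (∈-⁻ S′ (subst (u ∈_) e (∈-⁺ S uS ne)))

    -- 𝒢 attains this with `x` the point 1: the complements of the sets in ℬ are two `(k+1)`-sets
    -- sharing `k` points and a third one disjoint from both, so exactly `3b - binom k (suc r)` sets
    -- are bad.
    star-≤ : let b = binom (suc k) (suc r) in ∥ L ∥ + ((b + b) + b) ≤ binom (suc k + (2 + k)) (suc r) + binom k (suc r)
    star-≤ = begin
      ∥ L ∥ + _  ≤⟨ +-mono-≤ L-≤ total-≤ ⟩
      # (λ S → ksub? W (suc r) S ×-dec ¬? (β? S)) + (# Bad? + binom k (suc r))  ≡⟨ sym (+-assoc (# (λ S → ksub? W (suc r) S ×-dec ¬? (β? S))) (# Bad?) _) ⟩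
      (# (λ S → ksub? W (suc r) S ×-dec ¬? (β? S)) + # Bad?) + binom k (suc r)  ≤⟨ +-monoˡ-≤ (binom k (suc r))
          (#-⊎ (λ S → ksub? W (suc r) S ×-dec ¬? (β? S)) Bad? (ksub? W (suc r)) (λ _ → proj₁) (λ _ → proj₁) (λ { S (_ , a) (_ , b) → a b })) ⟩
      # (ksub? W (suc r)) + binom k (suc r)  ≡⟨ cong (_+ binom k (suc r)) (trans (#-ksub W (suc r)) (cong (λ z → binom z (suc r)) ∣W∣)) ⟩
      binom (suc k + (2 + k)) (suc r) + binom k (suc r)  ∎
      where open ≤-Reasoning

-- Families of triples

#-sum-≤ : {P : Subset n → Set} (P? : Decidable P) (b m : ℕ) (R : Subset n) → ∣ R ∣ ≡ m → (∀ X → P X → Meets X R) →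
  (∀ {z} → z ∈ R → # (P? &∈ z) ≤ b) → # P? ≤ m * b
#-sum-≤ P? b zero R e h c = ≤-reflexive (#-∅ P? (λ X p → let x , _ , xR = h X p in
  case subst (1 ≤_) e (x∈p⇒1≤∣p∣ xR) of λ ()))
#-sum-≤ {P = P} P? b (suc m) R e h c with ∃-∈ R (subst (0 <_) (sym e) (s≤s z≤n))
... | z , zR = ≤-trans (#-∪ (P? &∈ z) (P? &∉ z) P? split)
    (+-mono-≤ (c zR) (#-sum-≤ (P? &∉ z) b m (R - z) (suc-injective (trans (∣-∣-∈ R zR) e))
      (λ { X (p , zX) → let x , xX , xR = h X p in x , xX , ∈-⁺ R xR (∈∉⇒≢ xX zX) })
      (λ {y} yR → ≤-trans (#-mono (λ X → (P? X ×-dec ¬? (z ∈? X)) ×-dec (y ∈? X)) (P? &∈ y) (λ { X ((p , _) , yX) → p , yX }))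
                    (c (proj₁ (∈-⁻ R yR))))))
  where
  split : ∀ X → P X → (P X × z ∈ X) ⊎ (P X × ¬ (z ∈ X))
  split X p with z ∈? X
  ... | yes a = inj₁ (p , a)
  ... | no a = inj₂ (p , a)

abstract

  #-two : {P : Subset n → Set} (P? : Decidable P) → 2 ≤ # P? → ∃ λ X → ∃ λ Z → P X × P Z × X ≢ Z
  #-two {P = P} P? h with #-∃ P? (≤-trans (s≤s z≤n) h)
  ... | X , p with anySubset? (λ Z → P? Z ×-dec ¬? (X ≟ₛ Z))
  ...   | yes (Z , q , ne) = X , Z , p , q , ne
  ...   | no all = ⊥-elim (<⇒≱ h (#-≤1 P? (λ A B a b → trans (sym (eq A a)) (eq B b))))
    where
    eq : ∀ A → P A → X ≡ A
    eq A a with X ≟ₛ A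
    ... | yes e = e
    ... | no ne = ⊥-elim (all (A , a , ne))

≤-or-> : ∀ a b → a ≤ b ⊎ suc b ≤ a
≤-or-> a b with a ≤? b
... | yes h = inj₁ h
... | no h = inj₂ (≰⇒> h)

triple≡ : ∀ {X : Subset n} {u w z} → ∣ X ∣ ≡ 3 → u ≢ w → u ≢ z → w ≢ z → u ∈ X → w ∈ X → z ∈ X → pts (u ∷ w ∷ z ∷ []) ≡ X
triple≡ {X = X} {u} {w} {z} e uw uz wz uX wX zX = ⊆∧∣∣⇒≡ (pts (u ∷ w ∷ z ∷ [])) X (pts-⊆ (uX ∷ wX ∷ zX ∷ []))
  (≤-trans (≤-reflexive e) (≤-trans (m≤m+n 3 _) (outside-≤ {I = ⊥} (u ∷ w ∷ z ∷ []) ((uw ∷ uz ∷ []) ∷ (wz ∷ []) ∷ [] ∷ [])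
    ((∈-pts⁺ at₀ , ∉⊥) ∷ (∈-pts⁺ at₁ , ∉⊥) ∷ (∈-pts⁺ at₂ , ∉⊥) ∷ []))))

abstract

  third : ∀ {X : Subset n} {x y} → ∣ X ∣ ≡ 3 → x ≢ y → x ∈ X → y ∈ X →
    ∃ λ c → c ≢ x × c ≢ y × c ∈ X × (∀ {z} → z ∈ X → z ≡ x ⊎ z ≡ y ⊎ z ≡ c)
  third {X = X} {x} {y} e xy xX yX =
    let e₁ = suc-injective (trans (∣-∣-∈ X xX) e)
        e₂ = suc-injective (trans (∣-∣-∈ (X - x) (∈-⁺ X yX (xy ∘ sym))) e₁)
        c , c∈ = ∃-∈ ((X - x) - y) (subst (0 <_) (sym e₂) (s≤s z≤n))
        c∈′ , c≢y = ∈-⁻ (X - x) c∈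
        cX , c≢x = ∈-⁻ X c∈′
    in c , c≢x , c≢y , cX , λ {z} zX → ∈-pts₃ (subst (z ∈_) (sym (triple≡ e xy (c≢x ∘ sym) (c≢y ∘ sym) xX yX cX)) zX)

module Triples {n : ℕ} {Y : Subset n} {L : Fam n} (uL : Unif Y 3 L) (int : Cross L L) where

  private
    ∣L∣ : ∀ {X} → L ∋ X → ∣ X ∣ ≡ 3
    ∣L∣ h = proj₂ (uL h)

  codeg? : (u w : Fin n) → Decidable (λ S → L ∋ S × u ∈ S × w ∈ S)
  codeg? u w S = (L ∋? S) ×-dec (u ∈? S) ×-dec (w ∈? S)

  triple-≤1 : ∀ {P : Subset n → Set} (P? : Decidable P) {u w z} → u ≢ w → u ≢ z → w ≢ z →
    (∀ S → P S → L ∋ S × u ∈ S × w ∈ S × z ∈ S) → # P? ≤ 1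
  triple-≤1 P? uw uz wz f = #-≤1 P? (λ X Z p q →
    let hX , a , b , c = f X p
        hZ , a′ , b′ , c′ = f Z q
    in trans (sym (triple≡ (∣L∣ hX) uw uz wz a b c)) (triple≡ (∣L∣ hZ) uw uz wz a′ b′ c′))

  codeg-≤ : ∀ {u w R δ} → u ≢ w → ∣ R ∣ ≡ δ → u ∉ R → w ∉ R → (∀ {S} → L ∋ S → Meets S R) → # (codeg? u w) ≤ δ
  codeg-≤ {u} {w} {R} {δ} uw e uR wR h = ≤-trans (#-sum-≤ (codeg? u w) 1 δ R e (λ { X (hX , _) → h hX })
      (λ {z} zR → triple-≤1 (codeg? u w &∈ z) uw (∈∉⇒≢ zR uR ∘ sym) (∈∉⇒≢ zR wR ∘ sym) (λ { S ((hS , a , b) , c) → hS , a , b , c })))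
    (≤-reflexive (*-identityʳ δ))

  Only : Fin n → Fin n → Subset n → Set
  Only x y S = L ∋ S × x ∈ S × y ∉ S

  only? : ∀ x y → Decidable (Only x y)
  only? x y S = (L ∋? S) ×-dec (x ∈? S) ×-dec ¬? (y ∈? S)

  abstract

    others : ∀ {x y X} → Only x y X → ∃ λ u → ∃ λ v → u ≢ v × u ≢ x × v ≢ x × u ≢ y × v ≢ y × u ∈ X × v ∈ X ×
      (∀ {z} → z ∈ X → z ≡ x ⊎ z ≡ u ⊎ z ≡ v)
    others {x} {y} {X} (hX , xX , yX) =
      let u , u∈ = ∃-∈ (X - x) (subst (0 <_) (sym (suc-injective (trans (∣-∣-∈ X xX) (∣L∣ hX)))) (s≤s z≤n))
          uX , u≢x = ∈-⁻ X u∈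
          v , v≢x , v≢u , vX , all = third (∣L∣ hX) (u≢x ∘ sym) xX uX
      in u , v , v≢u ∘ sym , u≢x , v≢x , ∈∉⇒≢ uX yX , ∈∉⇒≢ vX yX , uX , vX , all

  cross-hit : ∀ {x y X Z u v} → Only x y X → (∀ {z} → z ∈ X → z ≡ x ⊎ z ≡ u ⊎ z ≡ v) → Only y x Z → u ∈ Z ⊎ v ∈ Z
  cross-hit (hX , _ , _) all (hZ , _ , xZ) with int hX hZ
  ... | z , zX , zZ with all zX
  ...   | inj₁ refl = ⊥-elim (xZ zZ)
  ...   | inj₂ (inj₁ refl) = inj₁ zZ
  ...   | inj₂ (inj₂ refl) = inj₂ zZ

  module _ {δ : ℕ} (3≤δ : 3 ≤ δ) where

    CodegBound : Fin n → Set
    CodegBound x = ∀ {u} → u ≢ x → # (codeg? x u) ≤ δ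

    only-through-≤ : ∀ {x y u} → CodegBound x → u ≢ x → # (only? x y &∈ u) ≤ δ
    only-through-≤ {x} {y} {u} cb ux = ≤-trans (#-mono (only? x y &∈ u) (codeg? x u)
      (λ { S ((hS , a , _) , b) → hS , a , b })) (cb ux)

    one-opposite : ∀ {x y X} → CodegBound y → Only x y X → # (only? y x) ≤ δ + δ
    one-opposite {x} {y} cb oX = let u , v , uv , ux , vx , uy , vy , uX , vX , all = others oX in
      ≤-trans (#-∪ (only? y x &∈ u) (only? y x &∈ v) (only? y x)
                (λ S o → [ (λ h → inj₁ (o , h)) , (λ h → inj₂ (o , h)) ]′ (cross-hit oX all o)))
        (+-mono-≤ (only-through-≤ cb uy) (only-through-≤ cb vy))

    -- Two triples {x,u,v}, {x,u,w} or {x,u,v}, {x,w,z} seen from the triples through y.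
    data Pair (x y : Fin n) : Set where
      sharing : ∀ {u} → u ≢ x → u ≢ y →
        # (only? y x &∉ u) ≤ 1 → Pair x y
      disjoint : # (only? y x) ≤ 4 → Pair x y

    -- A triple through `y` but not `x` meets both given triples away from `x`. If these share a
    -- point, a triple through `y` without it must take the last point of each and is determined;
    -- otherwise there are two choices for each, four in all.
    pair : ∀ {x y X₁ X₂} → Only x y X₁ → Only x y X₂ → X₁ ≢ X₂ → Pair x y
    pair {x} {y} {X₁} {X₂} o₁ o₂ ne with others o₁ | others o₂
    ... | u , v , uv , ux , vx , uy , vy , u₁ , v₁ , all₁ | w , z , wz , wx , zx , wy , zy , w₂ , z₂ , all₂ = go (u ∈? X₂) (v ∈? X₂)
      where
      share : ∀ {s t} → s ≢ x → s ≢ y → t ≢ x → t ≢ y → s ≢ t → s ∈ X₁ → t ∈ X₁ → (∀ {z} → z ∈ X₁ → z ≡ x ⊎ z ≡ s ⊎ z ≡ t) → s ∈ X₂ → Pair x y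
      share {s} {t} sx sy tx ty st s₁ t₁ all s₂ =
        let c , cx , cs , c₂ , all′ = third (∣L∣ (proj₁ o₂)) (sx ∘ sym) (proj₁ (proj₂ o₂)) s₂
            tc : t ≢ c
            tc e = ne (trans (sym (triple≡ (∣L∣ (proj₁ o₁)) (sx ∘ sym) (tx ∘ sym) st (proj₁ (proj₂ o₁)) s₁ t₁))
                     (triple≡ (∣L∣ (proj₁ o₂)) (sx ∘ sym) (tx ∘ sym) st (proj₁ (proj₂ o₂)) s₂ (subst (_∈ X₂) (sym e) c₂)))
            cy : c ≢ y
            cy = ∈∉⇒≢ c₂ (proj₂ (proj₂ o₂))
        in sharing sx sy (triple-≤1 (only? y x &∉ s) (ty ∘ sym) (cy ∘ sym) tc
             (λ { S (o@(hS , yS , _) , sS) → hS , yS , resolveˡ sS (cross-hit o₁ all o) , resolveˡ sS (cross-hit o₂ all′ o) }))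
      go : Dec (u ∈ X₂) → Dec (v ∈ X₂) → Pair x y
      go (yes h) _ = share ux uy vx vy uv u₁ v₁ all₁ h
      go (no _) (yes h) = share vx vy ux uy (uv ∘ sym) v₁ u₁ (λ q → [ inj₁ , [ inj₂ ∘ inj₂ , inj₂ ∘ inj₁ ]′ ]′ (all₁ q)) h
      go (no u∉) (no v∉) = disjoint (≤-trans (#-∪ (only? y x &∈ u) (only? y x &∈ v) (only? y x)
            (λ S o → [ (λ h → inj₁ (o , h)) , (λ h → inj₂ (o , h)) ]′ (cross-hit o₁ all₁ o)))
          (+-mono-≤ (through u∉ uy) (through v∉ vy)))
        where
        through : ∀ {s} → s ∉ X₂ → s ≢ y → # (only? y x &∈ s) ≤ 2
        through {s} s∉ sy = ≤-trans (#-∪ (only? y x &∈ s &∈ w) (only? y x &∈ s &∈ z)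
            (only? y x &∈ s) (λ { S (o , h) → [ (λ h′ → inj₁ ((o , h) , h′)) , (λ h′ → inj₂ ((o , h) , h′)) ]′ (cross-hit o₂ all₂ o) }))
          (+-mono-≤ (single w₂ wy) (single z₂ zy))
          where
          single : ∀ {t} → t ∈ X₂ → t ≢ y → # (only? y x &∈ s &∈ t) ≤ 1
          single {t} t₂ ty = triple-≤1 (only? y x &∈ s &∈ t) (sy ∘ sym) (ty ∘ sym) (∈∉⇒≢ t₂ s∉ ∘ sym)
            (λ { S (((hS , yS , _) , a) , b) → hS , yS , a , b })

    split-∈ : ∀ {P : Subset n → Set} (P? : Decidable P) u → # P? ≤ # (P? &∈ u) + # (P? &∉ u)
    split-∈ {P} P? u = #-∪ (P? &∈ u) (P? &∉ u) P? lem
      where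
      lem : ∀ S → P S → (P S × u ∈ S) ⊎ (P S × u ∉ S)
      lem S p with u ∈? S
      ... | yes a = inj₁ (p , a)
      ... | no a = inj₂ (p , a)

    two-opposite : ∀ {x y} → CodegBound y → Pair x y → # (only? y x) ≤ suc δ
    two-opposite {x} {y} cb (sharing {u} ux uy h) = ≤-trans (split-∈ (only? y x) u)
      (≤-trans (+-mono-≤ (only-through-≤ cb uy) h) (≤-reflexive (+-comm δ 1)))
    two-opposite cb (disjoint h) = ≤-trans h (s≤s 3≤δ)

    -- A single triple on one side leaves at most `δ + δ` on the other, and `δ ≤ 4` makes the sum
    -- small enough. With two on each side both are at most `suc δ`, one too many in total when `δ`
    -- is 4. In the sharing case one gains by asking whether all triples on the first side contain
    -- `u`: if so, that side is at most `δ`; if one avoids `u`, the opposite side is at most 3.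
    exactlyOne-≤ : ∀ {x y} → δ ≤ 4 → CodegBound x → CodegBound y → 0 < # (only? x y) → 0 < # (only? y x) →
      # (only? x y) + # (only? y x) ≤ δ + 5
    exactlyOne-≤ {x} {y} δ≤4 cx cy x>0 y>0 with ≤-or-> (# (only? x y)) 1 | ≤-or-> (# (only? y x)) 1
    ... | inj₁ a | _ = ≤-trans (+-mono-≤ a (one-opposite cy (proj₂ (#-∃ (only? x y) x>0))))
          (≤-trans (+-monoʳ-≤ (suc δ) δ≤4) (≤-reflexive (sym (+-suc δ 4))))
    ... | inj₂ _ | inj₁ b = ≤-trans (+-mono-≤ (one-opposite cx (proj₂ (#-∃ (only? y x) y>0))) b)
          (≤-trans (+-monoˡ-≤ 1 (+-monoʳ-≤ δ δ≤4)) (≤-reflexive (+-assoc δ 4 1)))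
    ... | inj₂ a | inj₂ b with #-two (only? x y) a | #-two (only? y x) b
    ...   | X₁ , X₂ , o₁ , o₂ , ne | Z₁ , Z₂ , o₁′ , o₂′ , ne′ = go (pair o₁ o₂ ne)
      where
      x≤ : # (only? x y) ≤ suc δ
      x≤ = two-opposite cx (pair o₁′ o₂′ ne′)
      go : Pair x y → # (only? x y) + # (only? y x) ≤ δ + 5
      go (disjoint h) = ≤-trans (+-mono-≤ x≤ h) (≤-reflexive (sym (+-suc δ 4)))
      go pr@(sharing {u} ux uy h) with anySubset? (only? x y &∉ u)
      ... | no none = ≤-trans (+-mono-≤ (≤-trans (#-mono (only? x y) (only? x y &∈ u) (λ S o → o , in-u S o)) (only-through-≤ cx ux))
                                (two-opposite cy pr)) (+-monoʳ-≤ δ (s≤s δ≤4))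
        where
        in-u : ∀ S → Only x y S → u ∈ S
        in-u S o with u ∈? S
        ... | yes q = q
        ... | no q = ⊥-elim (none (S , o , q))
      ... | yes (X , oX , uX) = ≤-trans (+-mono-≤ x≤ (≤-trans (split-∈ (only? y x) u) (≤-trans (+-mono-≤ two h) (n≤1+n 3)))) (≤-reflexive (sym (+-suc δ 4)))
        where
        two : # (only? y x &∈ u) ≤ 2
        two with others oX
        ... | s , t , st , sx , tx , sy , ty , sX , tX , all = ≤-trans
          (#-∪ (only? y x &∈ u &∈ s) (only? y x &∈ u &∈ t)
            (only? y x &∈ u) (λ { S (o , h) → [ (λ h′ → inj₁ ((o , h) , h′)) , (λ h′ → inj₂ ((o , h) , h′)) ]′ (cross-hit oX all o) }))
          (+-mono-≤ (single sX sy) (single tX ty))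
          where
          single : ∀ {t} → t ∈ X → t ≢ y → # (only? y x &∈ u &∈ t) ≤ 1
          single {t} tX ty = triple-≤1 (only? y x &∈ u &∈ t) (uy ∘ sym) (ty ∘ sym) (∈∉⇒≢ tX uX ∘ sym)
            (λ { S (((hS , yS , _) , a) , b) → hS , yS , a , b })

  neither? : ∀ x y → Decidable (λ S → L ∋ S × x ∉ S × y ∉ S)
  neither? x y S = (L ∋? S) ×-dec ¬? (x ∈? S) ×-dec ¬? (y ∈? S)

  four-classes : ∀ x y → ∥ L ∥ ≤ (# (codeg? x y) + # (neither? x y)) + (# (only? x y) + # (only? y x))
  four-classes x y = ≤-trans (#-∪ (λ S → codeg? x y S ⊎-dec neither? x y S) (λ S → only? x y S ⊎-dec only? y x S) (L ∋?_) lem)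
    (+-mono-≤ (#-∪ (codeg? x y) (neither? x y) (λ S → codeg? x y S ⊎-dec neither? x y S) (λ _ h → h))
              (#-∪ (only? x y) (only? y x) (λ S → only? x y S ⊎-dec only? y x S) (λ _ h → h)))
    where
    lem : ∀ S → L ∋ S → ((L ∋ S × x ∈ S × y ∈ S) ⊎ (L ∋ S × x ∉ S × y ∉ S)) ⊎ (Only x y S ⊎ Only y x S)
    lem S h with x ∈? S | y ∈? S
    ... | yes a | yes b = inj₁ (inj₁ (h , a , b))
    ... | yes a | no b = inj₂ (inj₁ (h , a , b))
    ... | no a | yes b = inj₂ (inj₂ (h , b , a))
    ... | no a | no b = inj₁ (inj₂ (h , a , b))

  module _ (nc : NoCov L) where

    private
      codeg≤3 : ∀ {u w} → u ≢ w → # (codeg? u w) ≤ 3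
      codeg≤3 {u} {w} uw = let R , hR , uR , wR = nc u w in codeg-≤ uw (∣L∣ hR) uR wR (λ hS → int hS hR)

      linear : (∀ {u w} → u ≢ w → # (codeg? u w) ≤ 1) → ∥ L ∥ ≤ 13
      linear c with anySubset? (L ∋?_)
      ... | no none = ≤-trans (≤-reflexive (#-∅ (L ∋?_) (λ X h → none (X , h)))) z≤n
      ... | yes (T , hT) = ≤-trans (#-sum-≤ (L ∋?_) 3 3 T (∣L∣ hT) (λ X hX → int hX hT) deg) (m≤m+n 9 4)
        where
        deg : ∀ {z} → z ∈ T → # (λ X → (L ∋? X) ×-dec (z ∈? X)) ≤ 3
        deg {z} _ = let R , hR , zR , _ = nc z z in
          #-sum-≤ (λ X → (L ∋? X) ×-dec (z ∈? X)) 1 3 R (∣L∣ hR) (λ { X (hX , _) → int hX hR })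
            (λ {w} wR → ≤-trans (#-mono (λ X → ((L ∋? X) ×-dec (z ∈? X)) ×-dec (w ∈? X)) (codeg? z w) (λ { S ((a , b) , c) → a , b , c }))
                          (c (∈∉⇒≢ wR zR ∘ sym)))

      doubled : ∀ {x y} → x ≢ y → 2 ≤ # (codeg? x y) → ∥ L ∥ ≤ 13
      doubled {x} {y} xy h with #-two (codeg? x y) h
      ... | S₁ , S₂ , (h₁ , x₁ , y₁) , (h₂ , x₂ , y₂) , ne with third (∣L∣ h₁) xy x₁ y₁ | third (∣L∣ h₂) xy x₂ y₂
      ...   | c , cx , cy , c₁ , all₁ | d , dx , dy , d₂ , all₂ =
          ≤-trans (four-classes x y) (+-mono-≤ five (exactlyOne-≤ {3} ≤-refl (n≤1+n 3) (λ ux → codeg≤3 (ux ∘ sym)) (λ ux → codeg≤3 (ux ∘ sym)) x>0 y>0))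
        where
        third-in : ∀ {S e Z} → L ∋ S → (∀ {z} → z ∈ S → z ≡ x ⊎ z ≡ y ⊎ z ≡ e) → L ∋ Z → x ∉ Z → y ∉ Z → e ∈ Z
        third-in hS all hZ xZ yZ with int hS hZ
        ... | z , zS , zZ with all zS
        ...   | inj₁ refl = ⊥-elim (xZ zZ)
        ...   | inj₂ (inj₁ refl) = ⊥-elim (yZ zZ)
        ...   | inj₂ (inj₂ refl) = zZ
        cd : c ≢ d
        cd refl = ne (trans (sym (triple≡ (∣L∣ h₁) xy (cx ∘ sym) (cy ∘ sym) x₁ y₁ c₁)) (triple≡ (∣L∣ h₂) xy (cx ∘ sym) (cy ∘ sym) x₂ y₂ d₂))
        x>0 : 0 < # (only? x y)
        x>0 = let Z , hZ , yZ , cZ = nc y c in #-≥1 (only? x y) Z (hZ , (case x ∈? Z of λ { (yes a) → a ; (no a) → ⊥-elim (cZ (third-in h₁ all₁ hZ a yZ)) }) , yZ)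
        y>0 : 0 < # (only? y x)
        y>0 = let Z , hZ , xZ , cZ = nc x c in #-≥1 (only? y x) Z (hZ , (case y ∈? Z of λ { (yes a) → a ; (no a) → ⊥-elim (cZ (third-in h₁ all₁ hZ xZ a)) }) , xZ)
        -- A triple avoiding `x` and `y` contains the third point of every triple through both.
        -- Three such points determine it, which gives `3 + 1`. If `c` and `d` are the only ones,
        -- there are two triples through `x`, `y` and at most three through `c`, `d`.
        five : # (codeg? x y) + # (neither? x y) ≤ 5
        five with anySubset? (λ S → codeg? x y S ×-dec ¬? (c ∈? S) ×-dec ¬? (d ∈? S))
        ... | yes (S , (hS , xS , yS) , cS , dS) with third (∣L∣ hS) xy xS yS
        ...   | f , fx , fy , fS , all = ≤-trans (+-mono-≤ (codeg≤3 xy) (triple-≤1 (neither? x y) cd (∈∉⇒≢ fS cS ∘ sym) (∈∉⇒≢ fS dS ∘ sym)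
                  (λ { Z (hZ , xZ , yZ) → hZ , third-in h₁ all₁ hZ xZ yZ , third-in h₂ all₂ hZ xZ yZ , third-in hS all hZ xZ yZ }))) (n≤1+n 4)
        five | no none = +-mono-≤ (≤-trans (#-∪ (codeg? x y &∈ c) (codeg? x y &∈ d) (codeg? x y) lem)
              (+-mono-≤ (triple-≤1 (codeg? x y &∈ c) xy (cx ∘ sym) (cy ∘ sym) (λ { S ((a , b , e) , f) → a , b , e , f }))
                        (triple-≤1 (codeg? x y &∈ d) xy (dx ∘ sym) (dy ∘ sym) (λ { S ((a , b , e) , f) → a , b , e , f }))))
            (≤-trans (#-mono (neither? x y) (codeg? c d) (λ { Z (hZ , xZ , yZ) → hZ , third-in h₁ all₁ hZ xZ yZ , third-in h₂ all₂ hZ xZ yZ })) (codeg≤3 cd))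
          where
          lem : ∀ S → L ∋ S × x ∈ S × y ∈ S → ((L ∋ S × x ∈ S × y ∈ S) × c ∈ S) ⊎ ((L ∋ S × x ∈ S × y ∈ S) × d ∈ S)
          lem S h with c ∈? S | d ∈? S
          ... | yes a | _ = inj₁ (h , a)
          ... | no _ | yes b = inj₂ (h , b)
          ... | no a | no b = ⊥-elim (none (S , h , a , b))

    -- The target is `extremal 2 3`. If two points never lie in two triples, the three points of one
    -- triple have degree at most 3, so there are at most 9 triples; otherwise a pair of larger
    -- codegree gives `5 + 8`.
    noCov₃-≤ : ∥ L ∥ ≤ 13
    noCov₃-≤ with any? (λ x → any? (λ y → ¬? (x ≟ y) ×-dec (2 ≤? # (codeg? x y))))
    ... | yes (x , y , xy , h) = doubled xy h
    ... | no none = linear (λ {u} {w} uw → [ (λ h → h) , (λ h → ⊥-elim (none (u , w , uw , h))) ]′ (≤-or-> (# (codeg? u w)) 1))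

  -- No triple avoids both points of the cover, so the classes contribute at most `4 + 0` and, with
  -- codegrees up to 4, `4 + 5`.
  cov₂-≤ : (∀ {u w} → u ≢ w → # (codeg? u w) ≤ 4) → ∀ {x y} → Cov₂ L x y → (∃ λ S → L ∋ S × x ∉ S) → (∃ λ S → L ∋ S × y ∉ S) → ∥ L ∥ ≤ 13
  cov₂-≤ c {x} {y} cov (S , hS , xS) (S′ , hS′ , yS′) = ≤-trans (four-classes x y)
      (+-mono-≤ (≤-trans (+-mono-≤ (c xy) (≤-reflexive (#-∅ (neither? x y) (λ { Z (hZ , a , b) → [ a , b ]′ (cov hZ) })))) (≤-reflexive refl))
        (exactlyOne-≤ {4} (n≤1+n 3) ≤-refl (λ ux → c (ux ∘ sym)) (λ ux → c (ux ∘ sym))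
          (#-≥1 (only? x y) S′ (hS′ , resolveʳ yS′ (cov hS′) , yS′))
          (#-≥1 (only? y x) S (hS , yS , xS))))
    where
    yS : y ∈ S
    yS = resolveˡ xS (cov hS)
    xy : x ≢ y
    xy refl = xS yS

-- Families given by decidable predicates

⟦_⟧ : {P : Subset n → Set} → Decidable P → Fam n
⟦ P? ⟧ X = does (P? X)

⟦⟧⁺ : {P : Subset n → Set} (P? : Decidable P) → ∀ {X} → P X → ⟦ P? ⟧ ∋ X
⟦⟧⁺ P? {X} h = mem (dec-true (P? X) h)

⟦⟧⁻ : {P : Subset n → Set} (P? : Decidable P) → ∀ {X} → ⟦ P? ⟧ ∋ X → P X
⟦⟧⁻ P? {X} h = does⁻ (P? X) (holds h)

∥⟦⟧∥ : {P : Subset n → Set} (P? : Decidable P) → # P? ≤ ∥ ⟦ P? ⟧ ∥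
∥⟦⟧∥ P? = #-mono P? (⟦ P? ⟧ ∋?_) (λ X → ⟦⟧⁺ P?)

-∪⁅⁆ : ∀ {S : Subset n} {x} → x ∈ S → (S - x) ∪ ⁅ x ⁆ ≡ S
-∪⁅⁆ {S = S} {x} h = ⊆-antisym
  (λ u → [ (λ a → proj₁ (∈-⁻ S a)) , (λ a → subst (_∈ S) (sym (x∈⁅y⁆⇒x≡y x a)) h) ]′ (x∈p∪q⁻ (S - x) ⁅ x ⁆ u))
  (λ {z} u → case z ≟ x of λ { (yes refl) → x∈p∪q⁺ (inj₂ (x∈⁅x⁆ x)) ; (no ne) → x∈p∪q⁺ (inj₁ (∈-⁺ S u ne)) })

-- Families covered by two points

module _ {n k j v : ℕ} {Y : Subset n} {L : Fam n} (∣Y∣ : ∣ Y ∣ ≡ (2 + k) + (2 + k)) (uL : Unif Y (2 + j) L) (int : Cross L L)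
  (bound : CrossBound (suc j)) (dim : k + (2 + k) ≡ (suc j + suc j) + v) where

  private
    link? : (U : Subset n) (x : Fin n) → Decidable (λ S → KSub U (suc j) S × L ∋ S ∪ ⁅ x ⁆)
    link? U x S = ksub? U (suc j) S ×-dec (L ∋? (S ∪ ⁅ x ⁆))

    only-≤-link : ∀ {U x y} → (∀ {z} → z ∈ Y → z ≢ x → z ≢ y → z ∈ U) →
      # (λ S → (L ∋? S) ×-dec (x ∈? S) ×-dec ¬? (y ∈? S)) ≤ ∥ ⟦ link? U x ⟧ ∥
    only-≤-link {U} {x} {y} inU = ≤-trans (#-injection (λ S → (L ∋? S) ×-dec (x ∈? S) ×-dec ¬? (y ∈? S)) (link? U x) (_- x)
        (λ { S (h , xS , yS) → ((λ u → let a , b = ∈-⁻ S u in inU (proj₁ (uL h) a) b (∈∉⇒≢ a yS)) ,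
                                suc-injective (trans (∣-∣-∈ S xS) (proj₂ (uL h)))) , subst (L ∋_) (sym (-∪⁅⁆ xS)) h })
        (λ { S S′ (_ , xS , _) (_ , xS′ , _) e → trans (sym (-∪⁅⁆ xS)) (trans (cong (_∪ ⁅ x ⁆) e) (-∪⁅⁆ xS′)) }))
      (∥⟦⟧∥ (link? U x))

    link-unif : ∀ {U x} → Unif U (suc j) ⟦ link? U x ⟧
    link-unif {U} {x} h = proj₁ (⟦⟧⁻ (link? U x) h)

    link-cross : ∀ {U x y} → x ≢ y → x ∉ U → y ∉ U → Cross ⟦ link? U x ⟧ ⟦ link? U y ⟧
    link-cross {U} {x} {y} xy xU yU {S} {S′} h h′ =
      let (s , _) , hS = ⟦⟧⁻ (link? U x) h
          (s′ , _) , hS′ = ⟦⟧⁻ (link? U y) h′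
          z , a , b = int hS hS′
      in go s s′ a b
      where
      go : ∀ {z} → S ⊆ U → S′ ⊆ U → z ∈ S ∪ ⁅ x ⁆ → z ∈ S′ ∪ ⁅ y ⁆ → Meets S S′
      go {z} s s′ a b with x∈p∪q⁻ S ⁅ x ⁆ a | x∈p∪q⁻ S′ ⁅ y ⁆ b
      ... | inj₁ u | inj₁ w = z , u , w
      ... | inj₁ u | inj₂ w = ⊥-elim (yU (subst (_∈ U) (x∈⁅y⁆⇒x≡y y w) (s u)))
      ... | inj₂ u | inj₁ w = ⊥-elim (xU (subst (_∈ U) (x∈⁅y⁆⇒x≡y x u) (s′ w)))
      ... | inj₂ u | inj₂ w = ⊥-elim (xy (trans (sym (x∈⁅y⁆⇒x≡y x u)) (x∈⁅y⁆⇒x≡y y w)))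

  -- Members through both points, stripped of them, still meet `R`, which contains neither point.
  -- Members through exactly one of the points leave two non-empty families of `(j+1)`-sets in `U`;
  -- these cross-intersect because the removed points are different.
  twoCover-≤ : ∀ {x y R} → Cov₂ L x y → (∃ λ S → L ∋ S × x ∉ S) → (∃ λ S → L ∋ S × y ∉ S) →
    ∣ R ∣ ≡ 2 + k → x ∉ R → y ∉ R → (∀ {S} → L ∋ S → Meets S R) →
    ∥ L ∥ + binom k j ≤ binom (k + (2 + k)) j + conv (crossLevel (suc j)) v (suc j)
  twoCover-≤ {x} {y} {R} cov (S₁ , h₁ , x₁) (S₂ , h₂ , y₂) ∣R∣ xR yR hits = begin
    ∥ L ∥ + binom k j  ≤⟨ +-monoˡ-≤ _ classes ⟩
    (# both? + (# onlyx? + # onlyy?)) + binom k j  ≡⟨ solve 3 (λ a b c → (a :+ b) :+ c := (a :+ c) :+ b) refl (# both?) (# onlyx? + # onlyy?) (binom k j) ⟩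
    (# both? + binom k j) + (# onlyx? + # onlyy?)  ≤⟨ +-mono-≤ both-≤ only-≤ ⟩
    binom (k + (2 + k)) j + conv (crossLevel (suc j)) v (suc j) ∎
    where
    open ≤-Reasoning
    open +-*-Solver using (solve; _:=_; _:+_; con)
    both? = λ S → (L ∋? S) ×-dec (x ∈? S) ×-dec (y ∈? S)
    onlyx? = λ S → (L ∋? S) ×-dec (x ∈? S) ×-dec ¬? (y ∈? S)
    onlyy? = λ S → (L ∋? S) ×-dec (y ∈? S) ×-dec ¬? (x ∈? S)
    y₁ : y ∈ S₁
    y₁ = resolveˡ x₁ (cov h₁)
    x₂ : x ∈ S₂
    x₂ = resolveʳ y₂ (cov h₂)
    xy : x ≢ y
    xy = ∈∉⇒≢ x₂ y₂
    U : Subset n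
    U = (Y - x) - y
    ∣U∣ : ∣ U ∣ ≡ k + (2 + k)
    ∣U∣ = suc-injective (trans (∣-∣-∈ (Y - x) (∈-⁺ Y (proj₁ (uL h₁) y₁) (xy ∘ sym))) (suc-injective (trans (∣-∣-∈ Y (proj₁ (uL h₂) x₂)) ∣Y∣)))
    inU : ∀ {z} → z ∈ Y → z ≢ x → z ≢ y → z ∈ U
    inU zY zx zy = ∈-⁺ (Y - x) (∈-⁺ Y zY zx) zy
    xU : x ∉ U
    xU h = proj₂ (∈-⁻ Y (proj₁ (∈-⁻ (Y - x) h))) refl
    yU : y ∉ U
    yU h = proj₂ (∈-⁻ (Y - x) h) refl
    lem : ∀ S → L ∋ S → (L ∋ S × x ∈ S × y ∈ S) ⊎ ((L ∋ S × x ∈ S × y ∉ S) ⊎ (L ∋ S × y ∈ S × x ∉ S))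
    lem S h with x ∈? S | y ∈? S
    ... | yes a | yes b = inj₁ (h , a , b)
    ... | yes a | no b = inj₂ (inj₁ (h , a , b))
    ... | no a | yes b = inj₂ (inj₂ (h , b , a))
    ... | no a | no b = ⊥-elim ([ a , b ]′ (cov h))
    classes : ∥ L ∥ ≤ # both? + (# onlyx? + # onlyy?)
    classes = ≤-trans (#-∪ both? (λ S → onlyx? S ⊎-dec onlyy? S) (L ∋?_) lem)
      (+-monoʳ-≤ (# both?) (#-∪ onlyx? onlyy? (λ S → onlyx? S ⊎-dec onlyy? S) (λ _ h → h)))
    both-≤ : # both? + binom k j ≤ binom (k + (2 + k)) j
    both-≤ = begin
      # both? + binom k j  ≤⟨ +-mono-≤ (≤-trans (#-injection both? hit? (λ S → (S - x) - y) maps inj) (∥⟦⟧∥ hit?))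
                                                      (binom-mono j (+-cancelˡ-≤ (2 + k) _ _ (≤-trans (≤-reflexive (trans (+-comm (2 + k) k) (sym ∣U∣))) (∣─∣≥ U R (2 + k) (≤-reflexive ∣R∣))))) ⟩
      ∥ ⟦ hit? ⟧ ∥ + binom (∣ U ─ R ∣) j  ≤⟨ hitting-≤ (λ h → proj₁ (⟦⟧⁻ hit? h)) (λ h → proj₂ (⟦⟧⁻ hit? h)) ⟩
      binom (∣ U ∣) j  ≡⟨ cong (λ z → binom z j) ∣U∣ ⟩
      binom (k + (2 + k)) j  ∎
      where
      hit? = λ S → ksub? U j S ×-dec meets? S R
      maps : ∀ S → L ∋ S × x ∈ S × y ∈ S → KSub U j ((S - x) - y) × Meets ((S - x) - y) R
      maps S (h , xS , yS) = ((λ u → let a , b = ∈-⁻ (S - x) u ; c , d = ∈-⁻ S a in inU (proj₁ (uL h) c) d b) ,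
          suc-injective (trans (∣-∣-∈ (S - x) (∈-⁺ S yS (xy ∘ sym))) (suc-injective (trans (∣-∣-∈ S xS) (proj₂ (uL h)))))) ,
        (let z , zS , zR = hits h in z , ∈-⁺ (S - x) (∈-⁺ S zS (∈∉⇒≢ zR xR)) (∈∉⇒≢ zR yR) , zR)
      back : ∀ {S} → x ∈ S → y ∈ S → (((S - x) - y) ∪ ⁅ y ⁆) ∪ ⁅ x ⁆ ≡ S
      back {S} xS yS = trans (cong (_∪ ⁅ x ⁆) (-∪⁅⁆ (∈-⁺ S yS (xy ∘ sym)))) (-∪⁅⁆ xS)
      inj : ∀ S S′ → L ∋ S × x ∈ S × y ∈ S → L ∋ S′ × x ∈ S′ × y ∈ S′ → (S - x) - y ≡ (S′ - x) - y → S ≡ S′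
      inj S S′ (_ , xS , yS) (_ , xS′ , yS′) e = trans (sym (back xS yS)) (trans (cong (λ z → (z ∪ ⁅ y ⁆) ∪ ⁅ x ⁆) e) (back xS′ yS′))
    only-≤ : # onlyx? + # onlyy? ≤ conv (crossLevel (suc j)) v (suc j)
    only-≤ = ≤-trans (+-mono-≤ lx ly) (bound (trans ∣U∣ dim) link-unif link-unif (link-cross xy xU yU)
        (≤-trans (#-≥1 onlyx? S₂ (h₂ , x₂ , y₂)) lx) (≤-trans (#-≥1 onlyy? S₁ (h₁ , y₁ , x₁)) ly))
      where
      lx = only-≤-link {U} {x} {y} inU
      ly = only-≤-link {U} {y} {x} (λ a b c → inU a c b)

-- The bound for k = 4, 5, 6

-- The number of i-sets in the trace of 𝒢(n, k+2) on [2k+4].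
extremal : ℕ → ℕ → ℕ
extremal k i = if does (i ℕ.≟ 2 + k) then binom (suc k + (2 + k)) (suc k) else
  (binom (suc k + (2 + k)) (i ∸ 1) + binom k (i ∸ 1)) ∸ ((b + b) + b)
  where
  b : ℕ
  b = binom (suc k) (i ∸ 1)

MainBound : ℕ → Set
MainBound k = ∀ {n v} {V : Subset n} {p} → ∣ V ∣ ≡ ((2 + k) + (2 + k)) + v → Good V (2 + k) p → ∥ p ∥ ≤ conv (extremal k) v (2 + k)

NoCovBound : ℕ → ℕ → Set
NoCovBound k i = ∀ {n} {Y : Subset n} {L} → ∣ Y ∣ ≡ (2 + k) + (2 + k) → Good Y i L → ∥ L ∥ ≤ extremal k i

TwoCovBound : ℕ → ℕ → Set
TwoCovBound k i = ∀ {n} {V Y : Subset n} {L fam x y} → ∣ Y ∣ ≡ (2 + k) + (2 + k) → Unif Y i L → Cross L L → Good V (2 + k) fam →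
  (∀ {S Z} → L ∋ S → fam ∋ Z → Meets S Z) → Cov₂ L x y → (∃ λ S → L ∋ S × x ∉ S) → (∃ λ S → L ∋ S × y ∉ S) → ∥ L ∥ ≤ extremal k i

module _ (k : ℕ) {n v : ℕ} {V : Subset n} (4≤ : 4 ≤ 2 + k) (∣V∣ : ∣ V ∣ ≡ ((2 + k) + (2 + k)) + v)
  (middle : binom ((2 + k) + (2 + k)) (2 + k) ≡ extremal k (2 + k) + extremal k (2 + k))
  (lower : ∀ i → 3 ≤ i → i < 2 + k → NoCovBound k i × TwoCovBound k i) where

  private
    2K≤ : (2 + k) + (2 + k) ≤ ∣ V ∣
    2K≤ = ≤-trans (m≤m+n _ v) (≤-reflexive (sym ∣V∣))

  open Stages V (2 + k) 4≤ 2K≤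
  open Reduction V (2 + k) 4≤ 2K≤

  private
   module FromCore {p : Fam n} (res : CoreRes p) where
    open CoreRes res

    L : ℕ → Fam n
    L = level fam Y

    -- A trace on the core is itself a cover of the family, so it has at least three points.
    small : ∀ i → i ≤ 2 → ∥ L i ∥ ≡ 0
    small i i≤2 = #-∅ (L i ∋?_) λ S h →
      let (X , pX , e) , c = level⁻ fam Y h
          x , xX , _ , xY = isCore pX pX
          xS = subst (x ∈_) e (x∈p∩q⁺ (xX , xY))
      in contra S h x xS (≤-trans (≤-reflexive c) i≤2)
      where
      contra : ∀ S → L i ∋ S → ∀ x → x ∈ S → ∣ S ∣ ≤ 2 → ∅
      contra S h x xS le with any? (λ y → y ∈? (S - x))
      ... | no none = let Z , fZ , a , _ = Good.nocov good x x
                          z , zS , zZ = level-meets isCore h fZ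
                      in none (z , ∈-⁺ S zS (∈∉⇒≢ zZ a))
      ... | yes (y , y∈) = let Z , fZ , a , b = Good.nocov good x y
                               z , zS , zZ = level-meets isCore h fZ
                               z∈ = ∈-⁺ (S - x) (∈-⁺ S zS (∈∉⇒≢ zZ a)) (∈∉⇒≢ zZ b)
                           in <⇒≱ (s≤s (s≤s (s≤s z≤n))) (≤-trans (three y y∈ z z∈) le)
        where
        three : ∀ y → y ∈ S - x → ∀ z → z ∈ (S - x) - y → 3 ≤ ∣ S ∣
        three y y∈ z z∈ = subst (3 ≤_) (∣-∣-∈ S xS) (s≤s (subst (2 ≤_) (∣-∣-∈ (S - x) y∈) (s≤s (subst (1 ≤_) (∣-∣-∈ ((S - x) - y) z∈) (s≤s z≤n)))))

    star-bound : ∀ i → 2 ≤ i → i < 2 + k → ∀ x → (∀ {S} → L i ∋ S → x ∈ S) → ∥ L i ∥ ≤ extremal k i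
    star-bound (suc zero) (s≤s ())
    star-bound (suc (suc i)) _ i< x st with ∥ L (2 + i) ∥ ℕ.≟ 0
    ... | yes e = ≤-trans (≤-reflexive e) z≤n
    ... | no ne = ≤-trans (m+n≤o⇒m≤o∸n ∥ L (2 + i) ∥ (Levels.star-≤ good ∣Y∣ isCore (level-unif fam Y) (level-meets isCore) x∈Y st)) (≤-reflexive (sym eq))
      where
      x∈Y : x ∈ Y
      x∈Y = let S , h = #-∃ (L (2 + i) ∋?_) (n≢0⇒n>0 ne) in proj₁ (level-unif fam Y h) (st h)
      eq : extremal k (2 + i) ≡ (binom (suc k + (2 + k)) (suc i) + binom k (suc i)) ∸ ((binom (suc k) (suc i) + binom (suc k) (suc i)) + binom (suc k) (suc i))
      eq rewrite dec-false ((2 + i) ℕ.≟ (2 + k)) (<⇒≢ i<) = refl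

    missing : ∀ i x → (∀ {S} → L i ∋ S → x ∈ S) ⊎ (∃ λ S → L i ∋ S × x ∉ S)
    missing i x with anySubset? (λ S → (L i ∋? S) ×-dec ¬? (x ∈? S))
    ... | yes h = inj₂ h
    ... | no h = inj₁ (λ {S} hS → case x ∈? S of λ { (yes a) → a ; (no a) → ⊥-elim (h (S , hS , a)) })

    middle-bound : ∥ L (2 + k) ∥ ≤ extremal k (2 + k)
    middle-bound with ∥ L (2 + k) ∥ ≤? extremal k (2 + k)
    ... | yes h = h
    ... | no h = ⊥-elim (<⇒≱ (+-mono-< (≰⇒> h) (≰⇒> h)) (≤-trans (complement-≤ {t = 2 + k} ∣Y∣ (level-unif fam Y) (level-unif fam Y) (level-cross isCore)) (≤-reflexive middle)))

    lower-bound : ∀ i → 3 ≤ i → i < 2 + k → ∥ L i ∥ ≤ extremal k i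
    lower-bound i 3≤i i< with noCov? (L i)
    ... | yes nc = proj₁ (lower i 3≤i i<) ∣Y∣ (record { unif = level-unif fam Y ; int = level-cross isCore ; nocov = nc })
    ... | no ¬nc with ¬noCov (L i) ¬nc
    ...   | x , y , cov with missing i x | missing i y
    ...     | inj₁ sx | _ = star-bound i (≤-trans (n≤1+n 2) 3≤i) i< x sx
    ...     | inj₂ _ | inj₁ sy = star-bound i (≤-trans (n≤1+n 2) 3≤i) i< y sy
    ...     | inj₂ mx | inj₂ my = proj₂ (lower i 3≤i i<) ∣Y∣ (level-unif fam Y) (level-cross isCore) good (level-meets isCore) cov mx my

    bound : ∀ i → i ≤ 2 + k → ∥ L i ∥ ≤ extremal k i
    bound i i≤ with i ≤? 2 | i ℕ.≟ 2 + k
    ... | yes h | _ = ≤-trans (≤-reflexive (small i h)) z≤n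
    ... | no _ | yes refl = middle-bound
    ... | no h | no ne = lower-bound i (≰⇒> h) (≤∧≢⇒< i≤ ne)

    ∣V─Y∣ : ∣ V ─ Y ∣ ≡ v
    ∣V─Y∣ = +-cancelʳ-≡ ((2 + k) + (2 + k)) ∣ V ─ Y ∣ v (trans (cong (∣ V ─ Y ∣ +_) (sym ∣Y∣)) (trans (∣─∣-⊆ V Y Y⊆V) (trans ∣V∣ (+-comm ((2 + k) + (2 + k)) v))))

    result : ∥ p ∥ ≤ conv (extremal k) v (2 + k)
    result = begin
      ∥ p ∥  ≤⟨ size-≤ ⟩
      ∥ fam ∥  ≤⟨ ∥∥≤levels fam Y (Good.unif good) Y⊆V ⟩
      conv (λ i → ∥ L i ∥) (∣ V ─ Y ∣) (2 + k)  ≡⟨ cong (λ z → conv (λ i → ∥ L i ∥) z (2 + k)) ∣V─Y∣ ⟩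
      conv (λ i → ∥ L i ∥) v (2 + k)  ≤⟨ conv-mono v (2 + k) bound ⟩
      conv (extremal k) v (2 + k)  ∎
      where open ≤-Reasoning

  mainStep : ∀ {p} → Good V (2 + k) p → ∥ p ∥ ≤ conv (extremal k) v (2 + k)
  mainStep g = FromCore.result (toCore g)

viaCross : ∀ k j v → CrossBound (suc j) → k + (2 + k) ≡ (suc j + suc j) + v →
  (binom (k + (2 + k)) j + conv (crossLevel (suc j)) v (suc j)) ∸ binom k j ≤ extremal k (2 + j) → TwoCovBound k (2 + j)
viaCross k j v cb dim le {L = L} {x = x} {y} ∣Y∣ uL int good hits cov mx my =
  let R , fR , xR , yR = Good.nocov good x y
  in ≤-trans (m+n≤o⇒m≤o∸n ∥ L ∥ (twoCover-≤ ∣Y∣ uL int cb dim cov mx my (proj₂ (Good.unif good fR)) xR yR (λ hS → hits hS fR))) le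

triples-≤ : ∀ k → 13 ≤ extremal k 3 → NoCovBound k 3
triples-≤ k le ∣Y∣ g = ≤-trans (Triples.noCov₃-≤ (Good.unif g) (Good.int g) (Good.nocov g)) le

main₄ : MainBound 2
main₄ e = mainStep 2 (s≤s (s≤s (s≤s (s≤s z≤n)))) e refl λ
  { 0 () _ ; 1 (s≤s ()) _ ; 2 (s≤s (s≤s ())) _
  -- Every trace meets a four-element member avoiding `u` and `w`, so at most four triples pass
  -- through both: this is the codegree bound 4.
  ; 3 _ _ → triples-≤ 2 ≤-refl , λ ∣Y∣ uL int good hits cov mx my → Triples.cov₂-≤ uL int
      (λ {u} {w} uw → let R , fR , uR , wR = Good.nocov good u w in Triples.codeg-≤ uL int uw (proj₂ (Good.unif good fR)) uR wR (λ hS → hits hS fR)) cov mx my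
  ; (suc (suc (suc (suc i)))) _ (s≤s (s≤s (s≤s (s≤s ())))) }

main₅ : MainBound 3
main₅ e = mainStep 3 (s≤s (s≤s (s≤s (s≤s z≤n)))) e refl λ
  { 0 () _ ; 1 (s≤s ()) _ ; 2 (s≤s (s≤s ())) _
  -- The literals are the evaluated sides of the inequalities; 21 and 73 are `extremal 3 3` and
  -- `extremal 3 4`.
  ; 3 _ _ → triples-≤ 3 (toWitness {a? = 13 ≤? 21} tt) , viaCross 3 1 4 cross₂ refl (toWitness {a? = 19 ≤? 21} tt)
  -- Four-element traces with covering number three form a family on the 10 points of the core, that
  -- is, two points beyond 8.
  ; 4 _ _ → (λ ∣Y∣ g → ≤-trans (main₄ {v = 2} ∣Y∣ g) (toWitness {a? = 61 ≤? 73} tt)) , viaCross 3 2 2 cross₃ refl (toWitness {a? = 72 ≤? 73} tt)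
  ; (suc (suc (suc (suc (suc i))))) _ (s≤s (s≤s (s≤s (s≤s (s≤s ()))))) }

main₆ : MainBound 4
main₆ e = mainStep 4 (s≤s (s≤s (s≤s (s≤s z≤n)))) e refl λ
  { 0 () _ ; 1 (s≤s ()) _ ; 2 (s≤s (s≤s ())) _
  -- Here 31, 139 and 316 are the values of `extremal 4` at 3, 4 and 5, and the core has 12 points.
  ; 3 _ _ → triples-≤ 4 (toWitness {a? = 13 ≤? 31} tt) , viaCross 4 1 6 cross₂ refl (toWitness {a? = 24 ≤? 31} tt)
  ; 4 _ _ → (λ ∣Y∣ g → ≤-trans (main₄ {v = 4} ∣Y∣ g) (toWitness {a? = 87 ≤? 139} tt)) , viaCross 4 2 4 cross₃ refl (toWitness {a? = 125 ≤? 139} tt)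
  ; 5 _ _ → (λ ∣Y∣ g → ≤-trans (main₅ {v = 2} ∣Y∣ g) (toWitness {a? = 293 ≤? 316} tt)) , viaCross 4 3 2 cross₄ refl (toWitness {a? = 312 ≤? 316} tt)
  ; (suc (suc (suc (suc (suc (suc i)))))) _ (s≤s (s≤s (s≤s (s≤s (s≤s (s≤s ())))))) }

-- Lists of sets and families

module _ {n : ℕ} where
  open DecMembership (_≟ₛ_ {n}) using () renaming (_∈?_ to _∈ₗ?_)

  toFam : List (Subset n) → Fam n
  toFam ℱ = ⟦ _∈ₗ? ℱ ⟧

  toFam⁻ : ∀ ℱ {X} → toFam ℱ ∋ X → X ∈ₗ ℱ
  toFam⁻ ℱ = ⟦⟧⁻ (_∈ₗ? ℱ)

  toFam⁺ : ∀ {ℱ X} → X ∈ₗ ℱ → toFam ℱ ∋ X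
  toFam⁺ {ℱ} = ⟦⟧⁺ (_∈ₗ? ℱ)

  length≤# : ∀ {ℱ} → Unique ℱ → length ℱ ≤ # (_∈ₗ? ℱ)
  length≤# {[]} _ = z≤n
  length≤# {F ∷ ℱ} (ne ∷ u) = ≤-trans (+-mono-≤ (≤-reflexive (sym (#-≡ F))) (length≤# u))
    (#-⊎ (_≟ₛ F) (_∈ₗ? ℱ) (_∈ₗ? (F ∷ ℱ)) (λ _ → here) (λ _ → there) (λ { X refl h → All.lookup ne h refl }))

  admissible⇒good : ∀ {k ℱ} → Admissible n k 3 ℱ → Good ⊤ k (toFam ℱ) × length ℱ ≤ ∥ toFam ℱ ∥
  admissible⇒good {k} {ℱ} (u , sizes , int , cov) = record
    { unif = λ h → (λ _ → ∈⊤) , All.lookup sizes (toFam⁻ ℱ h)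
    ; int = λ {X} {Z} h h′ → let x , x∈ = int (toFam⁻ ℱ h) (toFam⁻ ℱ h′) in x , x∈p∩q⁻ X Z x∈
    ; nocov = nc } , ≤-trans (length≤# u) (∥⟦⟧∥ (_∈ₗ? ℱ))
    where
    nc : NoCov (toFam ℱ)
    nc x y with anySubset? (λ X → (toFam ℱ ∋? X) ×-dec ¬? (x ∈? X) ×-dec ¬? (y ∈? X))
    ... | yes h = h
    ... | no h = ⊥-elim (cov (pts (x ∷ y ∷ [])) (s≤s (∣pts∣≤ (x ∷ y ∷ []))) hit)
      where
      hit : IsCover (pts (x ∷ y ∷ [])) ℱ
      hit {F} F∈ with x ∈? F | y ∈? F
      ... | yes a | _ = x , x∈p∩q⁺ (∈-pts⁺ at₀ , a)
      ... | no _ | yes b = y , x∈p∩q⁺ (∈-pts⁺ at₁ , b)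
      ... | no a | no b = ⊥-elim (h (F , toFam⁺ F∈ , a , b))

∈-allSubsets : (X : Subset n) → X ∈ₗ allSubsets n
∈-allSubsets [] = here refl
∈-allSubsets (true ∷ X) = ∈-++⁺ˡ (∈-map⁺ (true ∷_) (∈-allSubsets X))
∈-allSubsets {suc n} (false ∷ X) = ∈-++⁺ʳ (map (true ∷_) (allSubsets n)) (∈-map⁺ (false ∷_) (∈-allSubsets X))

allSubsets-unique : ∀ n → Unique (allSubsets n)
allSubsets-unique zero = [] ∷ []
allSubsets-unique (suc n) = Uniqueₚ.++⁺ (Uniqueₚ.map⁺ (λ { refl → refl }) (allSubsets-unique n)) (Uniqueₚ.map⁺ (λ { refl → refl }) (allSubsets-unique n))
  (λ { (h , h′) → case ∈-map⁻ (true ∷_) h of λ { (_ , _ , refl) → case ∈-map⁻ (false ∷_) h′ of λ { (_ , _ , ()) } } })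

length-filter-map : {A B : Set} {P : B → Set} (P? : Decidable P) (f : A → B) (xs : List A) →
  length (filter P? (map f xs)) ≡ length (filter (P? ∘ f) xs)
length-filter-map P? f [] = refl
length-filter-map P? f (x ∷ xs) with does (P? (f x))
... | true = cong suc (length-filter-map P? f xs)
... | false = length-filter-map P? f xs

length-filter-allSubsets : ∀ n {P : Subset n → Set} (P? : Decidable P) → length (filter P? (allSubsets n)) ≡ sumS (λ X → ind (P? X))
length-filter-allSubsets zero P? with does (P? [])
... | true = refl
... | false = refl
length-filter-allSubsets (suc n) P? = begin
  length (filter P? (map (true ∷_) A ++ map (false ∷_) A))  ≡⟨ cong length (filter-++ P? (map (true ∷_) A) _) ⟩
  length (filter P? (map (true ∷_) A) ++ filter P? (map (false ∷_) A))  ≡⟨ length-++ (filter P? (map (true ∷_) A)) ⟩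
  length (filter P? (map (true ∷_) A)) + length (filter P? (map (false ∷_) A))  ≡⟨ cong₂ _+_ (length-filter-map P? (true ∷_) A) (length-filter-map P? (false ∷_) A) ⟩
  length (filter (P? ∘ (true ∷_)) A) + length (filter (P? ∘ (false ∷_)) A)  ≡⟨ cong₂ _+_ (length-filter-allSubsets n (P? ∘ (true ∷_))) (length-filter-allSubsets n (P? ∘ (false ∷_))) ⟩
  sumS (λ X → ind (P? X))  ∎
  where
  open ≡-Reasoning
  A = allSubsets n

-- Counting a family that depends on the first a points only

take : ∀ a {v} → Subset (a + v) → Subset a
take zero X = []
take (suc a) (x ∷ X) = x ∷ take a X

prefix : ∀ {a} → (Subset a → Bool) → ℕ → ℕ
prefix Q i = sumS (λ S → ind ((Q S Boolₚ.≟ true) ×-dec (∣ S ∣ ℕ.≟ i)))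

ind-cong : {P Q : Set} (d : Dec P) (e : Dec Q) → (P → Q) → (Q → P) → ind d ≡ ind e
ind-cong d e f g = ≤-antisym (ind-mono d e f) (ind-mono e d g)

conv-0 : ∀ v k → conv (λ _ → 0) v k ≡ 0
conv-0 zero k = refl
conv-0 (suc v) zero = refl
conv-0 (suc v) (suc k) = cong₂ _+_ (conv-0 v (suc k)) (conv-0 v k)

sumS-prefix : ∀ a v k (Q : Subset a → Bool) →
  sumS {a + v} (λ X → ind ((Q (take a X) Boolₚ.≟ true) ×-dec (∣ X ∣ ℕ.≟ k))) ≡ conv (prefix Q) v k
sumS-prefix zero v k Q with Q []
... | true = trans (sumS-cong {v} λ X → ind-cong ((true Boolₚ.≟ true) ×-dec (∣ X ∣ ℕ.≟ k)) (ksub? ⊤ k X) (λ { (_ , c) → ⊆⊤ , c }) (λ { (_ , c) → refl , c }))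
      (trans (sym (#-sumS {v} (ksub? ⊤ k))) (trans (#-ksub {v} ⊤ k) (trans (cong (λ z → binom z k) (∣⊤∣≡n v))
        (trans (sym (conv-δ v k)) (conv-cong v k λ i _ → ind-cong (i ℕ.≟ 0) ((true Boolₚ.≟ true) ×-dec (0 ℕ.≟ i)) (λ { refl → refl , refl }) (λ { (_ , refl) → refl }))))))
... | false = trans (sumS-cong {v} λ X → ind-no ((false Boolₚ.≟ true) ×-dec (∣ X ∣ ℕ.≟ k)) λ { (() , _) }) (trans (sumS-0 {v}) (trans (sym (conv-0 v k))
      (conv-cong v k λ i _ → sym (ind-no ((false Boolₚ.≟ true) ×-dec (0 ℕ.≟ i)) λ { (() , _) }))))
sumS-prefix (suc a) v k Q = trans (cong₂ _+_ (inn k) (sumS-prefix a v k (Q ∘ (false ∷_)))) (step k)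
  where
  H F : ℕ → ℕ
  H = prefix (Q ∘ (true ∷_))
  F = prefix (Q ∘ (false ∷_))
  G : ℕ → ℕ
  G zero = 0
  G (suc k) = conv H v k
  inn : ∀ k → sumS {a + v} (λ X → ind ((Q (true ∷ take a X) Boolₚ.≟ true) ×-dec (suc ∣ X ∣ ℕ.≟ k))) ≡ G k
  inn zero = trans (sumS-cong {a + v} λ X → ind-no ((Q (true ∷ take a X) Boolₚ.≟ true) ×-dec (suc ∣ X ∣ ℕ.≟ 0)) λ { (_ , ()) }) (sumS-0 {a + v})
  inn (suc k) = trans (sumS-cong {a + v} λ X → ind-cong ((Q (true ∷ take a X) Boolₚ.≟ true) ×-dec (suc ∣ X ∣ ℕ.≟ suc k)) ((Q (true ∷ take a X) Boolₚ.≟ true) ×-dec (∣ X ∣ ℕ.≟ k))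
    (λ { (h , e) → h , suc-injective e }) (λ { (h , e) → h , cong suc e })) (sumS-prefix a v k (Q ∘ (true ∷_)))
  P₀ : prefix Q 0 ≡ F 0
  P₀ = cong (_+ F 0) (trans (sumS-cong λ S → ind-no ((Q (true ∷ S) Boolₚ.≟ true) ×-dec (suc ∣ S ∣ ℕ.≟ 0)) λ { (_ , ()) }) (sumS-0 {a}))
  Pₛ : ∀ i → prefix Q (suc i) ≡ H i + F (suc i)
  Pₛ i = cong (_+ F (suc i)) (sumS-cong λ S → ind-cong ((Q (true ∷ S) Boolₚ.≟ true) ×-dec (suc ∣ S ∣ ℕ.≟ suc i)) ((Q (true ∷ S) Boolₚ.≟ true) ×-dec (∣ S ∣ ℕ.≟ i))
    (λ { (h , e) → h , suc-injective e }) (λ { (h , e) → h , cong suc e }))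
  step : ∀ k → G k + conv F v k ≡ conv (prefix Q) v k
  step zero = trans (conv-zero F v) (trans (sym P₀) (sym (conv-zero (prefix Q) v)))
  step (suc k) = sym (conv-cons (prefix Q) H F v k P₀ Pₛ)

conv-top : ∀ f v k → (∀ i → i < k → f i ≡ 0) → conv f v k ≡ f k
conv-top f zero k h = refl
conv-top f (suc v) zero h = refl
conv-top f (suc v) (suc k) h = trans (cong₂ _+_ (conv-top f v (suc k) h) (trans (conv-top f v k (λ i l → h i (m<n⇒m<1+n l))) (h k ≤-refl))) (+-identityʳ _)

conv-binom : ∀ a v k → conv (binom a) v k ≡ binom (a + v) k
conv-binom a zero k = cong (λ z → binom z k) (sym (+-identityʳ a))
conv-binom a (suc v) zero = refl
conv-binom a (suc v) (suc k) = trans (cong₂ _+_ (conv-binom a v (suc k)) (conv-binom a v k)) (cong (λ z → binom z (suc k)) (sym (+-suc a v)))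

binom≡C : ∀ n k → binom n k ≡ n C k
binom≡C n zero = sym (trans (nCk≡nC[n∸k] {n = n} z≤n) (nCn≡1 n))
binom≡C zero (suc k) = sym (k>n⇒nCk≡0 {0} {suc k} (s≤s z≤n))
binom≡C (suc n) (suc k) = trans (cong₂ _+_ (binom≡C n (suc k)) (binom≡C n k)) (trans (+-comm (n C suc k) _) (nCk+nC[k+1]≡[n+1]C[k+1] n k))

-- Predicates on [n]

∈-fromPred⁺ : ∀ {p} {x : Fin n} → p (suc (toℕ x)) ≡ true → x ∈ fromPred n p
∈-fromPred⁺ {p = p} {x} h = lookup⇒[]= x (fromPred _ p) (trans (lookup∘tabulate _ x) h)

∈-fromPred⁻ : ∀ {p} {x : Fin n} → x ∈ fromPred n p → p (suc (toℕ x)) ≡ true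
∈-fromPred⁻ {p = p} {x} h = trans (sym (lookup∘tabulate _ x)) ([]=⇒lookup h)

-- A Boolean form of meeting `fromPred n p` that recurses with the vector, so it can be evaluated on
-- the first `2k` points alone.
meetᵇ : ∀ {n} → (ℕ → Bool) → Subset n → Bool
meetᵇ p [] = false
meetᵇ p (x ∷ X) = (x ∧ p 1) ∨ meetᵇ (p ∘ suc) X

meetᵇ⁻ : ∀ p (X : Subset n) → meetᵇ p X ≡ true → Nonempty (X ∩ fromPred n p)
meetᵇ⁻ p (x ∷ X) h with x ∧ p 1
... | true = zero , here
... | false = let y , y∈ = meetᵇ⁻ (p ∘ suc) X h in suc y , there y∈

meetᵇ⁺ : ∀ p (X : Subset n) → Nonempty (X ∩ fromPred n p) → meetᵇ p X ≡ true
meetᵇ⁺ p (x ∷ X) (zero , h) with x ∧ p 1 | h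
... | true | here = refl
meetᵇ⁺ p (x ∷ X) (suc y , there h) = ∨-trueʳ {x ∧ p 1} (meetᵇ⁺ (p ∘ suc) X (y , h))

meetᵇ-take : ∀ a {v} p (X : Subset (a + v)) → (∀ i → p (suc (a + i)) ≡ false) → meetᵇ p (take a X) ≡ meetᵇ p X
meetᵇ-take zero p X h = sym (none p X h)
  where
  none : ∀ {n} p (X : Subset n) → (∀ i → p (suc i) ≡ false) → meetᵇ p X ≡ false
  none p [] h = refl
  none p (x ∷ X) h rewrite h 0 | Boolₚ.∧-zeroʳ x = none (p ∘ suc) X (λ i → h (suc i))
meetᵇ-take (suc a) p (x ∷ X) h = cong ((x ∧ p 1) ∨_) (meetᵇ-take a (p ∘ suc) X h)

∣fromPred∣ : ∀ a {v} p → (∀ i → p (suc (a + i)) ≡ false) → ∣ fromPred (a + v) p ∣ ≡ ∣ fromPred a p ∣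
∣fromPred∣ zero {v} p h = none {v} p h
  where
  none : ∀ {n} p → (∀ i → p (suc i) ≡ false) → ∣ fromPred n p ∣ ≡ 0
  none {zero} p h = refl
  none {suc n} p h rewrite h 0 = none {n} (p ∘ suc) (λ i → h (suc i))
∣fromPred∣ (suc a) {v} p h with p 1
... | true = cong suc (∣fromPred∣ a {v} (p ∘ suc) h)
... | false = ∣fromPred∣ a {v} (p ∘ suc) h

-- The family 𝒢

pred₁ pred₂ pred₃ predᶜ : ℕ → ℕ → Bool
pred₁ k = inRange 2 (k + 1)
pred₂ k i = (i ℕ.≡ᵇ 2) ∨ inRange (k + 2) (2 * k) i
pred₃ k i = (i ℕ.≡ᵇ 3) ∨ inRange (k + 2) (2 * k) i
predᶜ k = inRange (k + 2) (2 * k)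

inAᵇ : ∀ k {a} → Subset (suc a) → Bool
inAᵇ k S = lookup S zero ∧ (meetᵇ (pred₁ k) S ∧ (meetᵇ (pred₂ k) S ∧ meetᵇ (pred₃ k) S))

-- The three sets of ℬ lie within the first `2k` points, so they contribute traces of full size
-- only.
top : ℕ → ℕ → ℕ
top k i = if does (i ℕ.≟ k) then 3 else 0

-- Decided by computation for each k; here suc a = 2k, so that one N X reduces to zero ∈ X.
record Facts (k₂ a : ℕ) : Set where
  k : ℕ
  k = 2 + k₂
  field
    dim : suc a ≡ k + k
    4≤k : 4 ≤ k
    van₁ : ∀ i → pred₁ k (suc (suc a + i)) ≡ false
    van₂ : ∀ i → pred₂ k (suc (suc a + i)) ≡ false
    van₃ : ∀ i → pred₃ k (suc (suc a + i)) ≡ false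
    vanᶜ : ∀ i → predᶜ k (suc (suc a + i)) ≡ false
    size₁ : ∣ fromPred (suc a) (pred₁ k) ∣ ≡ k
    size₂ : ∣ fromPred (suc a) (pred₂ k) ∣ ≡ k
    size₃ : ∣ fromPred (suc a) (pred₃ k) ∣ ≡ k
    sizeᶜ : ∣ fromPred (suc a) (predᶜ k) ∣ ≡ suc k₂
    no₁ : pred₁ k 1 ≡ false
    no₂ : pred₂ k 1 ≡ false
    no₃ : pred₃ k 1 ≡ false
    ₁∋2 : pred₁ k 2 ≡ true
    ₁∋3 : pred₁ k 3 ≡ true
    ₂∌3 : pred₂ k 3 ≡ false
    ₃∌2 : pred₃ k 2 ≡ false
    last : predᶜ k (suc a) ≡ true
    empty : ∀ i → pred₁ k i ≡ true → pred₂ k i ≡ true → pred₃ k i ≡ true → ∅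
    counts : ∀ i → i ≤ k → prefix (inAᵇ k {a}) i + top k i ≡ extremal k₂ i

module Family {k₂ a : ℕ} (facts : Facts k₂ a) (v : ℕ) where
  open Facts facts

  N : ℕ
  N = suc a + v

  P₁ P₂ P₃ : Subset N
  P₁ = B₁ N k
  P₂ = B₂ N k
  P₃ = B₃ N k

  private
    inA⁺ : ∀ X → inAᵇ k (take (suc a) X) ≡ true × ∣ X ∣ ≡ k → InA N k X
    inA⁺ (x ∷ X) (h , c) =
      let h₀ , h′ = ∧-true⁻ {x} h
          h₁ , h″ = ∧-true⁻ {meetᵇ (pred₁ k) (take (suc a) (x ∷ X))} h′
          h₂ , h₃ = ∧-true⁻ {meetᵇ (pred₂ k) (take (suc a) (x ∷ X))} h″
      in lookup⇒[]= zero (x ∷ X) h₀ , c ,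
         meetᵇ⁻ (pred₁ k) (x ∷ X) (trans (sym (meetᵇ-take (suc a) (pred₁ k) (x ∷ X) van₁)) h₁) ,
         meetᵇ⁻ (pred₂ k) (x ∷ X) (trans (sym (meetᵇ-take (suc a) (pred₂ k) (x ∷ X) van₂)) h₂) ,
         meetᵇ⁻ (pred₃ k) (x ∷ X) (trans (sym (meetᵇ-take (suc a) (pred₃ k) (x ∷ X) van₃)) h₃)

    inA⁻ : ∀ X → InA N k X → inAᵇ k (take (suc a) X) ≡ true × ∣ X ∣ ≡ k
    inA⁻ (x ∷ X) (o , c , m₁ , m₂ , m₃) = cong₂ _∧_ ([]=⇒lookup o) (cong₂ _∧_
      (trans (meetᵇ-take (suc a) (pred₁ k) (x ∷ X) van₁) (meetᵇ⁺ (pred₁ k) (x ∷ X) m₁)) (cong₂ _∧_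
      (trans (meetᵇ-take (suc a) (pred₂ k) (x ∷ X) van₂) (meetᵇ⁺ (pred₂ k) (x ∷ X) m₂))
      (trans (meetᵇ-take (suc a) (pred₃ k) (x ∷ X) van₃) (meetᵇ⁺ (pred₃ k) (x ∷ X) m₃)))) , c

  length-𝒢 : length (𝒢 N k) ≡ conv (extremal k₂) v k
  length-𝒢 = begin
    length (𝒢 N k)  ≡⟨ length-++ (filter (InA? N k) (allSubsets N)) ⟩
    length (filter (InA? N k) (allSubsets N)) + 3  ≡⟨ cong (_+ 3) (length-filter-allSubsets N (InA? N k)) ⟩
    sumS (λ X → ind (InA? N k X)) + 3  ≡⟨ cong (_+ 3) (sumS-cong {N} (λ X → ind-cong (InA? N k X)
                                                                          ((inAᵇ k (take (suc a) X) Boolₚ.≟ true) ×-dec (∣ X ∣ ℕ.≟ k)) (inA⁻ X) (inA⁺ X))) ⟩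
    sumS {N} (λ X → ind ((inAᵇ k (take (suc a) X) Boolₚ.≟ true) ×-dec (∣ X ∣ ℕ.≟ k))) + 3  ≡⟨ cong₂ _+_ (sumS-prefix (suc a) v k (inAᵇ k)) (sym top-conv) ⟩
    conv (prefix {suc a} (inAᵇ k)) v k + conv (top k) v k  ≡⟨ sym (conv-+ (prefix {suc a} (inAᵇ k)) (top k) v k) ⟩
    conv (λ i → prefix {suc a} (inAᵇ k) i + top k i) v k  ≡⟨ conv-cong v k counts ⟩
    conv (extremal k₂) v k  ∎
    where
    open ≡-Reasoning
    top-conv : conv (top k) v k ≡ 3
    top-conv = trans (conv-top (top k) v k lem) (cong (λ b → if b then 3 else 0) (dec-true (k ℕ.≟ k) refl))
      where
      lem : ∀ i → i < k → top k i ≡ 0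
      lem i l = cong (λ b → if b then 3 else 0) (dec-false (i ℕ.≟ k) (<⇒≢ l))

  private
    pt : ∀ i → i < N → Fin N
    pt i l = fromℕ< l

    pt-∈ : ∀ {p i} (l : i < N) → p (suc i) ≡ true → pt i l ∈ fromPred N p
    pt-∈ {p} {i} l h = ∈-fromPred⁺ {p = p} (trans (cong (p ∘ suc) (toℕ-fromℕ< l)) h)

    4≤N : 4 ≤ N
    4≤N = ≤-trans 4≤k (≤-trans (m≤m+n k k) (≤-trans (≤-reflexive (sym dim)) (m≤m+n (suc a) v)))

    2k≤N : k + k ≤ N
    2k≤N = ≤-trans (≤-reflexive (sym dim)) (m≤m+n (suc a) v)

    l1 : 1 < N
    l1 = ≤-trans (s≤s (s≤s z≤n)) 4≤N
    l2 : 2 < N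
    l2 = ≤-trans (s≤s (s≤s (s≤s z≤n))) 4≤N
    la : a < N
    la = m≤m+n (suc a) v

    ᶜ⊆₂ : ∀ {i} → predᶜ k i ≡ true → pred₂ k i ≡ true
    ᶜ⊆₂ {i} = ∨-trueʳ {i ℕ.≡ᵇ 2}
    ᶜ⊆₃ : ∀ {i} → predᶜ k i ≡ true → pred₃ k i ≡ true
    ᶜ⊆₃ {i} = ∨-trueʳ {i ℕ.≡ᵇ 3}

    ∉-by : ∀ {p} {x : Fin N} → p (suc (toℕ x)) ≡ false → x ∉ fromPred N p
    ∉-by {p} h h′ = case trans (sym h) (∈-fromPred⁻ {p = p} h′) of λ ()

    0∉₁ : zero ∉ P₁
    0∉₁ = ∉-by {pred₁ k} no₁
    0∉₂ : zero ∉ P₂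
    0∉₂ = ∉-by {pred₂ k} no₂
    0∉₃ : zero ∉ P₃
    0∉₃ = ∉-by {pred₃ k} no₃

    2∈₁ : pt 1 l1 ∈ P₁
    2∈₁ = pt-∈ {pred₁ k} l1 ₁∋2
    2∈₂ : pt 1 l1 ∈ P₂
    2∈₂ = pt-∈ {pred₂ k} l1 refl
    3∈₁ : pt 2 l2 ∈ P₁
    3∈₁ = pt-∈ {pred₁ k} l2 ₁∋3
    3∈₃ : pt 2 l2 ∈ P₃
    3∈₃ = pt-∈ {pred₃ k} l2 refl
    3∉₂ : pt 2 l2 ∉ P₂
    3∉₂ = ∉-by {pred₂ k} (trans (cong (pred₂ k ∘ suc) (toℕ-fromℕ< l2)) ₂∌3)
    2∉₃ : pt 1 l1 ∉ P₃
    2∉₃ = ∉-by {pred₃ k} (trans (cong (pred₃ k ∘ suc) (toℕ-fromℕ< l1)) ₃∌2)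
    a∈₂ : pt a la ∈ P₂
    a∈₂ = pt-∈ {pred₂ k} la (ᶜ⊆₂ {suc a} last)
    a∈₃ : pt a la ∈ P₃
    a∈₃ = pt-∈ {pred₃ k} la (ᶜ⊆₃ {suc a} last)

    ₁₂ : Nonempty (P₁ ∩ P₂)
    ₁₂ = pt 1 l1 , x∈p∩q⁺ (2∈₁ , 2∈₂)
    ₁₃ : Nonempty (P₁ ∩ P₃)
    ₁₃ = pt 2 l2 , x∈p∩q⁺ (3∈₁ , 3∈₃)
    ₂₃ : Nonempty (P₂ ∩ P₃)
    ₂₃ = pt a la , x∈p∩q⁺ (a∈₂ , a∈₃)
    self : ∀ {X : Subset N} {x} → x ∈ X → Nonempty (X ∩ X)
    self h = _ , x∈p∩q⁺ (h , h)
    sy : ∀ {X Z : Subset N} → Nonempty (X ∩ Z) → Nonempty (Z ∩ X)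
    sy {X} {Z} (x , h) = let a , b = x∈p∩q⁻ X Z h in x , x∈p∩q⁺ (b , a)

    ℬ : List (Subset N)
    ℬ = P₁ ∷ P₂ ∷ P₃ ∷ []

    𝒜 : List (Subset N)
    𝒜 = filter (InA? N k) (allSubsets N)

    𝒢⁻ : ∀ {X} → X ∈ₗ 𝒢 N k → InA N k X ⊎ X ∈ₗ ℬ
    𝒢⁻ h = [ (λ u → inj₁ (proj₂ (∈-filter⁻ (InA? N k) {xs = allSubsets N} u))) , inj₂ ]′ (∈-++⁻ 𝒜 h)

    unique : Unique (𝒢 N k)
    unique = Uniqueₚ.++⁺ (Uniqueₚ.filter⁺ (InA? N k) (allSubsets-unique N))
      (((λ e → 3∉₂ (subst (pt 2 l2 ∈_) e 3∈₁)) ∷ (λ e → 2∉₃ (subst (pt 1 l1 ∈_) e 2∈₁)) ∷ []) ∷ ((λ e → 2∉₃ (subst (pt 1 l1 ∈_) e 2∈₂)) ∷ []) ∷ [] ∷ [])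
      (λ { (h , h′) → no-1 h′ (proj₁ (proj₂ (∈-filter⁻ (InA? N k) {xs = allSubsets N} h))) })
      where
      no-1 : ∀ {X} → X ∈ₗ ℬ → zero ∉ X
      no-1 at₀ = 0∉₁
      no-1 at₁ = 0∉₂
      no-1 at₂ = 0∉₃

    ∣P₁∣ : ∣ P₁ ∣ ≡ k
    ∣P₁∣ = trans (∣fromPred∣ (suc a) {v} (pred₁ k) van₁) size₁
    ∣P₂∣ : ∣ P₂ ∣ ≡ k
    ∣P₂∣ = trans (∣fromPred∣ (suc a) {v} (pred₂ k) van₂) size₂
    ∣P₃∣ : ∣ P₃ ∣ ≡ k
    ∣P₃∣ = trans (∣fromPred∣ (suc a) {v} (pred₃ k) van₃) size₃

    sizes : All (λ F → ∣ F ∣ ≡ k) (𝒢 N k)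
    sizes = All.tabulate λ h → go (𝒢⁻ h)
      where
      go : ∀ {X} → InA N k X ⊎ X ∈ₗ ℬ → ∣ X ∣ ≡ k
      go (inj₁ (_ , c , _)) = c
      go (inj₂ at₀) = ∣P₁∣
      go (inj₂ at₁) = ∣P₂∣
      go (inj₂ at₂) = ∣P₃∣

    hitB : ∀ {X Z} → InA N k X → Z ∈ₗ ℬ → Nonempty (X ∩ Z)
    hitB (_ , _ , m₁ , m₂ , m₃) at₀ = m₁
    hitB (_ , _ , m₁ , m₂ , m₃) at₁ = m₂
    hitB (_ , _ , m₁ , m₂ , m₃) at₂ = m₃

    BB : ∀ {X Z} → X ∈ₗ ℬ → Z ∈ₗ ℬ → Nonempty (X ∩ Z)
    BB at₀ at₀ = self 2∈₁
    BB at₀ at₁ = ₁₂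
    BB at₀ at₂ = ₁₃
    BB at₁ at₀ = sy {P₁} {P₂} ₁₂
    BB at₁ at₁ = self 2∈₂
    BB at₁ at₂ = ₂₃
    BB at₂ at₀ = sy {P₁} {P₃} ₁₃
    BB at₂ at₁ = sy {P₂} {P₃} ₂₃
    BB at₂ at₂ = self 3∈₃

    intersecting : Intersecting (𝒢 N k)
    intersecting {F} {G} hF hG = go (𝒢⁻ hF) (𝒢⁻ hG)
      where
      go : ∀ {F G} → InA N k F ⊎ F ∈ₗ ℬ → InA N k G ⊎ G ∈ₗ ℬ → Nonempty (F ∩ G)
      go (inj₁ (o , _)) (inj₁ (o′ , _)) = zero , x∈p∩q⁺ (o , o′)
      go (inj₁ h) (inj₂ h′) = hitB h h′
      go {F} {G} (inj₂ h) (inj₁ h′) = sy {G} {F} (hitB h′ h)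
      go (inj₂ h) (inj₂ h′) = BB h h′

    ∈ℬ : ∀ {X} → X ∈ₗ ℬ → X ∈ₗ 𝒢 N k
    ∈ℬ = ∈-++⁺ʳ 𝒜

    -- If `T` contains 1, its one other point would have to lie in all three sets of ℬ. If not, 1
    -- with a point of `B₁` and a point of `[k+2, 2k]`, both outside `T`, extends to a member of 𝒜
    -- that avoids `T`; the second point serves `B₂` and `B₃` at once.
    cover : CoverNumberAtLeast 3 (𝒢 N k)
    cover T ∣T∣<3 cov with zero ∈? T
    ... | yes 0∈T = same (cov (∈ℬ at₀)) (cov (∈ℬ at₁)) (cov (∈ℬ at₂))
      where
      equal : ∀ {y z} → y ∈ T → z ∈ T → y ≢ zero → z ≢ zero → y ≡ z
      equal {y} {z} yT zT y0 z0 with y ≟ z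
      ... | yes e = e
      ... | no ne = ⊥-elim (<⇒≱ ∣T∣<3 (≤-trans (m≤m+n 3 _) (outside-≤ {X = T} {⊥} (zero ∷ y ∷ z ∷ [])
            ((y0 ∘ sym ∷ z0 ∘ sym ∷ []) ∷ (ne ∷ []) ∷ [] ∷ []) ((0∈T , ∉⊥) ∷ (yT , ∉⊥) ∷ (zT , ∉⊥) ∷ []))))
      same : Nonempty (T ∩ P₁) → Nonempty (T ∩ P₂) → Nonempty (T ∩ P₃) → ∅
      same (x , hx) (y , hy) (z , hz) =
        let xT , x₁ = x∈p∩q⁻ T P₁ hx
            yT , y₂ = x∈p∩q⁻ T P₂ hy
            zT , z₃ = x∈p∩q⁻ T P₃ hz
            x0 = ∈∉⇒≢ x₁ 0∉₁
        in empty (suc (toℕ x)) (∈-fromPred⁻ {p = pred₁ k} x₁)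
             (∈-fromPred⁻ {p = pred₂ k} (subst (_∈ P₂) (sym (equal xT yT x0 (∈∉⇒≢ y₂ 0∉₂))) y₂))
             (∈-fromPred⁻ {p = pred₃ k} (subst (_∈ P₃) (sym (equal xT zT x0 (∈∉⇒≢ z₃ 0∉₃))) z₃))
    ... | no 0∉T = avoiding (∣p∣<∣q∣⇒∃ T P₁ (≤-trans ∣T∣<3 (≤-trans (n≤1+n 3) (≤-trans 4≤k (≤-reflexive (sym ∣P₁∣))))))
                            (∣p∣<∣q∣⇒∃ T Pᶜ (≤-trans ∣T∣<3 (≤-trans (s≤s⁻¹ 4≤k) (≤-reflexive (sym (trans (∣fromPred∣ (suc a) {v} (predᶜ k) vanᶜ) sizeᶜ))))))
      where
      Pᶜ : Subset N
      Pᶜ = fromPred N (predᶜ k)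
      avoiding : (∃ λ w → w ∈ P₁ × w ∉ T) → (∃ λ z → z ∈ Pᶜ × z ∉ T) → ∅
      avoiding (w , w₁ , wT) (z , zᶜ , zT) with ∃-superset (pts (zero ∷ w ∷ z ∷ [])) (⊤ ─ T) k
        (pts-⊆ (x∈p∧x∉q⇒x∈p─q ∈⊤ 0∉T ∷ x∈p∧x∉q⇒x∈p─q ∈⊤ wT ∷ x∈p∧x∉q⇒x∈p─q ∈⊤ zT ∷ []))
        (≤-trans (∣pts∣≤ (zero ∷ w ∷ z ∷ [])) (≤-trans (n≤1+n 3) 4≤k))
        (+-cancelˡ-≤ k _ _ (≤-trans 2k≤N (≤-trans (≤-reflexive (sym (∣⊤∣≡n N))) (∣─∣≥ ⊤ T k (≤-trans (<⇒≤ ∣T∣<3) (≤-trans (n≤1+n 3) 4≤k))))))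
      ... | A , sub , A⊆ , ∣A∣ =
        let inA : InA N k A
            inA = sub (∈-pts⁺ at₀) , ∣A∣ ,
              (w , x∈p∩q⁺ (sub (∈-pts⁺ at₁) , w₁)) ,
              (z , x∈p∩q⁺ (zA , ∈-fromPred⁺ {p = pred₂ k} (ᶜ⊆₂ {suc (toℕ z)} (∈-fromPred⁻ {p = predᶜ k} zᶜ)))) ,
              (z , x∈p∩q⁺ (zA , ∈-fromPred⁺ {p = pred₃ k} (ᶜ⊆₃ {suc (toℕ z)} (∈-fromPred⁻ {p = predᶜ k} zᶜ))))
            x , hx = cov (∈-++⁺ˡ (∈-filter⁺ (InA? N k) (∈-allSubsets A) inA))
            xT , xA = x∈p∩q⁻ T A hx
        in proj₂ (∈─⁻ ⊤ T (A⊆ xA)) xT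
        where
        zA : z ∈ A
        zA = sub (∈-pts⁺ at₂)

  isM : MainBound k₂ → IsM N k 3 (length (𝒢 N k))
  isM main = (𝒢 N k , (unique , sizes , intersecting , cover) , refl) , λ ℱ adm →
    let good , len = admissible⇒good adm
    in ≤-trans len (≤-trans (main {v = v} (trans (∣⊤∣≡n N) (cong (_+ v) dim)) good) (≤-reflexive (sym length-𝒢)))

-- The closed formula

open import Data.Integer using (+_) renaming (_+_ to _+ℤ_; _-_ to _-ℤ_)
import Data.Integer.Solver as ℤ-Solver

-- The formula of the theorem, trace size by trace size, with terms moved so that no subtraction occurs.
Linear : ℕ → Set
Linear m = ∀ i → i ≤ 3 + m → extremal (suc m) i + (shift (binom (3 + m)) i + shift (binom (2 + m)) i) ≡
  shift (binom ((2 + m) + (3 + m))) i + (shift (binom 0) i + (shift (shift (shift (binom (suc m)))) i + top (3 + m) i))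

-- By Vandermonde's identity each binomial coefficient of the formula is the convolution of its own
-- trace counts on the core, so agreement for the finitely many trace sizes gives agreement for
-- every `v`.
formula-ℕ : ∀ m v → Linear m → conv (extremal (suc m)) v (3 + m) + (binom ((3 + m) + v) (2 + m) + binom ((2 + m) + v) (2 + m)) ≡
  binom (((2 + m) + (3 + m)) + v) (2 + m) + (binom v (2 + m) + (binom (suc m + v) m + 3))
formula-ℕ m v lin = begin
  E + (binom ((3 + m) + v) (2 + m) + binom ((2 + m) + v) (2 + m))
    ≡⟨ cong (λ z → E + z) (sym (trans (conv-+ (shift (binom (3 + m))) (shift (binom (2 + m))) v K) (cong₂ _+_ (sh (3 + m)) (sh (2 + m))))) ⟩
  E + conv (λ i → shift (binom (3 + m)) i + shift (binom (2 + m)) i) v K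
    ≡⟨ sym (conv-+ (extremal (suc m)) (λ i → shift (binom (3 + m)) i + shift (binom (2 + m)) i) v K) ⟩
  conv (λ i → extremal (suc m) i + (shift (binom (3 + m)) i + shift (binom (2 + m)) i)) v K
    ≡⟨ conv-cong v K lin ⟩
  conv (λ i → shift (binom ((2 + m) + (3 + m))) i + (shift (binom 0) i + (t i + top K i))) v K
    ≡⟨ conv-+ (shift (binom ((2 + m) + (3 + m)))) (λ i → shift (binom 0) i + (t i + top K i)) v K ⟩
  conv (shift (binom ((2 + m) + (3 + m)))) v K + conv (λ i → shift (binom 0) i + (t i + top K i)) v K
    ≡⟨ cong₂ _+_ (sh ((2 + m) + (3 + m))) (trans (conv-+ (shift (binom 0)) (λ i → t i + top K i) v K)
         (cong₂ _+_ (sh 0) (trans (conv-+ t (top K) v K) (cong₂ _+_ third-shift top-conv)))) ⟩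
  binom (((2 + m) + (3 + m)) + v) (2 + m) + (binom v (2 + m) + (binom (suc m + v) m + 3)) ∎
  where
  open ≡-Reasoning
  K E : ℕ
  K = 3 + m
  E = conv (extremal (suc m)) v K
  t : ℕ → ℕ
  t = shift (shift (shift (binom (suc m))))
  sh : ∀ a → conv (shift (binom a)) v K ≡ binom (a + v) (2 + m)
  sh a = trans (conv-shift (binom a) v (2 + m)) (conv-binom a v (2 + m))
  third-shift : conv t v K ≡ binom (suc m + v) m
  third-shift = trans (conv-shift (shift (shift (binom (suc m)))) v (2 + m)) (trans (conv-shift (shift (binom (suc m))) v (suc m))
    (trans (conv-shift (binom (suc m)) v m) (conv-binom (suc m) v m)))
  top-conv : conv (top K) v K ≡ 3
  top-conv = trans (conv-top (top K) v K (λ i l → cong (λ b → if b then 3 else 0) (dec-false (i ℕ.≟ K) (<⇒≢ l))))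
    (cong (λ b → if b then 3 else 0) (dec-true (K ℕ.≟ K) refl))

subtract : ∀ l a b c d e → l + (b + c) ≡ a + (d + (e + 3)) → + l ≡ (((+ a -ℤ + b) -ℤ + c) +ℤ + d) +ℤ + e +ℤ + 3
subtract l a b c d e h = begin
  + l  ≡⟨ solve 3 (λ l b c → l := (l :+ (b :+ c)) :- b :- c) refl (+ l) (+ b) (+ c) ⟩
  ((+ l +ℤ (+ b +ℤ + c)) -ℤ + b) -ℤ + c  ≡⟨ cong (λ z → (z -ℤ + b) -ℤ + c) (cong +_ h) ⟩
  ((+ a +ℤ (+ d +ℤ (+ e +ℤ + 3))) -ℤ + b) -ℤ + c  ≡⟨ solve 5 (λ a b c d e → ((a :+ (d :+ (e :+ con (+ 3)))) :- b) :- c := (((a :- b) :- c) :+ d) :+ e :+ con (+ 3)) refl (+ a) (+ b) (+ c) (+ d) (+ e) ⟩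
  (((+ a -ℤ + b) -ℤ + c) +ℤ + d) +ℤ + e +ℤ + 3  ∎
  where
  open ≡-Reasoning
  open ℤ-Solver.+-*-Solver using (solve; _:=_; _:+_; _:-_; con)

formula-ℤ : ∀ m v → Linear m → + conv (extremal (suc m)) v (3 + m) ≡
  (((+ ((((2 + m) + (3 + m)) + v) C (2 + m)) -ℤ + (((3 + m) + v) C (2 + m))) -ℤ + (((2 + m) + v) C (2 + m))) +ℤ + (v C (2 + m))) +ℤ + ((suc m + v) C m) +ℤ + 3
formula-ℤ m v lin = subtract (conv (extremal (suc m)) v (3 + m)) ((((2 + m) + (3 + m)) + v) C (2 + m)) (((3 + m) + v) C (2 + m)) (((2 + m) + v) C (2 + m)) (v C (2 + m)) ((suc m + v) C m)
  (trans (cong (λ z → conv (extremal (suc m)) v (3 + m) + z) (cong₂ _+_ (sym (binom≡C ((3 + m) + v) (2 + m))) (sym (binom≡C ((2 + m) + v) (2 + m)))))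
    (trans (formula-ℕ m v lin) (cong₂ _+_ (binom≡C (((2 + m) + (3 + m)) + v) (2 + m)) (cong₂ _+_ (binom≡C v (2 + m)) (cong (_+ 3) (binom≡C (suc m + v) m))))))

agree : (f g : ℕ → ℕ) (k : ℕ) → True (allUpTo? (λ i → f i ℕ.≟ g i) (suc k)) → ∀ i → i ≤ k → f i ≡ g i
agree f g k t i i≤k = toWitness t (s≤s i≤k)

-- The values 4, 5 and 6 of k

facts₄ : Facts 2 7
facts₄ = record
  { dim = refl ; 4≤k = ≤-refl ; van₁ = λ _ → refl ; van₂ = λ _ → refl ; van₃ = λ _ → refl ; vanᶜ = λ _ → refl
  ; size₁ = refl ; size₂ = refl ; size₃ = refl ; sizeᶜ = refl ; no₁ = refl ; no₂ = refl ; no₃ = refl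
  ; ₁∋2 = refl ; ₁∋3 = refl ; ₂∌3 = refl ; ₃∌2 = refl ; last = refl
  -- The point 2 is missing from `B₃`, the points 3 to `k+1` from `B₂`, and all others from `B₁`.
  ; empty = λ { 0 () _ _ ; 1 () _ _ ; 2 _ _ () ; 3 _ () _ ; 4 _ () _ ; 5 _ () _
              ; (suc (suc (suc (suc (suc (suc _)))))) () _ _ }
  ; counts = agree _ _ 4 tt }

facts₅ : Facts 3 9
facts₅ = record
  { dim = refl ; 4≤k = m≤m+n 4 1 ; van₁ = λ _ → refl ; van₂ = λ _ → refl ; van₃ = λ _ → refl ; vanᶜ = λ _ → refl
  ; size₁ = refl ; size₂ = refl ; size₃ = refl ; sizeᶜ = refl ; no₁ = refl ; no₂ = refl ; no₃ = refl
  ; ₁∋2 = refl ; ₁∋3 = refl ; ₂∌3 = refl ; ₃∌2 = refl ; last = refl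
  ; empty = λ { 0 () _ _ ; 1 () _ _ ; 2 _ _ () ; 3 _ () _ ; 4 _ () _ ; 5 _ () _ ; 6 _ () _
              ; (suc (suc (suc (suc (suc (suc (suc _))))))) () _ _ }
  ; counts = agree _ _ 5 tt }

facts₆ : Facts 4 11
facts₆ = record
  { dim = refl ; 4≤k = m≤m+n 4 2 ; van₁ = λ _ → refl ; van₂ = λ _ → refl ; van₃ = λ _ → refl ; vanᶜ = λ _ → refl
  ; size₁ = refl ; size₂ = refl ; size₃ = refl ; sizeᶜ = refl ; no₁ = refl ; no₂ = refl ; no₃ = refl
  ; ₁∋2 = refl ; ₁∋3 = refl ; ₂∌3 = refl ; ₃∌2 = refl ; last = refl
  ; empty = λ { 0 () _ _ ; 1 () _ _ ; 2 _ _ () ; 3 _ () _ ; 4 _ () _ ; 5 _ () _ ; 6 _ () _ ; 7 _ () _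
              ; (suc (suc (suc (suc (suc (suc (suc (suc _)))))))) () _ _ }
  ; counts = agree _ _ 6 tt }

Claim : ℕ → ℕ → Set
Claim k n = IsM n k 3 (length (𝒢 n k)) × (+ length (𝒢 n k) ≡ formula n k)

claim₄ : ∀ v → Claim 4 (8 + v)
claim₄ v = Family.isM facts₄ v main₄ , trans (cong +_ (Family.length-𝒢 facts₄ v)) (formula-ℤ 1 v (agree _ _ 4 tt))

claim₅ : ∀ v → Claim 5 (10 + v)
claim₅ v = Family.isM facts₅ v main₅ , trans (cong +_ (Family.length-𝒢 facts₅ v)) (formula-ℤ 2 v (agree _ _ 5 tt))

claim₆ : ∀ v → Claim 6 (12 + v)
claim₆ v = Family.isM facts₆ v main₆ , trans (cong +_ (Family.length-𝒢 facts₆ v)) (formula-ℤ 3 v (agree _ _ 6 tt))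

theorem1p9 : (k n : ℕ) → (k ≡ 4 ⊎ k ≡ 5 ⊎ k ≡ 6) → 2 * k ≤ n →
    IsM n k 3 (length (𝒢 n k)) × (+ length (𝒢 n k) ≡ formula n k)
theorem1p9 k n (inj₁ refl) h = subst (Claim 4) (m+[n∸m]≡n h) (claim₄ (n ∸ 8))
theorem1p9 k n (inj₂ (inj₁ refl)) h = subst (Claim 5) (m+[n∸m]≡n h) (claim₅ (n ∸ 10))
theorem1p9 k n (inj₂ (inj₂ refl)) h = subst (Claim 6) (m+[n∸m]≡n h) (claim₆ (n ∸ 12))
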